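{- Fix a root $e$ of $x^2+6x+3$ in $\mathbb{F}_{7^2}$. Every non-exceptional permutation polynomial of degree $7$ over $\mathbb{F}_{7^2}$ is linearly related to $$x^7+ex^5+e^{18}x^3+e^{35}x.$$ Every exceptional polynomial of degree $7$ over $\mathbb{F}_{7^2}$ is linearly related to exactly one of the following polynomials: (i) $x^7+ax$ with $a\in\{0,e,e^2,e^3,e^4,e^5\}$; (ii) $x^7+x^4+2x$, $\;x^7+e^2x^4+2e^4x$; (iii) $x^7+ex^5+5e^2x^3+6e^3x$.
   Context: A permutation polynomial (PP) over $\mathbb{F}_q$ is a polynomial $f\in\mathbb{F}_q[x]$ whose associated map $a\mapsto f(a)$ is a permutation of $\mathbb{F}_q$. An exceptional polynomial over $\mathbb{F}_q$ is a polynomial in $\mathbb{F}_q[x]$ which is a PP over $\mathbb{F}_{q^m}$ for infinitely many positive integers $m$; non-exceptional means not exceptional. Two polynomials $f,g\in\mathbb{F}_q[x]$ are linearly related if there exist $s,t\in\mathbb{F}_q^*=\mathbb{F}_q\setminus\{0\}$ and $u,v\in\mathbb{F}_q$ with $g(x)=sf(tx+u)+v$. -}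

module Defs where

open import Level as Level using (_⊔_)
open import Data.Nat.Base as ℕ using (ℕ; zero; suc; _<_)
open import Data.Fin.Base using (Fin)
open import Data.List.Base using (List; []; _∷_; map; replicate; _++_)
open import Data.Product.Base using (_×_; ∃-syntax)
open import Relation.Binary.Core using (Rel)
open import Relation.Binary.PropositionalEquality.Core using (_≡_)
open import Relation.Binary.PropositionalEquality.Properties using (setoid)
open import Function.Bundles using (Inverse)
open import Function.Definitions using (Bijective)
open import Algebra.Bundles using (CommutativeRing; Semiring)
open import Algebra.Apartness.Bundles using (HeytingField; HeytingCommutativeRing)
open import Algebra.Morphism.Structures using (IsRingMonomorphism)

-- On a Heyting field enumerated by some Fin q, equality is decidable and the
-- apartness _#_ coincides with _≉_, so this is the classical notion.
record FiniteField c ℓ₁ ℓ₂ : Set (Level.suc (c ⊔ ℓ₁ ⊔ ℓ₂)) where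
  field
    heytingField : HeytingField c ℓ₁ ℓ₂

  open HeytingField heytingField public using (heytingCommutativeRing)
  open HeytingCommutativeRing heytingCommutativeRing public using (commutativeRing)
  open CommutativeRing commutativeRing public
    renaming (setoid to ≈-setoid)

  field
    order       : ℕ
    enumeration : Inverse (setoid (Fin order)) ≈-setoid

module Polynomial {c ℓ} (R : CommutativeRing c ℓ) where
  open CommutativeRing R
  open import Algebra.Definitions.RawSemiring (Semiring.rawSemiring semiring) public
    using (_^_) renaming (_×_ to _·_)

  -- Coefficient lists, constant term first; trailing zeros are allowed and
  -- are disregarded by _≋_.
  Poly : Set c
  Poly = List Carrier

  coeff : Poly → ℕ → Carrier
  coeff []      _       = 0#
  coeff (a ∷ f) zero    = a
  coeff (a ∷ f) (suc n) = coeff f n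

  infix 4 _≋_
  _≋_ : Rel Poly ℓ
  f ≋ g = ∀ n → coeff f n ≈ coeff g n

  HasDegree : Poly → ℕ → Set ℓ
  HasDegree f n = coeff f n ≉ 0# × (∀ {m} → n < m → coeff f m ≈ 0#)

  ⟦_⟧ : Poly → Carrier → Carrier
  ⟦ []    ⟧ x = 0#
  ⟦ a ∷ f ⟧ x = a + x * ⟦ f ⟧ x

  infix 8 _X^_
  _X^_ : Carrier → ℕ → Poly
  a X^ n = replicate n 0# ++ a ∷ []

  infixl 6 _⊕_
  _⊕_ : Poly → Poly → Poly
  []      ⊕ g       = g
  (a ∷ f) ⊕ []      = a ∷ f
  (a ∷ f) ⊕ (b ∷ g) = (a + b) ∷ (f ⊕ g)

  infixl 7 _⊗_
  _⊗_ : Poly → Poly → Poly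
  []      ⊗ g = []
  (a ∷ f) ⊗ g = map (a *_) g ⊕ (0# ∷ (f ⊗ g))

  infixr 9 _⊚_
  _⊚_ : Poly → Poly → Poly
  []      ⊚ g = []
  (a ∷ f) ⊚ g = (a X^ 0) ⊕ g ⊗ (f ⊚ g)

  LinearlyRelated : Poly → Poly → Set (c ⊔ ℓ)
  LinearlyRelated f g =
    ∃[ s ] ∃[ t ] ∃[ u ] ∃[ v ] (s ≉ 0# × t ≉ 0# ×
      g ≋ (s X^ 0) ⊗ (f ⊚ (t X^ 1 ⊕ u X^ 0)) ⊕ v X^ 0)

module _ {c ℓ₁ ℓ₂} (K : FiniteField c ℓ₁ ℓ₂) where
  open FiniteField K
  open Polynomial commutativeRing

  IsPermutationPolynomial : Poly → Set (c ⊔ ℓ₁)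
  IsPermutationPolynomial f = Bijective _≈_ _≈_ ⟦ f ⟧

module _ {c ℓ₁ ℓ₂} (K : FiniteField c ℓ₁ ℓ₂) where
  private module K = FiniteField K
  open Polynomial K.commutativeRing

  -- The field with q^m elements is unique up to isomorphism over K and every
  -- two embeddings of K into it differ by an automorphism, so it does not
  -- matter which extension L of that order is used.
  IsPermutationPolynomialOverDegree : Poly → ℕ → Set (Level.suc (c ⊔ ℓ₁ ⊔ ℓ₂))
  IsPermutationPolynomialOverDegree f m =
    ∃[ L ] let module L = FiniteField {c} {ℓ₁} {ℓ₂} L in
      L.order ≡ K.order ℕ.^ m ×
      ∃[ ι ] IsRingMonomorphism K.rawRing L.rawRing ι ×
             IsPermutationPolynomial L (map ι f)

  Exceptional : Poly → Set (Level.suc (c ⊔ ℓ₁ ⊔ ℓ₂))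
  Exceptional f = ∀ N → ∃[ m ] N < m × IsPermutationPolynomialOverDegree f m

{-# OPTIONS --safe #-}

-- Let q = 7ʳ and k = Σ kᵢ 7ⁱ with base-7 digits kᵢ.  Up to sign, Σ f(x)ᵏ over 𝔽_q is the
-- sum of the coefficients of ∏ᵢ (f^kᵢ)^(σⁱ)(x^(7ⁱ)) at the positive multiples of q − 1, where
-- σ raises coefficients to the seventh power; these are computed digit by digit, with the
-- carries as states.  They vanish if f permutes 𝔽_q and 0 < k < q − 1 (Hermite's criterion).
-- For q = 49 the exponents 8 = 1 + 7 · 1 and 10 = 3 + 7 · 1 leave so few candidates among the
-- normalised polynomials of degree 7 that they can be searched: ten permutation polynomials
-- remain.  For q = 49ᵐ with m ≥ 2 the digits 3, 3, 2, 2, …, 2 show that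
-- x⁷ + ex⁵ + e¹⁸x³ + e³⁵x is no permutation.  Apart from x⁷ the other nine are
-- x (xⁿ − a)ʳ with n r = 6, which permutes every field in which a is not an n-th power; a stays
-- a non-cube in towers of quadratic extensions and a non-square in towers of cubic ones.
module Submission where

open import Level using (Level; _⊔_; Lift; lift)
open import Defs
open import Data.Nat.Base as ℕ using (ℕ; zero; suc; _%_; _/_; s≤s; z≤n; _≡ᵇ_; NonZero)
import Data.Nat.Properties as ℕ
open import Data.Nat.Divisibility using (_∣_; _∣?_; divides; _∤_; divides-refl; ∣m+n∣m⇒∣n; ∣-refl; n∣m*n; *-cancelˡ-∣; ∣-trans)
open import Data.List.Base using (List; []; _∷_; map; length; replicate; upTo; allFin; cartesianProduct)
open import Data.List.Properties using (map-id; length-++; length-replicate; length-map)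
open import Data.Bool.Base using (Bool; true; false; _∧_; if_then_else_; T; _∨_; not)
open import Data.Product using (_×_; _,_; proj₁; proj₂; ∃; ∃-syntax; ∃!)
open import Relation.Nullary.Decidable using (does; yes; no; Dec; map′; dec-true; dec-false; False; toWitnessFalse; fromWitnessFalse; decidable-stable; _×-dec_; toWitness)
open import Relation.Binary.PropositionalEquality.Core as ≡ using (_≡_; _≢_)
open import Function.Base using (id; _∘_; case_of_)
open import Algebra.Bundles using (CommutativeRing; RawRing; CommutativeMonoid; AbelianGroup)
open import Algebra.Morphism.Structures using (IsRingMonomorphism; IsRingHomomorphism)
import Algebra.Morphism.Construct.Identity as Identity
import Algebra.Properties.CommutativeSemiring.Exp as Exp
import Algebra.Solver.Ring.NaturalCoefficients.Default as NaturalSolver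
import Relation.Binary.Reasoning.Setoid as SetoidReasoning
open import Data.Nat.DivMod using (m≡m%n+[m/n]*n; m%n<n; m*n/n≡m; m<n*o⇒m/o<n)
open import Data.Product.Properties using (≡-dec)
open import Data.Maybe.Base using (Maybe; just; nothing; is-just; maybe′)
open import Data.Vec.Base as Vec using (Vec; []; _∷_; _∷ʳ_; lookup)
open import Data.Vec.N-ary using (N-ary; _$ⁿ_; curryⁿ; Eq; curryⁿ-cong)
open import Algebra.Solver.Ring.AlmostCommutativeRing using (fromCommutativeRing; _-Raw-AlmostCommutative⟶_)
import Algebra.Solver.Ring
import Algebra.Properties.Semiring.Mult as Mult
import Algebra.Properties.Group as GroupProperties
open import Data.Fin.Base as Fin using (Fin; punchIn; combine; remQuot; zero; suc; inject₁; toℕ)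
import Data.Fin.Properties as Fin
open import Data.Fin.Permutation using (Permutation′; permutation)
open import Data.Sum.Base using (_⊎_; inj₁; inj₂; [_,_]′)
open import Data.Empty using (⊥; ⊥-elim)
open import Relation.Nullary.Negation.Core using (¬_; contradiction)
open import Function.Bundles using (Inverse; Equivalence)
open import Function.Definitions using (Injective; Bijective)
open import Algebra.Apartness.Bundles using (HeytingField)
import Algebra.Properties.CommutativeMonoid.Sum as Sum
import Algebra.Properties.Semiring.Sum as SemiringSum
import Algebra.Properties.Ring as RingProperties
open import Data.Nat.Tactic.RingSolver using (solve-∀)
open import Data.Product.Relation.Binary.Pointwise.NonDependent using (×-setoid; ×-decidable)
open import Relation.Binary.Bundles using (Setoid)
import Relation.Binary.PropositionalEquality.Properties as ≡ₚ
open import Algebra.Construct.DirectProduct using (abelianGroup)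
import Algebra.Morphism.Construct.Composition as Composition
import Algebra.Consequences.Setoid as Consequences
open import Data.Bool.ListAction using (all; any)
open import Data.Bool.Properties using (T-≡; T-∧; T-∨)
open import Data.List.Membership.Propositional using (_∈_; find)
open import Data.List.Membership.Propositional.Properties using (∈-upTo⁺; ∈-cartesianProduct⁺; ∈-allFin)
open import Data.List.Relation.Unary.Any using (Any; here; there)
import Data.List.Relation.Unary.All as All
open import Data.List.Relation.Unary.All.Properties using (all⁺)
open import Data.List.Relation.Unary.Any.Properties using (any⁻)
open import Data.List.Relation.Binary.Pointwise as Pointwise using (Pointwise; []; _∷_)
open import Data.Fin.Patterns
open import Data.Fin.Relation.Unary.Top using (view; ‵fromℕ; ‵inject₁)

-- In characteristic 7 a translation acts on x⁷ only through the constant term, so it cannot remove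
-- the x⁶-coefficient; the exponent 8 is there for that. A leading lower term b xʲ with j ≤ 5 does
-- let a translation remove the next coefficient, j being a unit modulo 7, and scaling moves b
-- through a coset of the (7 - j)-th powers. The family with j = 5 keeps three free coefficients,
-- too many to search; the exponent 10 determines one of them. Only the coefficients at Q and 2 Q,
-- where Q = q - 1, enter a power sum while the degree stays below 3 Q. Digits 3 throughout would
-- exceed this, digits 2 do not. But with digits 2 alone the two coefficients are μᵐ and (-μ)ᵐ for q
-- = 49ᵐ, which cancel for odd m; two digits 3 break the symmetry. Digits come in pairs because σ²
-- fixes 𝔽₄₉: every pair of digits 2 has the same transfer matrix, and m enters only through a power
-- of an eigenvalue. Exceptionality asks only for infinitely many m, so towers with one fixed step
-- degree suffice; norms keep non-powers alive, that degree being prime to the exponent.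

-- Coefficient lists: evaluation, degree and substitution

module PolynomialProperties {c ℓ} (R : CommutativeRing c ℓ) where
  open CommutativeRing R
  open Polynomial R

  ⟦⟧-cong : ∀ p {x y} → x ≈ y → ⟦ p ⟧ x ≈ ⟦ p ⟧ y
  ⟦⟧-cong []      x≈y = refl
  ⟦⟧-cong (a ∷ p) x≈y = +-congˡ (*-cong x≈y (⟦⟧-cong p x≈y))

  ⟦⟧-zero : ∀ p x → (∀ n → coeff p n ≈ 0#) → ⟦ p ⟧ x ≈ 0#
  ⟦⟧-zero []      x p≋0 = refl
  ⟦⟧-zero (a ∷ p) x p≋0 =
    trans (+-cong (p≋0 0) (trans (*-congˡ (⟦⟧-zero p x (p≋0 ∘ suc))) (zeroʳ x))) (+-identityˡ 0#)

  ⟦⟧-≋ : ∀ p q x → p ≋ q → ⟦ p ⟧ x ≈ ⟦ q ⟧ x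
  ⟦⟧-≋ []      q       x p≋q = sym (⟦⟧-zero q x (λ n → sym (p≋q n)))
  ⟦⟧-≋ (a ∷ p) []      x p≋q = ⟦⟧-zero (a ∷ p) x p≋q
  ⟦⟧-≋ (a ∷ p) (b ∷ q) x p≋q = +-cong (p≋q 0) (*-congˡ (⟦⟧-≋ p q x (p≋q ∘ suc)))

  coeff-⊕ : ∀ p q n → coeff (p ⊕ q) n ≈ coeff p n + coeff q n
  coeff-⊕ []      q       n       = sym (+-identityˡ _)
  coeff-⊕ (a ∷ p) []      n       = sym (+-identityʳ _)
  coeff-⊕ (a ∷ p) (b ∷ q) zero    = refl
  coeff-⊕ (a ∷ p) (b ∷ q) (suc n) = coeff-⊕ p q n

  coeff-scale : ∀ a p n → coeff (map (a *_) p) n ≈ a * coeff p n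
  coeff-scale a []      n       = sym (zeroʳ a)
  coeff-scale a (b ∷ p) zero    = refl
  coeff-scale a (b ∷ p) (suc n) = coeff-scale a p n

  DegreeBelow : Poly → ℕ → Set ℓ
  DegreeBelow p n = ∀ {m} → n ℕ.≤ m → coeff p m ≈ 0#

  ⊕-degree : ∀ p q {n} → DegreeBelow p n → DegreeBelow q n → DegreeBelow (p ⊕ q) n
  ⊕-degree p q dp dq {m} n≤m =
    trans (coeff-⊕ p q m) (trans (+-cong (dp n≤m) (dq n≤m)) (+-identityˡ 0#))

  scale-degree : ∀ a p {n} → DegreeBelow p n → DegreeBelow (map (a *_) p) n
  scale-degree a p dp {m} n≤m = trans (coeff-scale a p m) (trans (*-congˡ (dp n≤m)) (zeroʳ a))

  shift-degree : ∀ p {n} → DegreeBelow p n → DegreeBelow (0# ∷ p) (suc n)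
  shift-degree p dp (s≤s n≤m) = dp n≤m

  suc-degree : ∀ p {n} → DegreeBelow p n → DegreeBelow p (suc n)
  suc-degree p dp n<m = dp (ℕ.<⇒≤ n<m)

  []-degree : ∀ n → DegreeBelow (0# ∷ []) n
  []-degree n {zero}  _ = refl
  []-degree n {suc m} _ = refl

  singleton-degree : ∀ a {n} → DegreeBelow (a ∷ []) (suc n)
  singleton-degree a (s≤s _) = refl

  linear-⊗-degree : ∀ u t p {n} → DegreeBelow p n → DegreeBelow ((t X^ 1 ⊕ u X^ 0) ⊗ p) (suc n)
  linear-⊗-degree u t p {n} dp = ⊕-degree (map ((0# + u) *_) p) (0# ∷ (map (t *_) p ⊕ (0# ∷ [])))
    (suc-degree (map ((0# + u) *_) p) (scale-degree (0# + u) p dp))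
    (shift-degree (map (t *_) p ⊕ (0# ∷ [])) (⊕-degree (map (t *_) p) (0# ∷ []) (scale-degree t p dp) ([]-degree n)))

  linear-⊚-degree : ∀ f u t {n} → DegreeBelow f n → DegreeBelow (f ⊚ (t X^ 1 ⊕ u X^ 0)) n
  linear-⊚-degree []      u t         df _ = refl
  -- A nonempty list may still represent 0. Multiplying by the linear factor gives only the bound 1,
  -- so the constant coefficient is treated by hand.
  linear-⊚-degree (a ∷ f) u t {zero}  df {m} _ = ⊕-degree (a ∷ []) ((t X^ 1 ⊕ u X^ 0) ⊗ g)
    (λ { {zero} _ → df {0} z≤n ; {suc _} _ → refl })
    (λ {m} _ → ⟨⊗⟩ m)
    {m} z≤n
    where
    g = f ⊚ (t X^ 1 ⊕ u X^ 0)
    dg : DegreeBelow g 0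
    dg = linear-⊚-degree f u t (λ {m} _ → df {suc m} z≤n)
    ⟨⊗⟩ : ∀ m → coeff ((t X^ 1 ⊕ u X^ 0) ⊗ g) m ≈ 0#
    ⟨⊗⟩ zero    = trans (coeff-⊕ (map ((0# + u) *_) g) (0# ∷ (map (t *_) g ⊕ (0# ∷ []))) 0)
                    (trans (+-identityʳ _) (scale-degree (0# + u) g dg z≤n))
    ⟨⊗⟩ (suc m) = linear-⊗-degree u t g dg (s≤s z≤n)
  linear-⊚-degree (a ∷ f) u t {suc n} df = ⊕-degree (a ∷ []) ((t X^ 1 ⊕ u X^ 0) ⊗ (f ⊚ (t X^ 1 ⊕ u X^ 0)))
    (singleton-degree a)
    (linear-⊗-degree u t (f ⊚ (t X^ 1 ⊕ u X^ 0)) (linear-⊚-degree f u t (λ n≤m → df (s≤s n≤m))))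

  constant-⊗-degree : ∀ s p {n} → DegreeBelow p n → DegreeBelow (s X^ 0 ⊗ p) n
  constant-⊗-degree s p {n} dp = ⊕-degree (map (s *_) p) (0# ∷ []) (scale-degree s p dp) ([]-degree n)

-- Evaluation after mapping coefficients along a homomorphism: one set of lemmas serves K itself,
-- with the identity, and all extensions of K.
module Evaluation {c₁ ℓ₁ c₂ ℓ₂} (R : CommutativeRing c₁ ℓ₁) (S : CommutativeRing c₂ ℓ₂) where
  private
    module R = CommutativeRing R
    module PR = Polynomial R
    module PS = Polynomial S
  open CommutativeRing S
  open PS using (⟦_⟧; _^_)

  module _ {ι : R.Carrier → Carrier} (ι-hom : IsRingHomomorphism R.rawRing (CommutativeRing.rawRing S) ι) where
    open IsRingHomomorphism ι-hom using (⟦⟧-cong; +-homo; *-homo; 0#-homo)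
    open SetoidReasoning setoid
    open NaturalSolver commutativeSemiring using (solve; _:+_; _:*_; _:=_)

    map-≋ : ∀ {p q} → p PR.≋ q → map ι p PS.≋ map ι q
    map-≋ {p} {q} p≋q n = trans (sym (lemma p n)) (trans (⟦⟧-cong (p≋q n)) (lemma q n))
      where
      lemma : ∀ p n → ι (PR.coeff p n) ≈ PS.coeff (map ι p) n
      lemma []      n       = 0#-homo
      lemma (a ∷ p) zero    = refl
      lemma (a ∷ p) (suc n) = lemma p n

    eval-⊕ : ∀ p q y → ⟦ map ι (p PR.⊕ q) ⟧ y ≈ ⟦ map ι p ⟧ y + ⟦ map ι q ⟧ y
    eval-⊕ []      q       y = sym (+-identityˡ _)
    eval-⊕ (a ∷ p) []      y = sym (+-identityʳ _)
    eval-⊕ (a ∷ p) (b ∷ q) y = trans (+-cong (+-homo a b) (*-congˡ (eval-⊕ p q y)))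
      (solve 5 (λ a b y p q → (a :+ b) :+ y :* (p :+ q) := (a :+ y :* p) :+ (b :+ y :* q)) refl (ι a) (ι b) y _ _)

    eval-scale : ∀ a p y → ⟦ map ι (map (a R.*_) p) ⟧ y ≈ ι a * ⟦ map ι p ⟧ y
    eval-scale a []      y = sym (zeroʳ _)
    eval-scale a (b ∷ p) y = trans (+-cong (*-homo a b) (*-congˡ (eval-scale a p y)))
      (solve 4 (λ a b y p → a :* b :+ y :* (a :* p) := a :* (b :+ y :* p)) refl (ι a) (ι b) y _)

    eval-shift : ∀ p y → ⟦ map ι (R.0# ∷ p) ⟧ y ≈ y * ⟦ map ι p ⟧ y
    eval-shift p y = trans (+-congʳ 0#-homo) (+-identityˡ _)

    eval-⊗ : ∀ p q y → ⟦ map ι (p PR.⊗ q) ⟧ y ≈ ⟦ map ι p ⟧ y * ⟦ map ι q ⟧ y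
    eval-⊗ []      q y = sym (zeroˡ _)
    eval-⊗ (a ∷ p) q y = begin
      ⟦ map ι (map (a R.*_) q PR.⊕ (R.0# ∷ (p PR.⊗ q))) ⟧ y
        ≈⟨ eval-⊕ (map (a R.*_) q) (R.0# ∷ (p PR.⊗ q)) y ⟩
      ⟦ map ι (map (a R.*_) q) ⟧ y + ⟦ map ι (R.0# ∷ (p PR.⊗ q)) ⟧ y
        ≈⟨ +-cong (eval-scale a q y) (trans (eval-shift (p PR.⊗ q) y) (*-congˡ (eval-⊗ p q y))) ⟩
      ι a * ⟦ map ι q ⟧ y + y * (⟦ map ι p ⟧ y * ⟦ map ι q ⟧ y)
        ≈⟨ solve 4 (λ a y p q → a :* q :+ y :* (p :* q) := (a :+ y :* p) :* q) refl (ι a) y _ _ ⟩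
      (ι a + y * ⟦ map ι p ⟧ y) * ⟦ map ι q ⟧ y ∎

    eval-X^ : ∀ a n y → ⟦ map ι (a PR.X^ n) ⟧ y ≈ ι a * y ^ n
    eval-X^ a zero    y = trans (+-congˡ (zeroʳ y)) (trans (+-identityʳ _) (sym (*-identityʳ _)))
    eval-X^ a (suc n) y = trans (eval-shift (a PR.X^ n) y) (trans (*-congˡ (eval-X^ a n y))
      (solve 3 (λ a y p → y :* (a :* p) := a :* (y :* p)) refl (ι a) y _))

    eval-⊚ : ∀ p q y → ⟦ map ι (p PR.⊚ q) ⟧ y ≈ ⟦ map ι p ⟧ (⟦ map ι q ⟧ y)
    eval-⊚ []      q y = refl
    eval-⊚ (a ∷ p) q y = trans (eval-⊕ (a ∷ []) (q PR.⊗ (p PR.⊚ q)) y)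
      (+-cong (trans (+-congˡ (zeroʳ y)) (+-identityʳ _))
        (trans (eval-⊗ q (p PR.⊚ q) y) (*-congˡ (eval-⊚ p q y))))

    eval-linear : ∀ f s t u v y →
      ⟦ map ι (s PR.X^ 0 PR.⊗ (f PR.⊚ (t PR.X^ 1 PR.⊕ u PR.X^ 0)) PR.⊕ v PR.X^ 0) ⟧ y ≈
      ι s * ⟦ map ι f ⟧ (ι t * y + ι u) + ι v
    eval-linear f s t u v y = trans (eval-⊕ (s PR.X^ 0 PR.⊗ g) (v PR.X^ 0) y)
      (+-cong
        (trans (eval-⊗ (s PR.X^ 0) g y) (*-cong (constant s) (trans (eval-⊚ f (t PR.X^ 1 PR.⊕ u PR.X^ 0) y)
          (PolynomialProperties.⟦⟧-cong S (map ι f) (trans (eval-⊕ (t PR.X^ 1) (u PR.X^ 0) y)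
            (+-cong (trans (eval-X^ t 1 y) (*-congˡ (*-identityʳ y))) (constant u)))))))
        (constant v))
      where
      g = f PR.⊚ (t PR.X^ 1 PR.⊕ u PR.X^ 0)
      constant : ∀ a → ⟦ map ι (a PR.X^ 0) ⟧ y ≈ ι a
      constant a = trans (eval-X^ a 0 y) (*-identityʳ _)

-- Coefficients of digit products by carries in base 7

module Transfer {a} {A : Set a} (_+_ _*_ : A → A → A) (0# 1# : A) where

  δ : ℕ → ℕ → A
  δ m n = if m ≡ᵇ n then 1# else 0#

  -- Σⱼ cⱼ h ((s + j) / 7), over those j for which the division is exact.
  step : List A → (ℕ → A) → ℕ → A
  step []      h s = 0#
  step (a ∷ c) h s = (a * (if does (7 ∣? s) then h (s / 7) else 0#)) + step c h (suc s)

  -- The coefficient of ∏ᵢ cᵢ(x^(7ⁱ)) at the exponent 7ʳ s₀ - s, where r is the number of digits;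
  -- the state s is a carry. For s = s₀ the exponent is s₀ (7ʳ - 1). Only bare operations are
  -- assumed, because this is run on field elements, on solver expressions and on codes.
  W : List (List A) → ℕ → ℕ → A
  W []       s₀ s = δ s s₀
  W (c ∷ cs) s₀ s = step c (W cs s₀) s

-- Computable arithmetic of 𝔽₄₉ and its interpretation in a ring

-- (a , b) stands for a + b e with e² = e + 4, coefficients modulo 7.
Code : Set
Code = ℕ × ℕ

infixl 6 _⊞_
infixl 7 _⊠_
infixr 8 _⊠^_

_⊞_ _⊠_ : Code → Code → Code
(a , b) ⊞ (c , d) = (a ℕ.+ c) % 7 , (b ℕ.+ d) % 7
(a , b) ⊠ (c , d) = (a ℕ.* c ℕ.+ 4 ℕ.* (b ℕ.* d)) % 7 , (a ℕ.* d ℕ.+ b ℕ.* c ℕ.+ b ℕ.* d) % 7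

⊟_ : Code → Code
⊟ (a , b) = (6 ℕ.* a) % 7 , (6 ℕ.* b) % 7

0c 1c ec : Code
0c = 0 , 0
1c = 1 , 0
ec = 0 , 1

_⊠^_ : Code → ℕ → Code
x ⊠^ zero  = 1c
x ⊠^ suc n = x ⊠ x ⊠^ n

codeRing : RawRing _ _
codeRing = record
  { Carrier = Code ; _≈_ = _≡_ ; _+_ = _⊞_ ; _*_ = _⊠_ ; -_ = ⊟_ ; 0# = 0c ; 1# = 1c }

-- What is needed to interpret codes in R. It passes along homomorphisms, so every extension of K
-- inherits it.
record F₄₉Algebra {c ℓ} (R : CommutativeRing c ℓ) : Set (c ⊔ ℓ) where
  open CommutativeRing R
  open Polynomial R
  field
    e      : Carrier
    7≈0    : 7 · 1# ≈ 0#
    e-root : e ^ 2 + 6 · e + 3 · 1# ≈ 0#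

module Scalars {c ℓ} (R : CommutativeRing c ℓ) (S : F₄₉Algebra R) where
  open CommutativeRing R
  open Polynomial R
  open F₄₉Algebra S

  open Mult semiring using (×-homo-+; ×1-homo-*)
  open SetoidReasoning setoid
  private
    module N = NaturalSolver commutativeSemiring

  ⟪_⟫ : ℕ → Carrier
  ⟪ n ⟫ = n · 1#

  -- The images of 0c and 1c are definitionally 0# and 1#, so that these may
  -- appear as constants in goals handed to the ring solver.
  φ : Code → Carrier
  φ (a , suc b) = ⟪ a ⟫ + ⟪ suc b ⟫ * e
  φ (1 , zero)  = 1#
  φ (a , zero)  = ⟪ a ⟫

  φ-def : ∀ a b → φ (a , b) ≈ ⟪ a ⟫ + ⟪ b ⟫ * e
  φ-def a             (suc b) = refl
  φ-def 0             zero    = sym (trans (+-congˡ (zeroˡ e)) (+-identityʳ _))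
  φ-def 1             zero    = sym (trans (+-congˡ (zeroˡ e)) (trans (+-identityʳ _) (+-identityʳ 1#)))
  φ-def (suc (suc a)) zero    = sym (trans (+-congˡ (zeroˡ e)) (+-identityʳ _))

  ⟪⟫-% : ∀ n → ⟪ n % 7 ⟫ ≈ ⟪ n ⟫
  ⟪⟫-% n = sym (begin
    ⟪ n ⟫                             ≡⟨ ≡.cong ⟪_⟫ (m≡m%n+[m/n]*n n 7) ⟩
    ⟪ n % 7 ℕ.+ n / 7 ℕ.* 7 ⟫         ≈⟨ ×-homo-+ 1# (n % 7) _ ⟩
    ⟪ n % 7 ⟫ + ⟪ n / 7 ℕ.* 7 ⟫       ≈⟨ +-congˡ (×1-homo-* (n / 7) 7) ⟩
    ⟪ n % 7 ⟫ + ⟪ n / 7 ⟫ * ⟪ 7 ⟫     ≈⟨ +-congˡ (*-congˡ 7≈0) ⟩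
    ⟪ n % 7 ⟫ + ⟪ n / 7 ⟫ * 0#        ≈⟨ +-congˡ (zeroʳ _) ⟩
    ⟪ n % 7 ⟫ + 0#                    ≈⟨ +-identityʳ _ ⟩
    ⟪ n % 7 ⟫                         ∎)

  ⟪⟫-+ : ∀ m n → ⟪ m ℕ.+ n ⟫ ≈ ⟪ m ⟫ + ⟪ n ⟫
  ⟪⟫-+ = ×-homo-+ 1#

  ⟪⟫-* : ∀ m n → ⟪ m ℕ.* n ⟫ ≈ ⟪ m ⟫ * ⟪ n ⟫
  ⟪⟫-* = ×1-homo-*

  φ-% : ∀ a b → φ (a % 7 , b % 7) ≈ ⟪ a ⟫ + ⟪ b ⟫ * e
  φ-% a b = trans (φ-def (a % 7) (b % 7)) (+-cong (⟪⟫-% a) (*-congʳ (⟪⟫-% b)))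

  7*≈0 : ∀ x → x * ⟪ 7 ⟫ ≈ 0#
  7*≈0 x = trans (*-congˡ 7≈0) (zeroʳ x)

  e² : e * e ≈ e + ⟪ 4 ⟫
  e² = begin
    e * e                                ≈⟨ +-identityʳ _ ⟨
    -- Over the naturals there is no subtraction, so 7 (e + 1) = 0 is added first: e² + 7 e + 7 =
    -- (e² + 6 e + 3) + (e + 4).
    e * e + 0#                           ≈⟨ +-congˡ (7*≈0 (e + 1#)) ⟨
    e * e + (e + 1#) * ⟪ 7 ⟫             ≈⟨ N.solve 1 (λ e → e N.:* e N.:+ (e N.:+ N.con 1) N.:* (7 N.:× N.con 1) N.:=
                                              (e N.:^ 2 N.:+ (6 N.:× e) N.:+ (3 N.:× N.con 1)) N.:+ (e N.:+ (4 N.:× N.con 1))) refl e ⟩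
    (e ^ 2 + 6 · e + ⟪ 3 ⟫) + (e + ⟪ 4 ⟫) ≈⟨ +-congʳ e-root ⟩
    0# + (e + ⟪ 4 ⟫)                     ≈⟨ +-identityˡ _ ⟩
    e + ⟪ 4 ⟫                            ∎

  φ-⊞ : ∀ x y → φ (x ⊞ y) ≈ φ x + φ y
  φ-⊞ (a , b) (c , d) = begin
    φ ((a , b) ⊞ (c , d))                         ≈⟨ φ-% (a ℕ.+ c) (b ℕ.+ d) ⟩
    ⟪ a ℕ.+ c ⟫ + ⟪ b ℕ.+ d ⟫ * e                 ≈⟨ +-cong (⟪⟫-+ a c) (*-congʳ (⟪⟫-+ b d)) ⟩
    (⟪ a ⟫ + ⟪ c ⟫) + (⟪ b ⟫ + ⟪ d ⟫) * e         ≈⟨ N.solve 5 (λ a b c d e → (a N.:+ c) N.:+ (b N.:+ d) N.:* e N.:=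
                                                       (a N.:+ b N.:* e) N.:+ (c N.:+ d N.:* e)) refl ⟪ a ⟫ ⟪ b ⟫ ⟪ c ⟫ ⟪ d ⟫ e ⟩
    (⟪ a ⟫ + ⟪ b ⟫ * e) + (⟪ c ⟫ + ⟪ d ⟫ * e)     ≈⟨ +-cong (φ-def a b) (φ-def c d) ⟨
    φ (a , b) + φ (c , d)                         ∎

  φ-⊠ : ∀ x y → φ (x ⊠ y) ≈ φ x * φ y
  φ-⊠ (a , b) (c , d) = begin
    φ ((a , b) ⊠ (c , d))
      ≈⟨ φ-% (a ℕ.* c ℕ.+ 4 ℕ.* (b ℕ.* d)) (a ℕ.* d ℕ.+ b ℕ.* c ℕ.+ b ℕ.* d) ⟩
    ⟪ a ℕ.* c ℕ.+ 4 ℕ.* (b ℕ.* d) ⟫ + ⟪ a ℕ.* d ℕ.+ b ℕ.* c ℕ.+ b ℕ.* d ⟫ * e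
      ≈⟨ +-cong
           (trans (⟪⟫-+ (a ℕ.* c) _) (+-cong (⟪⟫-* a c) (trans (⟪⟫-* 4 (b ℕ.* d)) (*-congˡ (⟪⟫-* b d)))))
           (*-congʳ (trans (⟪⟫-+ (a ℕ.* d ℕ.+ b ℕ.* c) _)
             (+-cong (trans (⟪⟫-+ (a ℕ.* d) _) (+-cong (⟪⟫-* a d) (⟪⟫-* b c))) (⟪⟫-* b d)))) ⟩
    (A * C + ⟪ 4 ⟫ * (B * D)) + (A * D + B * C + B * D) * e
      ≈⟨ N.solve 6 (λ a b c d e f → (a N.:* c N.:+ f N.:* (b N.:* d)) N.:+ (a N.:* d N.:+ b N.:* c N.:+ b N.:* d) N.:* e N.:=
           (a N.:* c N.:+ (a N.:* d N.:+ b N.:* c) N.:* e) N.:+ b N.:* d N.:* (e N.:+ f)) refl A B C D e ⟪ 4 ⟫ ⟩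
    (A * C + (A * D + B * C) * e) + B * D * (e + ⟪ 4 ⟫)
      ≈⟨ +-congˡ (*-congˡ e²) ⟨
    (A * C + (A * D + B * C) * e) + B * D * (e * e)
      ≈⟨ N.solve 5 (λ a b c d e → (a N.:* c N.:+ (a N.:* d N.:+ b N.:* c) N.:* e) N.:+ b N.:* d N.:* (e N.:* e) N.:=
           (a N.:+ b N.:* e) N.:* (c N.:+ d N.:* e)) refl A B C D e ⟩
    (A + B * e) * (C + D * e)
      ≈⟨ *-cong (φ-def a b) (φ-def c d) ⟨
    φ (a , b) * φ (c , d) ∎
    where
    A = ⟪ a ⟫
    B = ⟪ b ⟫
    C = ⟪ c ⟫
    D = ⟪ d ⟫

  φ-e : φ ec ≈ e
  φ-e = trans (+-identityˡ _) (trans (*-congʳ (+-identityʳ 1#)) (*-identityˡ e))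

  φ-⊟ : ∀ x → φ (⊟ x) ≈ - φ x
  φ-⊟ x@(a , b) = GroupProperties.inverseˡ-unique +-group (φ (⊟ x)) (φ x) (begin
    φ (⊟ x) + φ x                                  ≈⟨ +-cong (φ-% (6 ℕ.* a) (6 ℕ.* b)) (φ-def a b) ⟩
    (⟪ 6 ℕ.* a ⟫ + ⟪ 6 ℕ.* b ⟫ * e) + (⟪ a ⟫ + ⟪ b ⟫ * e)
      ≈⟨ +-congʳ (+-cong (⟪⟫-* 6 a) (*-congʳ (⟪⟫-* 6 b))) ⟩
    (⟪ 6 ⟫ * ⟪ a ⟫ + ⟪ 6 ⟫ * ⟪ b ⟫ * e) + (⟪ a ⟫ + ⟪ b ⟫ * e)
      ≈⟨ N.solve 3 (λ a b e → ((6 N.:× N.con 1) N.:* a N.:+ (6 N.:× N.con 1) N.:* b N.:* e) N.:+ (a N.:+ b N.:* e) N.:=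
           (a N.:+ b N.:* e) N.:* (7 N.:× N.con 1)) refl ⟪ a ⟫ ⟪ b ⟫ e ⟩
    (⟪ a ⟫ + ⟪ b ⟫ * e) * ⟪ 7 ⟫                    ≈⟨ 7*≈0 _ ⟩
    0#                                             ∎)

  φ-^ : ∀ x n → φ (x ⊠^ n) ≈ φ x ^ n
  φ-^ x zero    = refl
  φ-^ x (suc n) = trans (φ-⊠ x (x ⊠^ n)) (*-congˡ (φ-^ x n))

  private
    coeff≟ : ∀ x y → Maybe (φ x ≈ φ y)
    coeff≟ x y with ≡-dec ℕ._≟_ ℕ._≟_ x y
    ... | yes x≡y = just (reflexive (≡.cong φ x≡y))
    ... | no  _   = nothing

    φ-morphism : codeRing -Raw-AlmostCommutative⟶ fromCommutativeRing R
    φ-morphism = record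
      { ⟦_⟧ = φ ; +-homo = φ-⊞ ; *-homo = φ-⊠ ; -‿homo = φ-⊟ ; 0-homo = refl ; 1-homo = refl }

  module Solver = Algebra.Solver.Ring codeRing (fromCommutativeRing R) φ-morphism coeff≟

  open Solver using (_:=_; _:+_; _:^_)

  private
    closed : ∀ n → N-ary n (Solver.Polynomial n) (Solver.Polynomial n × Solver.Polynomial n) →
      Solver.Polynomial n × Solver.Polynomial n
    closed n f = f $ⁿ Vec.map Solver.var (Vec.allFin n)

    normalForms-agree : ∀ {n} (p q : Solver.Polynomial n) → is-just (Solver.normalise p Solver.≟N Solver.normalise q) ≡ true →
      ∀ ρ → Solver.⟦ p ⟧ ρ ≈ Solver.⟦ q ⟧ ρ
    normalForms-agree p q eq ρ with Solver.normalise p Solver.≟N Solver.normalise q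
    ... | just p≈q = trans (sym (Solver.correct p ρ)) (trans (Solver.⟦ p≈q ⟧N-cong ρ) (Solver.correct q ρ))

  -- In contrast to Solver.solve the normal forms are compared by computation, which keeps
  -- them out of the proof terms.
  solve : ∀ n (f : N-ary n (Solver.Polynomial n) (Solver.Polynomial n × Solver.Polynomial n)) →
    is-just (Solver.normalise (proj₁ (closed n f)) Solver.≟N Solver.normalise (proj₂ (closed n f))) ≡ true →
    Eq n _≈_ (curryⁿ Solver.⟦ proj₁ (closed n f) ⟧) (curryⁿ Solver.⟦ proj₂ (closed n f) ⟧)
  solve n f eq = curryⁿ-cong _≈_ Solver.⟦ proj₁ (closed n f) ⟧ Solver.⟦ proj₂ (closed n f) ⟧
    (normalForms-agree (proj₁ (closed n f)) (proj₂ (closed n f)) eq)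

  -- The coefficients of the solver are codes, so the inner binomial coefficients are already 0
  -- modulo 7 in the normal form.
  frobenius-+ : ∀ x y → (x + y) ^ 7 ≈ x ^ 7 + y ^ 7
  frobenius-+ = solve 2 (λ x y → (x :+ y) :^ 7 := x :^ 7 :+ y :^ 7) ≡.refl

-- Finite fields: inverses, sums and products over all elements, roots

-- If y were missed, punching it out of the codomain would inject a finite set into a smaller one.
injective⇒surjective : ∀ {n} (f : Fin n → Fin n) → Injective _≡_ _≡_ f → ∀ y → ∃[ x ] f x ≡ y
injective⇒surjective {suc n} f inj y with Fin.any? (λ x → f x Fin.≟ y)
... | yes ∃x = ∃x
... | no ∄x  = ⊥-elim (Fin.<⇒notInjective (ℕ.n<1+n n)
  λ {x} {x′} eq → inj (Fin.punchOut-injective (λ y≡ → ∄x (x , ≡.sym y≡)) (λ y≡ → ∄x (x′ , ≡.sym y≡)) eq))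

module _ {a ℓ} (M : CommutativeMonoid a ℓ) where
  open CommutativeMonoid M
  open Sum M
  import Data.Vec.Functional as Vector

  sum-single : ∀ {n} (t : Fin n → Carrier) i → (∀ j → j ≢ i → t j ≈ ε) → sum t ≈ t i
  sum-single {suc n} t i t≈ε = begin
    sum t                     ≈⟨ sum-remove {i = i} t ⟩
    t i ∙ sum (t ∘ punchIn i) ≈⟨ ∙-congˡ (sum-cong-≋ (λ j → t≈ε (punchIn i j) (Fin.punchInᵢ≢i i j))) ⟩
    t i ∙ sum (Vector.replicate n ε) ≈⟨ ∙-congˡ (sum-replicate-zero n) ⟩
    t i ∙ ε                   ≈⟨ identityʳ (t i) ⟩
    t i                       ∎
    where open SetoidReasoning setoid

module FiniteFieldProperties {c ℓ₁ ℓ₂} (F : FiniteField c ℓ₁ ℓ₂) where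
  open FiniteField F
  open HeytingField heytingField using (_#_; tight; #⇒invertible; invertible⇒#)
  open Polynomial commutativeRing
  open PolynomialProperties commutativeRing
  open RingProperties ring using (-0#≈0#)
  open GroupProperties +-group using (x∙y⁻¹≈ε⇒x≈y)
  open SetoidReasoning ≈-setoid
  private
    module E = Inverse enumeration

  el : Fin order → Carrier
  el = E.to

  ix : Carrier → Fin order
  ix = E.from

  el-ix : ∀ x → el (ix x) ≈ x
  el-ix x = E.inverseˡ ≡.refl

  ix-el : ∀ i → ix (el i) ≡ i
  ix-el i = E.inverseʳ refl

  ix-injective : ∀ {x y} → ix x ≡ ix y → x ≈ y
  ix-injective {x} {y} eq = trans (sym (el-ix x)) (trans (reflexive (≡.cong el eq)) (el-ix y))

  infix 4 _≟_
  _≟_ : ∀ x y → Dec (x ≈ y)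
  x ≟ y = map′ ix-injective E.from-cong (ix x Fin.≟ ix y)

  ∃? : ∀ {p} {P : Carrier → Set p} → (∀ {x y} → x ≈ y → P x → P y) →
       (∀ x → Dec (P x)) → Dec (∃ P)
  ∃? resp P? = map′ (λ (i , p) → el i , p) (λ (x , p) → ix x , resp (sym (el-ix x)) p)
    (Fin.any? (λ i → P? (el i)))

  x-0≈x : ∀ x → x - 0# ≈ x
  x-0≈x x = trans (+-congˡ -0#≈0#) (+-identityʳ x)

  1≉0 : 1# ≉ 0#
  1≉0 1≈0 = proj₂ (tight 1# 0#) 1≈0
    (invertible⇒# (1# , trans (*-identityˡ _) (x-0≈x 1#) , trans (*-identityʳ _) (x-0≈x 1#)))

  -- The Heyting structure inverts only what is apart from 0. A failed search for an inverse refutes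
  -- apartness, and tightness then gives x ≈ 0.
  inverse : ∀ {x} → x ≉ 0# → ∃[ y ] x * y ≈ 1#
  inverse {x} x≉0 with ∃? (λ y≈z xy≈1 → trans (*-congˡ (sym y≈z)) xy≈1) (λ y → x * y ≟ 1#)
  ... | yes ∃y = ∃y
  ... | no ∄y  = contradiction (proj₁ (tight x 0#) ¬x#0) x≉0
    where
    ¬x#0 : ¬ x # 0#
    ¬x#0 x#0 with y , _ , xy≈1 ← #⇒invertible x#0 = ∄y (y , trans (*-congʳ (sym (x-0≈x x))) xy≈1)

  *-nonzero : ∀ {x y} → x ≉ 0# → y ≉ 0# → x * y ≉ 0#
  *-nonzero {x} {y} x≉0 y≉0 xy≈0 with z , xz≈1 ← inverse x≉0 = y≉0 (begin
    y           ≈⟨ *-identityˡ y ⟨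
    1# * y      ≈⟨ *-congʳ xz≈1 ⟨
    x * z * y   ≈⟨ *-congʳ (*-comm x z) ⟩
    z * x * y   ≈⟨ *-assoc z x y ⟩
    z * (x * y) ≈⟨ *-congˡ xy≈0 ⟩
    z * 0#      ≈⟨ zeroʳ z ⟩
    0#          ∎)

  zero-product : ∀ {x y} → x * y ≈ 0# → x ≉ 0# → y ≈ 0#
  zero-product {x} {y} xy≈0 x≉0 with y ≟ 0#
  ... | yes y≈0 = y≈0
  ... | no  y≉0 = contradiction xy≈0 (*-nonzero x≉0 y≉0)

  ^-nonzero : ∀ {x} n → x ≉ 0# → x ^ n ≉ 0#
  ^-nonzero zero    x≉0 = 1≉0
  ^-nonzero (suc n) x≉0 = *-nonzero x≉0 (^-nonzero n x≉0)

  ^-zero : ∀ {x} n → x ^ n ≈ 0# → x ≈ 0#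
  ^-zero {x} n xⁿ≈0 with x ≟ 0#
  ... | yes x≈0 = x≈0
  ... | no  x≉0 = contradiction xⁿ≈0 (^-nonzero n x≉0)

  x-y≈0⇒x≈y : ∀ {x y} → x - y ≈ 0# → x ≈ y
  x-y≈0⇒x≈y {x} {y} = x∙y⁻¹≈ε⇒x≈y x y

  x≈y⇒x-y≈0 : ∀ {x y} → x ≈ y → x - y ≈ 0#
  x≈y⇒x-y≈0 {x} {y} x≈y = trans (+-congʳ x≈y) (-‿inverseʳ y)

  *-cancelˡ : ∀ {x y z} → x ≉ 0# → x * y ≈ x * z → y ≈ z
  *-cancelˡ {x} {y} {z} x≉0 xy≈xz with w , xw≈1 ← inverse x≉0 = begin
    y           ≈⟨ lemma y ⟨
    w * (x * y) ≈⟨ *-congˡ xy≈xz ⟩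
    w * (x * z) ≈⟨ lemma z ⟩
    z           ∎
    where
    lemma : ∀ u → w * (x * u) ≈ u
    lemma u = trans (sym (*-assoc w x u)) (trans (*-congʳ (trans (*-comm w x) xw≈1)) (*-identityˡ u))

  Congruent : (Carrier → Carrier) → Set _
  Congruent f = ∀ {x y} → x ≈ y → f x ≈ f y

  module _ {f : Carrier → Carrier} (f-cong : Congruent f) (f-inj : Injective _≈_ _≈_ f) where
    private
      f′ : Fin order → Fin order
      f′ i = ix (f (el i))

      f′-inj : Injective _≡_ _≡_ f′
      f′-inj {i} {j} eq = ≡.trans (≡.sym (ix-el i)) (≡.trans (E.from-cong (f-inj (ix-injective eq))) (ix-el j))

      g : Fin order → Fin order
      g i = proj₁ (injective⇒surjective f′ f′-inj i)

      f′-g : ∀ i → f′ (g i) ≡ i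
      f′-g i = proj₂ (injective⇒surjective f′ f′-inj i)

    index-permutation : Permutation′ order
    index-permutation = permutation f′ g f′-g (λ i → f′-inj (f′-g (f′ i)))

    injective⇒bijective : Bijective _≈_ _≈_ f
    injective⇒bijective = f-inj , λ y → el (g (ix y)) ,
      λ z≈ → trans (f-cong z≈) (ix-injective (f′-g (ix y)))

  private
    module S = SemiringSum semiring
    module P = Sum *-commutativeMonoid

  Σ Π : (Carrier → Carrier) → Carrier
  Σ h = S.sum (λ i → h (el i))
  Π h = P.sum (λ i → h (el i))

  Σ-cong : ∀ {h k} → (∀ x → h x ≈ k x) → Σ h ≈ Σ k
  Σ-cong h≈k = S.sum-cong-≋ (λ i → h≈k (el i))

  Σ-+ : ∀ h k → Σ (λ x → h x + k x) ≈ Σ h + Σ k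
  Σ-+ h k = S.∑-distrib-+ (λ i → h (el i)) (λ i → k (el i))

  Σ-*ˡ : ∀ a h → Σ (λ x → a * h x) ≈ a * Σ h
  Σ-*ˡ a h = sym (S.*-distribˡ-sum a (λ i → h (el i)))

  Σ-const : ∀ a → Σ (λ _ → a) ≈ order · a
  Σ-const a = S.sum-replicate order

  Σ-permute : ∀ {f} → Congruent f → Injective _≈_ _≈_ f → ∀ {h} → Congruent h → Σ (h ∘ f) ≈ Σ h
  Σ-permute {f} f-cong f-inj {h} h-cong = sym (trans
    (S.sum-permute (λ i → h (el i)) (index-permutation f-cong f-inj))
    (S.sum-cong-≋ (λ i → h-cong (el-ix (f (el i))))))

  Π-permute : ∀ {f} → Congruent f → Injective _≈_ _≈_ f → ∀ {h} → Congruent h → Π (h ∘ f) ≈ Π h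
  Π-permute {f} f-cong f-inj {h} h-cong = sym (trans
    (P.sum-permute (λ i → h (el i)) (index-permutation f-cong f-inj))
    (P.sum-cong-≋ (λ i → h-cong (el-ix (f (el i))))))

  private
    el≉0 : ∀ i → i ≢ ix 0# → el i ≉ 0#
    el≉0 i i≢ eli≈0 = i≢ (≡.trans (≡.sym (ix-el i)) (E.from-cong eli≈0))

  Σ-single : ∀ {h} → Congruent h → (∀ {x} → x ≉ 0# → h x ≈ 0#) → Σ h ≈ h 0#
  Σ-single h-cong h≈0 = trans
    (sum-single +-commutativeMonoid _ (ix 0#) (λ i i≢ → h≈0 (el≉0 i i≢))) (h-cong (el-ix 0#))

  Π-single : ∀ {h} → Congruent h → (∀ {x} → x ≉ 0# → h x ≈ 1#) → Π h ≈ h 0#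
  Π-single h-cong h≈1 = trans
    (sum-single *-commutativeMonoid _ (ix 0#) (λ i i≢ → h≈1 (el≉0 i i≢))) (h-cong (el-ix 0#))

  Π-* : ∀ h k → Π (λ x → h x * k x) ≈ Π h * Π k
  Π-* h k = P.∑-distrib-+ (λ i → h (el i)) (λ i → k (el i))

  Π-nonzero : ∀ {h} → (∀ x → h x ≉ 0#) → Π h ≉ 0#
  Π-nonzero {h} h≉0 = go (λ i → h (el i)) (λ i → h≉0 (el i))
    where
    go : ∀ {n} (t : Fin n → Carrier) → (∀ i → t i ≉ 0#) → P.sum t ≉ 0#
    go {zero}  t t≉0 = 1≉0
    go {suc n} t t≉0 = *-nonzero (t≉0 Fin.zero) (go (t ∘ Fin.suc) (t≉0 ∘ Fin.suc))

  -- Translation by 1 permutes the field, so Σ x = Σ (x + 1) = Σ x + order · 1.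
  order·1≈0 : order · 1# ≈ 0#
  order·1≈0 = begin
    order · 1#                            ≈⟨ +-identityˡ _ ⟨
    0# + order · 1#                       ≈⟨ +-congʳ (-‿inverseˡ (Σ (λ x → x))) ⟨
    - Σ (λ x → x) + Σ (λ x → x) + order · 1#   ≈⟨ +-assoc _ _ _ ⟩
    - Σ (λ x → x) + (Σ (λ x → x) + order · 1#) ≈⟨ +-congˡ (+-congˡ (Σ-const 1#)) ⟨
    - Σ (λ x → x) + (Σ (λ x → x) + Σ (λ _ → 1#)) ≈⟨ +-congˡ (Σ-+ (λ x → x) (λ _ → 1#)) ⟨
    - Σ (λ x → x) + Σ (λ x → x + 1#)           ≈⟨ +-congˡ (Σ-permute +-congʳ (GroupProperties.∙-cancelʳ +-group 1# _ _) (λ x≈y → x≈y)) ⟩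
    - Σ (λ x → x) + Σ (λ x → x)                ≈⟨ -‿inverseˡ _ ⟩
    0#                                         ∎

  private
    -- Replacing 0 by 1 makes the product over the field a unit.
    nz : Carrier → Carrier
    nz x with x ≟ 0#
    ... | yes _ = 1#
    ... | no  _ = x

    nz-cong : Congruent nz
    nz-cong {x} {y} x≈y with x ≟ 0# | y ≟ 0#
    ... | yes _   | yes _   = refl
    ... | yes x≈0 | no  y≉0 = contradiction (trans (sym x≈y) x≈0) y≉0
    ... | no  x≉0 | yes y≈0 = contradiction (trans x≈y y≈0) x≉0
    ... | no  _   | no  _   = x≈y

    nz≉0 : ∀ x → nz x ≉ 0#
    nz≉0 x with x ≟ 0#
    ... | yes _   = 1≉0
    ... | no  x≉0 = x≉0

    -- Replacing x by g x multiplies `nz` by g except at 0, where `nz` stays 1. This supplies the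
    -- missing factor g, which accounts for g ^ order being g rather than 1.
    at0 : Carrier → Carrier → Carrier
    at0 g x with x ≟ 0#
    ... | yes _ = g
    ... | no  _ = 1#

    at0-cong : ∀ g → Congruent (at0 g)
    at0-cong g {x} {y} x≈y with x ≟ 0# | y ≟ 0#
    ... | yes _   | yes _   = refl
    ... | yes x≈0 | no  y≉0 = contradiction (trans (sym x≈y) x≈0) y≉0
    ... | no  x≉0 | yes y≈0 = contradiction (trans x≈y y≈0) x≉0
    ... | no  _   | no  _   = refl

    at0-0 : ∀ g → at0 g 0# ≈ g
    at0-0 g with 0# ≟ 0#
    ... | yes _   = refl
    ... | no  0≉0 = contradiction refl 0≉0

    at0-1 : ∀ g {x} → x ≉ 0# → at0 g x ≈ 1#
    at0-1 g {x} x≉0 with x ≟ 0#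
    ... | yes x≈0 = contradiction x≈0 x≉0
    ... | no  _   = refl

    nz-scale : ∀ {g} → g ≉ 0# → ∀ x → nz (g * x) * at0 g x ≈ g * nz x
    nz-scale {g} g≉0 x with x ≟ 0# | g * x ≟ 0#
    ... | yes _   | yes _    = *-comm 1# g
    ... | yes x≈0 | no  gx≉0 = contradiction (trans (*-congˡ x≈0) (zeroʳ g)) gx≉0
    ... | no  x≉0 | yes gx≈0 = contradiction gx≈0 (*-nonzero g≉0 x≉0)
    ... | no  _   | no  _    = *-identityʳ _

    Π-const : ∀ g → Π (λ _ → g) ≈ g ^ order
    Π-const g = P.sum-replicate order

  x^order≈x : ∀ x → x ≉ 0# → x ^ order ≈ x
  x^order≈x g g≉0 = *-cancelˡ (Π-nonzero nz≉0) (begin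
    Π nz * g ^ order                       ≈⟨ *-comm _ _ ⟩
    g ^ order * Π nz                       ≈⟨ *-congʳ (Π-const g) ⟨
    Π (λ _ → g) * Π nz                     ≈⟨ Π-* (λ _ → g) nz ⟨
    Π (λ x → g * nz x)                     ≈⟨ P.sum-cong-≋ (λ i → nz-scale g≉0 (el i)) ⟨
    Π (λ x → nz (g * x) * at0 g x)         ≈⟨ Π-* (λ x → nz (g * x)) (at0 g) ⟩
    Π (λ x → nz (g * x)) * Π (at0 g)       ≈⟨ *-cong (Π-permute *-congˡ (*-cancelˡ g≉0) nz-cong)
                                                (trans (Π-single (at0-cong g) (at0-1 g)) (at0-0 g)) ⟩
    Π nz * g                               ∎)

  -- Synthetic division: the Horner values at r are the coefficients of (p(x) - p(r)) / (x - r).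
  quot : Poly → Carrier → Poly
  quot []          r = []
  quot (a ∷ [])    r = []
  quot (a ∷ b ∷ p) r = ⟦ b ∷ p ⟧ r ∷ quot (b ∷ p) r

  quot-eval : ∀ p r x → ⟦ p ⟧ x ≈ (x - r) * ⟦ quot p r ⟧ x + ⟦ p ⟧ r
  quot-eval [] r x = sym (trans (+-identityʳ _) (zeroʳ _))
  quot-eval (a ∷ []) r x = begin
    a + x * 0#                   ≈⟨ +-congˡ (trans (zeroʳ x) (sym (zeroʳ r))) ⟩
    a + r * 0#                   ≈⟨ +-identityˡ _ ⟨
    0# + (a + r * 0#)            ≈⟨ +-congʳ (zeroʳ _) ⟨
    (x - r) * 0# + (a + r * 0#)  ∎
  quot-eval (a ∷ p@(b ∷ _)) r x = begin
    a + x * ⟦ p ⟧ x                                              ≈⟨ +-congˡ (*-congˡ (quot-eval p r x)) ⟩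
    a + x * ((x - r) * q + pr)                                   ≈⟨ lemma a x q pr (x - r) ⟩
    ((x - r) * (x * q) + x * pr) + a                             ≈⟨ +-congʳ (+-congˡ (*-congʳ (sub x r))) ⟨
    ((x - r) * (x * q) + ((x - r) + r) * pr) + a                 ≈⟨ lemma₂ a x q pr (x - r) r ⟩
    (x - r) * (pr + x * q) + (a + r * pr)                        ∎
    where
    pr = ⟦ p ⟧ r
    q  = ⟦ quot p r ⟧ x

    open import Algebra.Solver.Ring.NaturalCoefficients.Default commutativeSemiring
      using (solve; _:+_; _:*_; _:=_)

    sub : ∀ x r → x - r + r ≈ x
    sub x r = trans (+-assoc x (- r) r) (trans (+-congˡ (-‿inverseˡ r)) (+-identityʳ x))

    lemma : ∀ a x q pr d → a + x * (d * q + pr) ≈ (d * (x * q) + x * pr) + a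
    lemma = solve 5 (λ a x q pr d → a :+ x :* (d :* q :+ pr) := (d :* (x :* q) :+ x :* pr) :+ a) refl

    lemma₂ : ∀ a x q pr d r → (d * (x * q) + (d + r) * pr) + a ≈ d * (pr + x * q) + (a + r * pr)
    lemma₂ = solve 6 (λ a x q pr d r → (d :* (x :* q) :+ (d :+ r) :* pr) :+ a := d :* (pr :+ x :* q) :+ (a :+ r :* pr)) refl

  quot-zero : ∀ p r → (∀ n → coeff (quot p r) n ≈ 0#) → ⟦ p ⟧ r ≈ 0# → ∀ n → coeff p n ≈ 0#
  quot-zero []              r q≋0 p≈0 n = refl
  quot-zero (a ∷ [])        r q≋0 p≈0 zero    = trans (sym (trans (+-congˡ (zeroʳ r)) (+-identityʳ a))) p≈0
  quot-zero (a ∷ [])        r q≋0 p≈0 (suc n) = refl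
  quot-zero (a ∷ p@(b ∷ _)) r q≋0 p≈0 zero    =
    trans (sym (trans (+-congˡ (trans (*-congˡ (q≋0 0)) (zeroʳ r))) (+-identityʳ a))) p≈0
  quot-zero (a ∷ p@(b ∷ _)) r q≋0 p≈0 (suc n) = quot-zero p r (q≋0 ∘ suc) (q≋0 0) n

  length-quot : ∀ p r {n} → length p ℕ.≤ suc n → length (quot p r) ℕ.≤ n
  length-quot []          r _        = z≤n
  length-quot (a ∷ [])    r _        = z≤n
  length-quot (a ∷ b ∷ p) r {suc n} (s≤s l) = s≤s (length-quot (b ∷ p) r l)

  roots-bound : ∀ n (x : Fin n → Carrier) → (∀ {i j} → x i ≈ x j → i ≡ j) →
    ∀ p → length p ℕ.≤ n → (∀ i → ⟦ p ⟧ (x i) ≈ 0#) → ∀ k → coeff p k ≈ 0#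
  roots-bound zero    x x-inj [] _ _ _ = refl
  roots-bound (suc n) x x-inj p l p≈0 = quot-zero p r
    (roots-bound n (x ∘ Fin.suc) (Fin.suc-injective ∘ x-inj) (quot p r) (length-quot p r l) q≈0)
    (p≈0 Fin.zero)
    where
    r = x Fin.zero
    q≈0 : ∀ i → ⟦ quot p r ⟧ (x (Fin.suc i)) ≈ 0#
    q≈0 i = zero-product
      (trans (sym (trans (quot-eval p r y) (trans (+-congˡ (p≈0 Fin.zero)) (+-identityʳ _)))) (p≈0 (Fin.suc i)))
      (λ y-r≈0 → contradiction (x-inj (x-y≈0⇒x≈y y-r≈0)) λ ())
      where y = x (Fin.suc i)

  vanishing : ∀ p → length p ℕ.≤ order → (∀ x → ⟦ p ⟧ x ≈ 0#) → ∀ k → coeff p k ≈ 0#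
  vanishing p l p≈0 = roots-bound order el
    (λ {i} {j} eq → ≡.trans (≡.sym (ix-el i)) (≡.trans (E.from-cong eq) (ix-el j))) p l (p≈0 ∘ el)

-- Power sums and Hermite's criterion

module Hermite {c ℓ₁ ℓ₂} (F : FiniteField c ℓ₁ ℓ₂) {Q-1} (order≡ : FiniteField.order F ≡ suc (suc Q-1)) where
  open FiniteField F
  open FiniteFieldProperties F
  open Polynomial commutativeRing
  open PolynomialProperties commutativeRing
  open Exp commutativeSemiring using (^-congˡ; ^-homo-*; ^-assocʳ; ^-distrib-*)
  open RingProperties ring using (-0#≈0#; -1*x≈-x; -‿involutive; -‿+-comm; -‿distribʳ-*)
  open SetoidReasoning ≈-setoid
  open Transfer _+_ _*_ 0# 1# public
  open NaturalSolver commutativeSemiring using (solve; _:+_; _:*_; _:=_)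

  Q : ℕ
  Q = suc Q-1

  powerSum : ℕ → Carrier
  powerSum J = Σ (λ x → x ^ J)

  x^Q≈1 : ∀ {x} → x ≉ 0# → x ^ Q ≈ 1#
  x^Q≈1 {x} x≉0 = *-cancelˡ x≉0 (begin
    x * x ^ Q    ≡⟨ ≡.cong (x ^_) order≡ ⟨
    x ^ order    ≈⟨ x^order≈x x x≉0 ⟩
    x            ≈⟨ *-identityʳ x ⟨
    x * 1#       ∎)

  1^n≈1 : ∀ n → 1# ^ n ≈ 1#
  1^n≈1 zero    = refl
  1^n≈1 (suc n) = trans (*-identityˡ _) (1^n≈1 n)

  x^sQ≈1 : ∀ s {x} → x ≉ 0# → x ^ (s ℕ.* Q) ≈ 1#
  x^sQ≈1 s {x} x≉0 = begin
    x ^ (s ℕ.* Q) ≡⟨ ≡.cong (x ^_) (ℕ.*-comm s Q) ⟩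
    x ^ (Q ℕ.* s) ≈⟨ ^-assocʳ x Q s ⟨
    (x ^ Q) ^ s   ≈⟨ ^-congˡ s (x^Q≈1 x≉0) ⟩
    1# ^ s        ≈⟨ 1^n≈1 s ⟩
    1#            ∎

  Σ1≈0 : Σ (λ _ → 1#) ≈ 0#
  Σ1≈0 = trans (Σ-const 1#) order·1≈0

  -- For such J the function 1 - xᴶ is 1 at 0 and 0 elsewhere, and Σ 1 = 0.
  powerSum-multiple : ∀ s → powerSum (suc s ℕ.* Q) ≈ - 1#
  powerSum-multiple s = begin
    powerSum J                          ≈⟨ -‿involutive _ ⟨
    - - powerSum J                      ≈⟨ -‿cong (+-identityˡ _) ⟨
    - (0# + - powerSum J)               ≈⟨ -‿cong (+-cong Σ1≈0 (trans (Σ-*ˡ (- 1#) (_^ J)) (-1*x≈-x _))) ⟨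
    - (Σ (λ _ → 1#) + Σ (λ x → - 1# * x ^ J)) ≈⟨ -‿cong (Σ-+ (λ _ → 1#) (λ x → - 1# * x ^ J)) ⟨
    - Σ (λ x → 1# + - 1# * x ^ J)       ≈⟨ -‿cong (Σ-single (λ x≈y → +-congˡ (*-congˡ (^-congˡ J x≈y)))
                                             (λ x≉0 → trans (+-congˡ (trans (-1*x≈-x _) (-‿cong (x^sQ≈1 (suc s) x≉0)))) (-‿inverseʳ 1#))) ⟩
    - (1# + - 1# * 0# ^ J)              ≈⟨ -‿cong (trans (+-congˡ (trans (*-congˡ (zeroˡ _)) (zeroʳ _))) (+-identityʳ 1#)) ⟩
    - 1#                                ∎
    where J = suc s ℕ.* Q

  length-X^ : ∀ a n → length (a X^ n) ≡ suc n
  length-X^ a n = ≡.trans (length-++ (replicate n 0#)) (≡.trans (≡.cong (ℕ._+ 1) (length-replicate n)) (ℕ.+-comm n 1))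

  ⟦X^⟧ : ∀ n x → ⟦ 1# X^ n ⟧ x ≈ x ^ n
  ⟦X^⟧ zero    x = trans (+-congˡ (zeroʳ x)) (+-identityʳ 1#)
  ⟦X^⟧ (suc n) x = trans (+-identityˡ _) (*-congˡ (⟦X^⟧ n x))

  exponent-bound : ∀ r → suc r ℕ.< Q → ¬ (∀ {x} → x ≉ 0# → x ^ suc r ≈ 1#)
  exponent-bound r r<Q all1 = 1≉0 (trans (sym (-‿involutive 1#)) (trans (-‿cong
    (vanishing p (≡.subst (length p ℕ.≤_) (≡.sym order≡) (s≤s (≡.subst (ℕ._≤ Q) (≡.cong suc (≡.sym (length-X^ 1# r))) r<Q)))
      p≈0 1)) -0#≈0#))
    where
    -- This is x^(r + 2) - x; the extra factor x makes it vanish at 0 as well. It has at most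
    -- `order` coefficients, yet its x-coefficient is -1.
    p = 0# ∷ - 1# ∷ 1# X^ r
    p≈0 : ∀ x → ⟦ p ⟧ x ≈ 0#
    p≈0 x with x ≟ 0#
    ... | yes x≈0 = trans (+-identityˡ _) (trans (*-congʳ x≈0) (zeroˡ _))
    ... | no  x≉0 = trans (+-identityˡ _) (trans (*-congˡ
      (trans (+-congˡ (trans (*-congˡ (⟦X^⟧ r x)) (all1 x≉0))) (-‿inverseˡ 1#))) (zeroʳ x))

  -- The substitution x ↦ g x shows gᴶ S = S for the sum S and every g ≠ 0. If S ≠ 0, all nonzero g
  -- are roots of x^(J mod Q) - 1, too many unless Q divides J. For J = 0 the convention x⁰ = 1
  -- makes the sum `order` · 1.
  powerSum-zero : ∀ J → (∀ s → J ≢ suc s ℕ.* Q) → powerSum J ≈ 0#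
  powerSum-zero J J≢ with J % Q in eq
  ... | zero with J / Q in eq′
  ...   | zero  = trans (Σ-cong (λ x → reflexive (≡.cong (x ^_) (≡.trans (m≡m%n+[m/n]*n J Q) (≡.cong₂ (λ a b → a ℕ.+ b ℕ.* Q) eq eq′))))) Σ1≈0
  ...   | suc s = contradiction (≡.trans (m≡m%n+[m/n]*n J Q) (≡.cong₂ (λ a b → a ℕ.+ b ℕ.* Q) eq eq′)) (J≢ s)
  powerSum-zero J J≢ | suc r with powerSum J ≟ 0#
  ... | yes S≈0 = S≈0
  ... | no  S≉0 = contradiction (λ {g} → all1 {g}) (exponent-bound r (≡.subst (ℕ._< Q) eq (m%n<n J Q)))
    where
    all1 : ∀ {g} → g ≉ 0# → g ^ suc r ≈ 1#
    all1 {g} g≉0 = *-cancelˡ S≉0 (begin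
      powerSum J * g ^ suc r               ≈⟨ *-comm _ _ ⟩
      g ^ suc r * powerSum J               ≈⟨ *-congʳ (*-identityʳ _) ⟨
      (g ^ suc r * 1#) * powerSum J        ≈⟨ *-congʳ (*-congˡ (x^sQ≈1 (J / Q) g≉0)) ⟨
      (g ^ suc r * g ^ (J / Q ℕ.* Q)) * powerSum J ≈⟨ *-congʳ (^-homo-* g (suc r) (J / Q ℕ.* Q)) ⟨
      g ^ (suc r ℕ.+ J / Q ℕ.* Q) * powerSum J ≡⟨ ≡.cong (λ k → g ^ k * powerSum J) (≡.trans (≡.cong (ℕ._+ J / Q ℕ.* Q) (≡.sym eq)) (≡.sym (m≡m%n+[m/n]*n J Q))) ⟩
      g ^ J * powerSum J                   ≈⟨ Σ-*ˡ (g ^ J) (_^ J) ⟨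
      Σ (λ x → g ^ J * x ^ J)              ≈⟨ Σ-cong (λ x → ^-distrib-* g x J) ⟨
      Σ (λ x → (g * x) ^ J)                ≈⟨ Σ-permute *-congˡ (*-cancelˡ g≉0) (^-congˡ J) ⟩
      powerSum J                           ≈⟨ *-identityʳ _ ⟨
      powerSum J * 1#                      ∎)

  δ-yes : ∀ {m n} → m ≡ n → δ m n ≈ 1#
  δ-yes {m} {n} m≡n = reflexive (≡.cong (if_then 1# else 0#) (dec-true (m ℕ.≟ n) m≡n))

  δ-no : ∀ {m n} → m ≢ n → δ m n ≈ 0#
  δ-no {m} {n} m≢n = reflexive (≡.cong (if_then 1# else 0#) (dec-false (m ℕ.≟ n) m≢n))

  δ-* : ∀ N .{{_ : NonZero N}} m n → δ (N ℕ.* m) (N ℕ.* n) ≈ δ m n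
  δ-* N m n with m ℕ.≟ n
  ... | yes m≡n = trans (δ-yes (≡.cong (N ℕ.*_) m≡n)) (sym (δ-yes m≡n))
  ... | no  m≢n = trans (δ-no (m≢n ∘ ℕ.*-cancelˡ-≡ m n N)) (sym (δ-no m≢n))

  digitProduct : ℕ → List Poly → Carrier → Carrier
  digitProduct N []       x = 1#
  digitProduct N (c ∷ cs) x = ⟦ c ⟧ (x ^ N) * digitProduct (7 ℕ.* N) cs x

  -- Counts coefficients instead of degrees, so each digit contributes one unit of N more than its
  -- formal degree does.
  degreeBound′ : ℕ → Poly → ℕ → ℕ
  degreeBound′ N []      r = r
  degreeBound′ N (a ∷ c) r = N ℕ.+ degreeBound′ N c r

  degreeBound : ℕ → List Poly → ℕ
  degreeBound N []       = 0
  degreeBound N (c ∷ cs) = degreeBound′ N c (degreeBound (7 ℕ.* N) cs)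

  private
    U′ : ℕ → Poly → (ℕ → Carrier) → ℕ → Carrier
    U′ N []      h M = 0#
    U′ N (a ∷ c) h M = a * h M + U′ N c h (M ℕ.+ N)

    -- The coefficient sum of the digit product over exponents J with J + M = 7ʳ s₀.
    U : ℕ → List Poly → ℕ → ℕ → Carrier
    U N []       s₀ M = δ M (N ℕ.* s₀)
    U N (c ∷ cs) s₀ M = U′ N c (U (7 ℕ.* N) cs s₀) M

    -- From level N on, all exponents and the value to be reached are multiples of N, so M must be
    -- one too.
    U-∤ : ∀ N cs s₀ {M} → N ∤ M → U N cs s₀ M ≈ 0#
    U-∤ N []       s₀ {M} N∤M = δ-no (λ eq → N∤M (divides s₀ (≡.trans eq (ℕ.*-comm N s₀))))
    U-∤ N (c ∷ cs) s₀ N∤M = go c N∤M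
      where
      go : ∀ c {M} → N ∤ M → U′ N c (U (7 ℕ.* N) cs s₀) M ≈ 0#
      go []      N∤M = refl
      go (a ∷ c) {M} N∤M = trans (+-cong
        (trans (*-congˡ (U-∤ (7 ℕ.* N) cs s₀ (λ 7N∣M → N∤M (∣-trans (n∣m*n 7) 7N∣M)))) (zeroʳ a))
        (go c (λ N∣M+N → N∤M (∣m+n∣m⇒∣n (≡.subst (N ∣_) (ℕ.+-comm M N) N∣M+N) ∣-refl)))) (+-identityˡ 0#)

    -- Dividing by N, a power of 7, replaces the growing exponents by carries; the divisibility test
    -- in `step` is the vanishing proved by `U-∤`.
    U-W : ∀ N .{{_ : NonZero N}} cs s₀ s → U N cs s₀ (N ℕ.* s) ≈ W cs s₀ s
    U-W N []       s₀ s = δ-* N s s₀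
    U-W N (c ∷ cs) s₀ s = go c s
      where
      instance
        7N≢0 : NonZero (7 ℕ.* N)
        7N≢0 = ℕ.m*n≢0 7 N
      exact : ∀ s → U (7 ℕ.* N) cs s₀ (N ℕ.* s) ≈ (if does (7 ∣? s) then W cs s₀ (s / 7) else 0#)
      exact s with 7 ∣? s
      ... | no  7∤s = trans
        (U-∤ (7 ℕ.* N) cs s₀ (λ 7N∣Ns → 7∤s (*-cancelˡ-∣ N (≡.subst (_∣ N ℕ.* s) (ℕ.*-comm 7 N) 7N∣Ns))))
        (reflexive (≡.cong (if_then W cs s₀ (s / 7) else 0#) (≡.sym (dec-false (7 ∣? s) 7∤s))))
      ... | yes 7∣s@(divides-refl t) = begin
        U (7 ℕ.* N) cs s₀ (N ℕ.* (t ℕ.* 7)) ≡⟨ ≡.cong (U (7 ℕ.* N) cs s₀) (lemma N t) ⟩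
        U (7 ℕ.* N) cs s₀ (7 ℕ.* N ℕ.* t)   ≈⟨ U-W (7 ℕ.* N) cs s₀ t ⟩
        W cs s₀ t                           ≡⟨ ≡.cong (W cs s₀) (m*n/n≡m t 7) ⟨
        W cs s₀ (t ℕ.* 7 / 7)               ≡⟨ ≡.cong (if_then W cs s₀ (t ℕ.* 7 / 7) else 0#) (dec-true (7 ∣? (t ℕ.* 7)) 7∣s) ⟨
        (if does (7 ∣? (t ℕ.* 7)) then W cs s₀ (t ℕ.* 7 / 7) else 0#) ∎
        where
        lemma : ∀ N t → N ℕ.* (t ℕ.* 7) ≡ 7 ℕ.* N ℕ.* t
        lemma = solve-∀
      go : ∀ c s → U′ N c (U (7 ℕ.* N) cs s₀) (N ℕ.* s) ≈ step c (W cs s₀) s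
      go []      s = refl
      go (a ∷ c) s = +-cong (*-congˡ (exact s))
        (trans (reflexive (≡.cong (U′ N c (U (7 ℕ.* N) cs s₀)) (≡.trans (ℕ.+-comm (N ℕ.* s) N) (≡.sym (ℕ.*-suc N s)))))
          (go c (suc s)))

    Top : ℕ → List Poly → Set
    Top N []       = N ≡ suc Q
    Top N (c ∷ cs) = Top (7 ℕ.* N) cs

    Σ-zero : Σ (λ _ → 0#) ≈ 0#
    Σ-zero = trans (Σ-cong (λ _ → sym (zeroˡ 0#))) (trans (Σ-*ˡ 0# (λ _ → 0#)) (zeroˡ _))

    -- J = s Q is rewritten as J + s = (Q + 1) s, and Q + 1 is a power of 7 in the application. So
    -- the multiples Q and 2 Q become the initial carries 1 and 2.
    powerSum-δ : ∀ J → J ℕ.< 3 ℕ.* Q → powerSum J ≈ - (δ (suc J) (suc Q ℕ.* 1) + δ (suc (suc J)) (suc Q ℕ.* 2))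
    powerSum-δ J J<3Q with J ℕ.≟ 1 ℕ.* Q | J ℕ.≟ 2 ℕ.* Q
    ... | yes ≡.refl | _          = trans (powerSum-multiple 0) (-‿cong (sym (trans (+-cong (δ-yes (lemma Q-1))
      (δ-no (λ eq → case ℕ.+-cancelˡ-≡ (2 ℕ.+ Q-1) _ _ (≡.trans (≡.sym (lemma₁ Q-1)) (≡.trans eq (lemma₂ Q-1))) of λ ()))) (+-identityʳ 1#))))
      where
      lemma : ∀ n → suc (1 ℕ.* suc n) ≡ suc (suc n) ℕ.* 1
      lemma = solve-∀
      lemma₁ : ∀ n → suc (suc (1 ℕ.* suc n)) ≡ 2 ℕ.+ n ℕ.+ 1
      lemma₁ = solve-∀
      lemma₂ : ∀ n → suc (suc n) ℕ.* 2 ≡ 2 ℕ.+ n ℕ.+ suc (suc n)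
      lemma₂ = solve-∀
    ... | no J≢Q     | yes ≡.refl = trans (powerSum-multiple 1) (-‿cong (sym (trans (+-cong
      (δ-no (λ eq → J≢Q (ℕ.suc-injective (≡.trans eq (lemma₁ Q-1)))))
      (δ-yes (lemma Q-1))) (+-identityˡ 1#))))
      where
      lemma : ∀ n → suc (suc (2 ℕ.* suc n)) ≡ suc (suc n) ℕ.* 2
      lemma = solve-∀
      lemma₁ : ∀ n → suc (suc n) ℕ.* 1 ≡ suc (1 ℕ.* suc n)
      lemma₁ = solve-∀
    ... | no J≢Q     | no J≢2Q    = trans (powerSum-zero J J≢) (sym (trans (-‿cong (trans (+-cong
      (δ-no (λ eq → J≢Q (ℕ.suc-injective (≡.trans eq (lemma₁ Q-1)))))
      (δ-no (λ eq → J≢2Q (ℕ.suc-injective (ℕ.suc-injective (≡.trans eq (lemma₂ Q-1))))))) (+-identityˡ 0#))) -0#≈0#))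
      where
      lemma₁ : ∀ n → suc (suc n) ℕ.* 1 ≡ suc (1 ℕ.* suc n)
      lemma₁ = solve-∀
      lemma₂ : ∀ n → suc (suc n) ℕ.* 2 ≡ suc (suc (2 ℕ.* suc n))
      lemma₂ = solve-∀
      J≢ : ∀ s → J ≢ suc s ℕ.* Q
      J≢ 0             = J≢Q
      J≢ 1             = J≢2Q
      J≢ (suc (suc s)) J≡ = ℕ.<⇒≱ J<3Q (≡.subst (3 ℕ.* Q ℕ.≤_) (≡.sym J≡) (ℕ.*-monoˡ-≤ Q {3} {3 ℕ.+ s} (s≤s (s≤s (s≤s z≤n)))))

    -- The product is expanded one coefficient at a time, with J collecting the exponents already
    -- chosen; the two carries move along with it.
    Σ-digitProduct : ∀ N cs → Top N cs → ∀ J → J ℕ.+ degreeBound N cs ℕ.< 3 ℕ.* Q →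
      Σ (λ x → x ^ J * digitProduct N cs x) ≈ - (U N cs 1 (suc J) + U N cs 2 (suc (suc J)))
    Σ-digitProduct N [] ≡.refl J J<3Q =
      trans (Σ-cong (λ x → *-identityʳ (x ^ J))) (powerSum-δ J (≡.subst (ℕ._< 3 ℕ.* Q) (ℕ.+-identityʳ J) J<3Q))
    Σ-digitProduct N (c ∷ cs) top J = go c J
      where
      D : Carrier → Carrier
      D = digitProduct (7 ℕ.* N) cs
      h : ℕ → ℕ → Carrier
      h = U (7 ℕ.* N) cs
      go : ∀ c J → J ℕ.+ degreeBound′ N c (degreeBound (7 ℕ.* N) cs) ℕ.< 3 ℕ.* Q →
        Σ (λ x → x ^ J * (⟦ c ⟧ (x ^ N) * D x)) ≈ - (U′ N c (h 1) (suc J) + U′ N c (h 2) (suc (suc J)))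
      go []      J J< = trans (Σ-cong (λ x → trans (*-congˡ (zeroˡ (D x))) (zeroʳ (x ^ J))))
        (trans Σ-zero (sym (trans (-‿cong (+-identityˡ 0#)) -0#≈0#)))
      go (a ∷ c) J J< = begin
        Σ (λ x → x ^ J * ((a + x ^ N * ⟦ c ⟧ (x ^ N)) * D x))
          ≈⟨ Σ-cong (λ x → trans (solve 5 (λ xJ a xN cx D → xJ :* ((a :+ xN :* cx) :* D) := a :* (xJ :* D) :+ (xJ :* xN) :* (cx :* D))
               refl (x ^ J) a (x ^ N) (⟦ c ⟧ (x ^ N)) (D x)) (+-congˡ (*-congʳ (sym (^-homo-* x J N))))) ⟩
        Σ (λ x → a * (x ^ J * D x) + x ^ (J ℕ.+ N) * (⟦ c ⟧ (x ^ N) * D x))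
          ≈⟨ Σ-+ (λ x → a * (x ^ J * D x)) (λ x → x ^ (J ℕ.+ N) * (⟦ c ⟧ (x ^ N) * D x)) ⟩
        Σ (λ x → a * (x ^ J * D x)) + Σ (λ x → x ^ (J ℕ.+ N) * (⟦ c ⟧ (x ^ N) * D x))
          ≈⟨ +-cong (trans (Σ-*ˡ a (λ x → x ^ J * D x)) (*-congˡ (Σ-digitProduct (7 ℕ.* N) cs top J (ℕ.≤-<-trans (ℕ.+-monoʳ-≤ J (bound c)) J<))))
               (go c (J ℕ.+ N) (≡.subst (ℕ._< 3 ℕ.* Q) (≡.sym (ℕ.+-assoc J N _)) J<)) ⟩
        a * - (u₁ + u₂) + - (v₁ + v₂)
          ≈⟨ +-congʳ (-‿distribʳ-* a (u₁ + u₂)) ⟨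
        - (a * (u₁ + u₂)) + - (v₁ + v₂)
          ≈⟨ -‿+-comm _ _ ⟩
        - (a * (u₁ + u₂) + (v₁ + v₂))
          ≈⟨ -‿cong (solve 5 (λ a u₁ u₂ v₁ v₂ → a :* (u₁ :+ u₂) :+ (v₁ :+ v₂) := (a :* u₁ :+ v₁) :+ (a :* u₂ :+ v₂)) refl a u₁ u₂ v₁ v₂) ⟩
        - ((a * u₁ + v₁) + (a * u₂ + v₂)) ∎
        where
        u₁ = h 1 (suc J)
        u₂ = h 2 (suc (suc J))
        v₁ = U′ N c (h 1) (suc J ℕ.+ N)
        v₂ = U′ N c (h 2) (suc (suc J) ℕ.+ N)
        bound : ∀ c → degreeBound (7 ℕ.* N) cs ℕ.≤ N ℕ.+ degreeBound′ N c (degreeBound (7 ℕ.* N) cs)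
        bound []      = ℕ.m≤n+m _ N
        bound (a ∷ c) = ℕ.≤-trans (bound c) (ℕ.m≤n+m _ N)

    top : ∀ N cs → N ℕ.* 7 ℕ.^ length cs ≡ suc Q → Top N cs
    top N []       eq = ≡.trans (≡.sym (ℕ.*-identityʳ N)) eq
    top N (c ∷ cs) eq = top (7 ℕ.* N) cs (≡.trans (lemma N (7 ℕ.^ length cs)) eq)
      where
      lemma : ∀ N m → 7 ℕ.* N ℕ.* m ≡ N ℕ.* (7 ℕ.* m)
      lemma = solve-∀

  -- A permutation does not change the power sum, which is 0 for this exponent. Expanding the same
  -- sum leaves minus the coefficients at Q and 2 Q.
  hermite : ∀ cs → 7 ℕ.^ length cs ≡ order → degreeBound 1 cs ℕ.< 3 ℕ.* Q →
    ∀ {f} → Congruent f → Injective _≈_ _≈_ f →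
    ∀ k → suc k ℕ.< Q → (∀ x → digitProduct 1 cs x ≈ f x ^ suc k) →
    W cs 1 1 + W cs 2 2 ≈ 0#
  hermite cs 7^≡ bound {f} f-cong f-inj k k<Q prod = begin
    W cs 1 1 + W cs 2 2                             ≈⟨ +-cong (U-W 1 cs 1 1) (U-W 1 cs 2 2) ⟨
    U 1 cs 1 1 + U 1 cs 2 2                         ≈⟨ -‿involutive _ ⟨
    - - (U 1 cs 1 1 + U 1 cs 2 2)                   ≈⟨ -‿cong (Σ-digitProduct 1 cs (top 1 cs (≡.trans (ℕ.+-identityʳ _) (≡.trans 7^≡ order≡))) 0 bound) ⟨
    - Σ (λ x → x ^ 0 * digitProduct 1 cs x)         ≈⟨ -‿cong (Σ-cong (λ x → trans (*-identityˡ _) (prod x))) ⟩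
    - Σ (λ x → f x ^ suc k)                         ≈⟨ -‿cong (Σ-permute f-cong f-inj (^-congˡ (suc k))) ⟩
    - powerSum (suc k)                              ≈⟨ -‿cong (powerSum-zero (suc k) (λ s eq → ℕ.<⇒≱ k<Q (≡.subst (Q ℕ.≤_) (≡.sym eq) (ℕ.m≤m+n Q _)))) ⟩
    - 0#                                            ≈⟨ -0#≈0# ⟩
    0#                                              ∎

-- Building finite fields and monomorphisms between them

module _ {c ℓ₁ : Level} (R : CommutativeRing c ℓ₁) where
  open CommutativeRing R renaming (setoid to ≈-setoid)
  open GroupProperties +-group using (x∙y⁻¹≈ε⇒x≈y)

  -- Apartness is decided inequality, lifted to ℓ₂ because exceptionality quantifies over extensions
  -- at the universe levels of K.
  finiteField : ∀ ℓ₂ → (_≟_ : ∀ x y → Dec (x ≈ y)) → 1# ≉ 0# → (∀ {x} → x ≉ 0# → ∃[ y ] x * y ≈ 1#) →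
    ∀ {q} → Inverse (≡ₚ.setoid (Fin q)) ≈-setoid → FiniteField c ℓ₁ ℓ₂
  finiteField ℓ₂ _≟_ 1≉0 inverse enum = record
    { heytingField = record
      { Carrier = Carrier ; _≈_ = _≈_ ; _#_ = λ x y → Lift ℓ₂ (False (x ≟ y))
      ; _+_ = _+_ ; _*_ = _*_ ; -_ = -_ ; 0# = 0# ; 1# = 1#
      ; isHeytingField = record
        { isHeytingCommutativeRing = record
          { isCommutativeRing = isCommutativeRing
          ; isApartnessRelation = record
            { irrefl  = λ x≈y (lift x≉y) → toWitnessFalse x≉y x≈y
            ; sym     = λ (lift x≉y) → lift (fromWitnessFalse (λ y≈x → toWitnessFalse x≉y (sym y≈x)))
            ; cotrans = λ (lift x≉y) z → cotrans (toWitnessFalse x≉y) z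
            }
          ; #⇒invertible = λ (lift x≉y) → invertible (toWitnessFalse x≉y)
          ; invertible⇒# = λ (z , zd≈1 , _) → lift (fromWitnessFalse (λ x≈y →
              1≉0 (trans (sym zd≈1) (trans (*-congˡ (trans (+-congʳ x≈y) (-‿inverseʳ _))) (zeroʳ z)))))
          }
        ; tight = λ x y →
            (λ ¬x#y → decidable-stable (x ≟ y) (λ x≉y → ¬x#y (lift (fromWitnessFalse x≉y)))) ,
            (λ x≈y (lift x≉y) → toWitnessFalse x≉y x≈y)
        }
      }
    ; enumeration = enum
    }
    where
    cotrans : ∀ {x y} → x ≉ y → ∀ z → Lift ℓ₂ (False (x ≟ z)) ⊎ Lift ℓ₂ (False (z ≟ y))
    cotrans {x} {y} x≉y z with x ≟ z
    ... | no  x≉z = inj₁ (lift _)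
    ... | yes x≈z = inj₂ (lift (fromWitnessFalse (λ z≈y → x≉y (trans x≈z z≈y))))
    invertible : ∀ {x y} → x ≉ y → ∃[ z ] z * (x - y) ≈ 1# × (x - y) * z ≈ 1#
    invertible {x} {y} x≉y with z , dz≈1 ← inverse (λ x-y≈0 → x≉y (x∙y⁻¹≈ε⇒x≈y x y x-y≈0)) =
      z , trans (*-comm z _) dz≈1 , dz≈1

×-enumeration : ∀ {a ℓ b ℓ′} {A : Setoid a ℓ} {B : Setoid b ℓ′} {m n} →
  Inverse (≡ₚ.setoid (Fin m)) A → Inverse (≡ₚ.setoid (Fin n)) B →
  Inverse (≡ₚ.setoid (Fin (m ℕ.* n))) (×-setoid A B)
×-enumeration {A = A} {B} {m} {n} α β = record
  { to        = λ k → A.to (proj₁ (remQuot n k)) , B.to (proj₂ (remQuot {m} n k))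
  ; from      = λ (x , y) → combine (A.from x) (B.from y)
  ; to-cong   = λ { ≡.refl → Setoid.refl (×-setoid A B) }
  ; from-cong = λ (x , y) → ≡.cong₂ combine (A.from-cong x) (B.from-cong y)
  ; inverse   =
      (λ { {x , y} ≡.refl → ≡.subst (λ r → Setoid._≈_ (×-setoid A B) (A.to (proj₁ r) , B.to (proj₂ r)) (x , y))
        (≡.sym (Fin.remQuot-combine (A.from x) (B.from y))) (A.inverseˡ ≡.refl , B.inverseˡ ≡.refl) }) ,
      (λ { {k} (x , y) → ≡.trans (≡.cong₂ combine (A.inverseʳ x) (B.inverseʳ y)) (Fin.combine-remQuot {m} n k) })
  }
  where
  module A = Inverse α
  module B = Inverse β

ringMonomorphism : ∀ {c₁ ℓ₁ c₂ ℓ₂} (R : CommutativeRing c₁ ℓ₁) (S : CommutativeRing c₂ ℓ₂) →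
  let module R = CommutativeRing R
      module S = CommutativeRing S
  in (ι : R.Carrier → S.Carrier) →
  (∀ {x y} → x R.≈ y → ι x S.≈ ι y) → (∀ {x y} → ι x S.≈ ι y → x R.≈ y) →
  (∀ x y → ι (x R.+ y) S.≈ ι x S.+ ι y) → (∀ x y → ι (x R.* y) S.≈ ι x S.* ι y) → ι R.1# S.≈ S.1# →
  IsRingMonomorphism R.rawRing S.rawRing ι
ringMonomorphism R S ι cong inj +-homo *-homo 1-homo = record
  { isRingHomomorphism = record
    { isSemiringHomomorphism = record
      { isNearSemiringHomomorphism = record
        { +-isMonoidHomomorphism = record
          { isMagmaHomomorphism = record { isRelHomomorphism = record { cong = cong } ; homo = +-homo }
          ; ε-homo = ι0≈0
          }
        ; *-homo = *-homo
        }
      ; 1#-homo = 1-homo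
      }
    ; -‿homo = λ x → inverseˡ-unique (ι (R.- x)) (ι x)
        (S.trans (S.sym (+-homo (R.- x) x)) (S.trans (cong (R.-‿inverseˡ x)) ι0≈0))
    }
  ; injective = inj
  }
  where
  module R = CommutativeRing R
  module S = CommutativeRing S
  open GroupProperties S.+-group using (identityʳ-unique; inverseˡ-unique)
  ι0≈0 : ι R.0# S.≈ S.0#
  ι0≈0 = identityʳ-unique (ι R.0#) (ι R.0#) (S.trans (S.sym (+-homo R.0# R.0#)) (cong (R.+-identityˡ R.0#)))

module _ {c ℓ} (R : CommutativeRing c ℓ) where
  open CommutativeRing R
  open Polynomial R

  IsPower : ℕ → Carrier → Set _
  IsPower n a = ∃[ w ] w ^ n ≈ a

module Homomorphism {c₁ ℓ₁ c₂ ℓ₂} {R : CommutativeRing c₁ ℓ₁} {S : CommutativeRing c₂ ℓ₂}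
  {ι : CommutativeRing.Carrier R → CommutativeRing.Carrier S}
  (ι-hom : IsRingHomomorphism (CommutativeRing.rawRing R) (CommutativeRing.rawRing S) ι) where
  private
    module R = CommutativeRing R
    module PR = Polynomial R
    module PS = Polynomial S
  open CommutativeRing S
  open IsRingHomomorphism ι-hom

  ι-^ : ∀ x n → ι (x PR.^ n) ≈ ι x PS.^ n
  ι-^ x zero    = 1#-homo
  ι-^ x (suc n) = trans (*-homo x (x PR.^ n)) (*-congˡ (ι-^ x n))

  ι-· : ∀ n x → ι (n PR.· x) ≈ n PS.· ι x
  ι-· zero    x = 0#-homo
  ι-· (suc n) x = trans (+-homo x (n PR.· x)) (+-congˡ (ι-· n x))

  ι-·1 : ∀ n → ι (n PR.· R.1#) ≈ n PS.· 1#
  ι-·1 zero    = 0#-homo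
  ι-·1 (suc n) = trans (+-homo R.1# (n PR.· R.1#)) (+-cong 1#-homo (ι-·1 n))

  image : F₄₉Algebra R → F₄₉Algebra S
  image A = record
    { e      = ι e
    ; 7≈0    = trans (sym (ι-·1 7)) (trans (⟦⟧-cong 7≈0) 0#-homo)
    ; e-root = trans (sym (trans (+-homo _ _) (+-cong (trans (+-homo _ _) (+-cong (ι-^ e 2) (ι-· 6 e))) (ι-·1 3))))
        (trans (⟦⟧-cong e-root) 0#-homo)
    }
    where open F₄₉Algebra A

-- Adjoining square roots and cube roots

module _ {c ℓ₁ ℓ₂} (F : FiniteField c ℓ₁ ℓ₂) (A : F₄₉Algebra (FiniteField.commutativeRing F)) where
  open FiniteField F
  open FiniteFieldProperties F
  open Polynomial commutativeRing
  open Scalars commutativeRing A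
  open Solver using (con; _:=_; _:+_; _:*_; _:-_; :-_; _:^_)
  open SetoidReasoning ≈-setoid

  open Exp commutativeSemiring using (^-congˡ)

  -- F(√d), in which (a , b) stands for a + b √d.
  module Quadratic (d : Carrier) (d-nonsquare : ¬ IsPower commutativeRing 2 d) where

    infixl 7 _∙_
    _∙_ : Carrier × Carrier → Carrier × Carrier → Carrier × Carrier
    (a , b) ∙ (a′ , b′) = a * a′ + d * (b * b′) , a * b′ + b * a′

    private
      module G = AbelianGroup (abelianGroup +-abelianGroup +-abelianGroup)
      open Consequences G.setoid using (comm∧idˡ⇒id; comm∧distrˡ⇒distr)

      ∙-comm : ∀ v w → v ∙ w G.≈ w ∙ v
      ∙-comm (a , b) (a′ , b′) =
        solve 5 (λ d a b a′ b′ → a :* a′ :+ d :* (b :* b′) := a′ :* a :+ d :* (b′ :* b)) ≡.refl d a b a′ b′ ,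
        solve 4 (λ a b a′ b′ → a :* b′ :+ b :* a′ := a′ :* b :+ b′ :* a) ≡.refl a b a′ b′

    R : CommutativeRing c ℓ₁
    R = record
      { _*_ = _∙_
      ; 1# = 1# , 0#
      ; isCommutativeRing = record
        { isRing = record
          { +-isAbelianGroup = G.isAbelianGroup
          ; *-cong     = λ (a , b) (a′ , b′) →
              +-cong (*-cong a a′) (*-congˡ (*-cong b b′)) , +-cong (*-cong a b′) (*-cong b a′)
          ; *-assoc    = λ (a , b) (a′ , b′) (a″ , b″) →
              solve 7 (λ d a b a′ b′ a″ b″ →
                (a :* a′ :+ d :* (b :* b′)) :* a″ :+ d :* ((a :* b′ :+ b :* a′) :* b″) :=
                a :* (a′ :* a″ :+ d :* (b′ :* b″)) :+ d :* (b :* (a′ :* b″ :+ b′ :* a″))) ≡.refl d a b a′ b′ a″ b″ ,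
              solve 7 (λ d a b a′ b′ a″ b″ →
                (a :* a′ :+ d :* (b :* b′)) :* b″ :+ (a :* b′ :+ b :* a′) :* a″ :=
                a :* (a′ :* b″ :+ b′ :* a″) :+ b :* (a′ :* a″ :+ d :* (b′ :* b″))) ≡.refl d a b a′ b′ a″ b″
          ; *-identity = comm∧idˡ⇒id ∙-comm (λ (a , b) →
              solve 3 (λ d a b → con 1c :* a :+ d :* (con 0c :* b) := a) ≡.refl d a b ,
              solve 2 (λ a b → con 1c :* b :+ con 0c :* a := b) ≡.refl a b)
          ; distrib    = comm∧distrˡ⇒distr G.∙-cong ∙-comm (λ (a , b) (a′ , b′) (a″ , b″) →
              solve 7 (λ d a b a′ b′ a″ b″ → a :* (a′ :+ a″) :+ d :* (b :* (b′ :+ b″)) :=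
                (a :* a′ :+ d :* (b :* b′)) :+ (a :* a″ :+ d :* (b :* b″))) ≡.refl d a b a′ b′ a″ b″ ,
              solve 6 (λ a b a′ b′ a″ b″ → a :* (b′ :+ b″) :+ b :* (a′ :+ a″) :=
                (a :* b′ :+ b :* a′) :+ (a :* b″ :+ b :* a″)) ≡.refl a b a′ b′ a″ b″)
          }
        ; *-comm = ∙-comm
        }
      }

    module R where
      open CommutativeRing R public
      open Polynomial R public using (_^_)

    N : R.Carrier → Carrier
    N (a , b) = a * a - d * (b * b)

    N-cong : ∀ {v w} → v R.≈ w → N v ≈ N w
    N-cong (a , b) = +-cong (*-cong a a) (-‿cong (*-congˡ (*-cong b b)))

    N-* : ∀ v w → N (v R.* w) ≈ N v * N w
    N-* (a , b) (a′ , b′) = solve 5 (λ d a b a′ b′ →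
      (a :* a′ :+ d :* (b :* b′)) :* (a :* a′ :+ d :* (b :* b′)) :- d :* ((a :* b′ :+ b :* a′) :* (a :* b′ :+ b :* a′)) :=
      (a :* a :- d :* (b :* b)) :* (a′ :* a′ :- d :* (b′ :* b′))) ≡.refl d a b a′ b′

    N-^ : ∀ v n → N (v R.^ n) ≈ N v ^ n
    N-^ v zero    = solve 1 (λ d → con 1c :* con 1c :- d :* (con 0c :* con 0c) := con 1c) ≡.refl d
    N-^ v (suc n) = trans (N-* v (v R.^ n)) (*-congˡ (N-^ v n))

    -- If a² = d b² with b ≠ 0, then d = (a / b)².
    N-nonzero : ∀ {v} → v R.≉ R.0# → N v ≉ 0#
    N-nonzero {a , b} v≉0 N≈0 with b ≟ 0#
    ... | yes b≈0 = v≉0 (^-zero 2 (begin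
      a ^ 2                        ≈⟨ solve 3 (λ a b d → a :^ 2 := (a :* a :- d :* (b :* b)) :+ d :* (b :* b)) ≡.refl a b d ⟩
      N (a , b) + d * (b * b)      ≈⟨ +-cong N≈0 (*-congˡ (trans (*-congˡ b≈0) (zeroʳ b))) ⟩
      0# + d * 0#                  ≈⟨ solve 1 (λ d → con 0c :+ d :* con 0c := con 0c) ≡.refl d ⟩
      0#                           ∎) , b≈0)
    ... | no b≉0 with z , bz≈1 ← inverse b≉0 = d-nonsquare (a * z , (begin
      (a * z) ^ 2                       ≈⟨ solve 4 (λ a b d z → (a :* z) :^ 2 := (a :* a :- d :* (b :* b)) :* z :^ 2 :+ d :* (b :* z) :^ 2) ≡.refl a b d z ⟩
      N (a , b) * z ^ 2 + d * (b * z) ^ 2 ≈⟨ +-cong (*-congʳ N≈0) (*-congˡ (^-congˡ 2 bz≈1)) ⟩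
      0# * z ^ 2 + d * 1# ^ 2           ≈⟨ solve 2 (λ d z → con 0c :* z :^ 2 :+ d :* con 1c :^ 2 := d) ≡.refl d z ⟩
      d                                 ∎))

    inverse′ : ∀ {v} → v R.≉ R.0# → ∃[ w ] v R.* w R.≈ R.1#
    inverse′ {a , b} v≉0 with z , Nz≈1 ← inverse (N-nonzero v≉0) = (a * z , - b * z) ,
      trans (solve 4 (λ a b d z → a :* (a :* z) :+ d :* (b :* (:- b :* z)) := (a :* a :- d :* (b :* b)) :* z) ≡.refl a b d z) Nz≈1 ,
      solve 3 (λ a b z → a :* (:- b :* z) :+ b :* (a :* z) := con 0c) ≡.refl a b z

    L : FiniteField c ℓ₁ ℓ₂
    L = finiteField R ℓ₂ (×-decidable _≟_ _≟_) (1≉0 ∘ proj₁) inverse′ (×-enumeration enumeration enumeration)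

    ι : Carrier → R.Carrier
    ι a = a , 0#

    ι-mono : IsRingMonomorphism rawRing R.rawRing ι
    ι-mono = ringMonomorphism commutativeRing R ι (λ x≈y → x≈y , refl) proj₁
      (λ x y → refl , sym (+-identityˡ 0#))
      (λ x y → solve 3 (λ d x y → x :* y := x :* y :+ d :* (con 0c :* con 0c)) ≡.refl d x y ,
               solve 2 (λ x y → con 0c := x :* con 0c :+ con 0c :* y) ≡.refl x y)
      (refl , refl)

    θ : R.Carrier
    θ = 0# , 1#

    -- N θ = - d, and - 1 = (e¹²)².
    θ-nonsquare : ¬ IsPower R 2 θ
    θ-nonsquare (w , w²≈θ) = d-nonsquare (i * N w , (begin
      (i * N w) ^ 2      ≈⟨ solve 1 (λ n → (con (ec ⊠^ 12) :* n) :^ 2 := :- (n :^ 2)) ≡.refl (N w) ⟩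
      - (N w ^ 2)        ≈⟨ -‿cong (trans (sym (N-^ w 2)) (N-cong w²≈θ)) ⟩
      - N θ              ≈⟨ solve 1 (λ d → :- (con 0c :* con 0c :- d :* (con 1c :* con 1c)) := d) ≡.refl d ⟩
      d                  ∎))
      where i = φ (ec ⊠^ 12)

    -- A cube root w of a would have (N w)³ = N a = a², hence a = a³ / a² = (a / N w)³ already in F.
    ι-noncube : ∀ {a} → ¬ IsPower commutativeRing 3 a → ¬ IsPower R 3 (ι a)
    ι-noncube {a} a-noncube (w , w³≈a) with a ≟ 0#
    ... | yes a≈0 = a-noncube (0# , trans (zeroˡ _) (sym a≈0))
    ... | no  a≉0 = a-noncube (a * z , (begin
      (a * z) ^ 3             ≈⟨ solve 2 (λ a z → (a :* z) :^ 3 := a :* (a :* a) :* z :^ 3) ≡.refl a z ⟩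
      a * (a * a) * z ^ 3     ≈⟨ *-congʳ (*-congˡ N³≈a²) ⟨
      a * N w ^ 3 * z ^ 3     ≈⟨ solve 3 (λ a n z → a :* n :^ 3 :* z :^ 3 := a :* (n :* z) :^ 3) ≡.refl a (N w) z ⟩
      a * (N w * z) ^ 3       ≈⟨ *-congˡ (^-congˡ 3 (proj₂ (inverse Nw≉0))) ⟩
      a * 1# ^ 3              ≈⟨ solve 1 (λ a → a :* con 1c :^ 3 := a) ≡.refl a ⟩
      a                       ∎))
      where
      N³≈a² : N w ^ 3 ≈ a * a
      N³≈a² = trans (sym (N-^ w 3)) (trans (N-cong w³≈a)
        (solve 2 (λ d a → a :* a :- d :* (con 0c :* con 0c) := a :* a) ≡.refl d a))
      Nw≉0 : N w ≉ 0#
      Nw≉0 Nw≈0 = *-nonzero a≉0 a≉0 (trans (sym N³≈a²) (trans (*-congʳ Nw≈0) (zeroˡ _)))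
      z = proj₁ (inverse Nw≉0)

  -- F(∛d), in which (a , b , c) stands for a + b ∛d + c ∛d².
  module Cubic (d : Carrier) (d-noncube : ¬ IsPower commutativeRing 3 d) where

    infixl 7 _∙_
    _∙_ : Carrier × Carrier × Carrier → Carrier × Carrier × Carrier → Carrier × Carrier × Carrier
    (a , b , c) ∙ (a′ , b′ , c′) =
      a * a′ + d * (b * c′ + c * b′) , a * b′ + b * a′ + d * (c * c′) , a * c′ + b * b′ + c * a′

    private
      module G = AbelianGroup (abelianGroup +-abelianGroup (abelianGroup +-abelianGroup +-abelianGroup))
      open Consequences G.setoid using (comm∧idˡ⇒id; comm∧distrˡ⇒distr)

      ∙-comm : ∀ v w → v ∙ w G.≈ w ∙ v
      ∙-comm (a , b , c) (a′ , b′ , c′) =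
        solve 7 (λ d a b c a′ b′ c′ → a :* a′ :+ d :* (b :* c′ :+ c :* b′) :=
          a′ :* a :+ d :* (b′ :* c :+ c′ :* b)) ≡.refl d a b c a′ b′ c′ ,
        solve 7 (λ d a b c a′ b′ c′ → a :* b′ :+ b :* a′ :+ d :* (c :* c′) :=
          a′ :* b :+ b′ :* a :+ d :* (c′ :* c)) ≡.refl d a b c a′ b′ c′ ,
        solve 6 (λ a b c a′ b′ c′ → a :* c′ :+ b :* b′ :+ c :* a′ :=
          a′ :* c :+ b′ :* b :+ c′ :* a) ≡.refl a b c a′ b′ c′

    R : CommutativeRing c ℓ₁
    R = record
      { _*_ = _∙_
      ; 1# = 1# , 0# , 0#
      ; isCommutativeRing = record
        { isRing = record
          { +-isAbelianGroup = G.isAbelianGroup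
          ; *-cong     = λ (a , b , c) (a′ , b′ , c′) →
              +-cong (*-cong a a′) (*-congˡ (+-cong (*-cong b c′) (*-cong c b′))) ,
              +-cong (+-cong (*-cong a b′) (*-cong b a′)) (*-congˡ (*-cong c c′)) ,
              +-cong (+-cong (*-cong a c′) (*-cong b b′)) (*-cong c a′)
          ; *-assoc    = λ (a , b , c) (a′ , b′ , c′) (a″ , b″ , c″) →
              solve 10 (λ d a b c a′ b′ c′ a″ b″ c″ →
                (a :* a′ :+ d :* (b :* c′ :+ c :* b′)) :* a″ :+
                d :* ((a :* b′ :+ b :* a′ :+ d :* (c :* c′)) :* c″ :+ (a :* c′ :+ b :* b′ :+ c :* a′) :* b″) :=
                a :* (a′ :* a″ :+ d :* (b′ :* c″ :+ c′ :* b″)) :+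
                d :* (b :* (a′ :* c″ :+ b′ :* b″ :+ c′ :* a″) :+ c :* (a′ :* b″ :+ b′ :* a″ :+ d :* (c′ :* c″))))
                ≡.refl d a b c a′ b′ c′ a″ b″ c″ ,
              solve 10 (λ d a b c a′ b′ c′ a″ b″ c″ →
                (a :* a′ :+ d :* (b :* c′ :+ c :* b′)) :* b″ :+ (a :* b′ :+ b :* a′ :+ d :* (c :* c′)) :* a″ :+
                d :* ((a :* c′ :+ b :* b′ :+ c :* a′) :* c″) :=
                a :* (a′ :* b″ :+ b′ :* a″ :+ d :* (c′ :* c″)) :+ b :* (a′ :* a″ :+ d :* (b′ :* c″ :+ c′ :* b″)) :+
                d :* (c :* (a′ :* c″ :+ b′ :* b″ :+ c′ :* a″)))
                ≡.refl d a b c a′ b′ c′ a″ b″ c″ ,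
              solve 10 (λ d a b c a′ b′ c′ a″ b″ c″ →
                (a :* a′ :+ d :* (b :* c′ :+ c :* b′)) :* c″ :+ (a :* b′ :+ b :* a′ :+ d :* (c :* c′)) :* b″ :+
                (a :* c′ :+ b :* b′ :+ c :* a′) :* a″ :=
                a :* (a′ :* c″ :+ b′ :* b″ :+ c′ :* a″) :+ b :* (a′ :* b″ :+ b′ :* a″ :+ d :* (c′ :* c″)) :+
                c :* (a′ :* a″ :+ d :* (b′ :* c″ :+ c′ :* b″)))
                ≡.refl d a b c a′ b′ c′ a″ b″ c″
          ; *-identity = comm∧idˡ⇒id ∙-comm (λ (a , b , c) →
              solve 4 (λ d a b c → con 1c :* a :+ d :* (con 0c :* c :+ con 0c :* b) := a) ≡.refl d a b c ,
              solve 4 (λ d a b c → con 1c :* b :+ con 0c :* a :+ d :* (con 0c :* c) := b) ≡.refl d a b c ,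
              solve 3 (λ a b c → con 1c :* c :+ con 0c :* b :+ con 0c :* a := c) ≡.refl a b c)
          ; distrib    = comm∧distrˡ⇒distr G.∙-cong ∙-comm (λ (a , b , c) (a′ , b′ , c′) (a″ , b″ , c″) →
              solve 10 (λ d a b c a′ b′ c′ a″ b″ c″ →
                a :* (a′ :+ a″) :+ d :* (b :* (c′ :+ c″) :+ c :* (b′ :+ b″)) :=
                (a :* a′ :+ d :* (b :* c′ :+ c :* b′)) :+ (a :* a″ :+ d :* (b :* c″ :+ c :* b″)))
                ≡.refl d a b c a′ b′ c′ a″ b″ c″ ,
              solve 10 (λ d a b c a′ b′ c′ a″ b″ c″ →
                a :* (b′ :+ b″) :+ b :* (a′ :+ a″) :+ d :* (c :* (c′ :+ c″)) :=
                (a :* b′ :+ b :* a′ :+ d :* (c :* c′)) :+ (a :* b″ :+ b :* a″ :+ d :* (c :* c″)))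
                ≡.refl d a b c a′ b′ c′ a″ b″ c″ ,
              solve 9 (λ a b c a′ b′ c′ a″ b″ c″ →
                a :* (c′ :+ c″) :+ b :* (b′ :+ b″) :+ c :* (a′ :+ a″) :=
                (a :* c′ :+ b :* b′ :+ c :* a′) :+ (a :* c″ :+ b :* b″ :+ c :* a″))
                ≡.refl a b c a′ b′ c′ a″ b″ c″)
          }
        ; *-comm = ∙-comm
        }
      }

    module R where
      open CommutativeRing R public
      open Polynomial R public using (_^_)

    -- The norm form a³ + d b³ + d² c³ - 3 d a b c, with -3 = 4 modulo 7.
    N : R.Carrier → Carrier
    N (a , b , c) = a ^ 3 + d * b ^ 3 + d ^ 2 * c ^ 3 + φ (4 , 0) * (d * (a * (b * c)))

    N-cong : ∀ {v w} → v R.≈ w → N v ≈ N w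
    N-cong (a , b , c) = +-cong (+-cong (+-cong (^-congˡ 3 a) (*-congˡ (^-congˡ 3 b))) (*-congˡ (^-congˡ 3 c)))
      (*-congˡ (*-congˡ (*-cong a (*-cong b c))))

    N-* : ∀ v w → N (v R.* w) ≈ N v * N w
    N-* (a , b , c) (a′ , b′ , c′) = solve 7 (λ d a b c a′ b′ c′ →
      let n = λ a b c → a :^ 3 :+ d :* b :^ 3 :+ d :^ 2 :* c :^ 3 :+ con (4 , 0) :* (d :* (a :* (b :* c))) in
      n (a :* a′ :+ d :* (b :* c′ :+ c :* b′)) (a :* b′ :+ b :* a′ :+ d :* (c :* c′)) (a :* c′ :+ b :* b′ :+ c :* a′) :=
      n a b c :* n a′ b′ c′) ≡.refl d a b c a′ b′ c′

    N-^ : ∀ v n → N (v R.^ n) ≈ N v ^ n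
    N-^ v zero    = solve 1 (λ d → con 1c :^ 3 :+ d :* con 0c :^ 3 :+ d :^ 2 :* con 0c :^ 3 :+
      con (4 , 0) :* (d :* (con 1c :* (con 0c :* con 0c))) := con 1c) ≡.refl d
    N-^ v (suc n) = trans (N-* v (v R.^ n)) (*-congˡ (N-^ v n))

    private
      -- Here the norm is a³ + d b³, and if it vanishes with b ≠ 0 then d = (- a / b)³.
      N-linear : ∀ {a b} → ¬ (a ≈ 0# × b ≈ 0#) → N (a , b , 0#) ≉ 0#
      N-linear {a} {b} ab≉0 N≈0 with b ≟ 0#
      ... | yes b≈0 = ab≉0 (^-zero 3 (begin
        a ^ 3             ≈⟨ solve 2 (λ d a → a :^ 3 := a :^ 3 :+ d :* con 0c :^ 3 :+ d :^ 2 :* con 0c :^ 3 :+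
                               con (4 , 0) :* (d :* (a :* (con 0c :* con 0c)))) ≡.refl d a ⟩
        N (a , 0# , 0#)   ≈⟨ N-cong (refl , sym b≈0 , refl) ⟩
        N (a , b , 0#)    ≈⟨ N≈0 ⟩
        0#                ∎) , b≈0)
      ... | no  b≉0 with z , bz≈1 ← inverse b≉0 = d-noncube (- a * z , (begin
        (- a * z) ^ 3                          ≈⟨ solve 4 (λ d a b z → (:- a :* z) :^ 3 :=
                                                    d :* (b :* z) :^ 3 :- (a :^ 3 :+ d :* b :^ 3 :+ d :^ 2 :* con 0c :^ 3 :+
                                                    con (4 , 0) :* (d :* (a :* (b :* con 0c)))) :* z :^ 3) ≡.refl d a b z ⟩
        d * (b * z) ^ 3 - N (a , b , 0#) * z ^ 3 ≈⟨ +-cong (*-congˡ (^-congˡ 3 bz≈1)) (-‿cong (*-congʳ N≈0)) ⟩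
        d * 1# ^ 3 - 0# * z ^ 3                ≈⟨ solve 2 (λ d z → d :* con 1c :^ 3 :- con 0c :* z :^ 3 := d) ≡.refl d z ⟩
        d                                      ∎))

    -- A v with N v = 0 is reduced to the case c = 0 by multiplying it with c ∛d − b.
    N-nonzero : ∀ {v} → v R.≉ R.0# → N v ≉ 0#
    N-nonzero {v@(a , b , c)} v≉0 N≈0 with c ≟ 0#
    ... | yes c≈0 = N-linear (λ (a≈0 , b≈0) → v≉0 (a≈0 , b≈0 , c≈0)) (trans (N-cong (refl , refl , sym c≈0)) N≈0)
    ... | no  c≉0 with z , cz≈1 ← inverse c≉0 | (d * (c * c) - a * b ≟ 0#) ×-dec (a * c - b * b ≟ 0#)
    ...   | no ≉0 = N-linear ≉0 (begin
      N (d * (c * c) - a * b , a * c - b * b , 0#)   ≈⟨ N-cong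
                                                          ( solve 4 (λ d a b c → d :* (c :* c) :- a :* b := a :* :- b :+ d :* (b :* con 0c :+ c :* c)) ≡.refl d a b c
                                                          , solve 4 (λ d a b c → a :* c :- b :* b := a :* c :+ b :* :- b :+ d :* (c :* con 0c)) ≡.refl d a b c
                                                          , solve 3 (λ a b c → con 0c := a :* con 0c :+ b :* c :+ c :* :- b) ≡.refl a b c) ⟩
      N (v R.* (- b , c , 0#))                       ≈⟨ N-* v (- b , c , 0#) ⟩
      N v * N (- b , c , 0#)                         ≈⟨ *-congʳ N≈0 ⟩
      0# * N (- b , c , 0#)                          ≈⟨ zeroˡ _ ⟩
      0#                                             ∎)
    -- The multiplier itself annihilates v, that is, d c² = a b and a c = b². Then d c³ = a b c =
    -- b³, so d = (b / c)³.
    ...   | yes (dc²≈ab , ac≈b²) = d-noncube (b * z , (begin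
      (b * z) ^ 3
        ≈⟨ solve 5 (λ d a b c z → (b :* z) :^ 3 :=
             d :* (c :* z) :^ 3 :- (d :* (c :* c) :- a :* b) :* c :* z :^ 3 :- (a :* c :- b :* b) :* b :* z :^ 3) ≡.refl d a b c z ⟩
      d * (c * z) ^ 3 - (d * (c * c) - a * b) * c * z ^ 3 - (a * c - b * b) * b * z ^ 3
        ≈⟨ +-cong (+-cong (*-congˡ (^-congˡ 3 cz≈1)) (-‿cong (*-congʳ (*-congʳ dc²≈ab)))) (-‿cong (*-congʳ (*-congʳ ac≈b²))) ⟩
      d * 1# ^ 3 - 0# * c * z ^ 3 - 0# * b * z ^ 3
        ≈⟨ solve 4 (λ d b c z → d :* con 1c :^ 3 :- con 0c :* c :* z :^ 3 :- con 0c :* b :* z :^ 3 := d) ≡.refl d b c z ⟩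
      d ∎))

    inverse′ : ∀ {v} → v R.≉ R.0# → ∃[ w ] v R.* w R.≈ R.1#
    inverse′ {v@(a , b , c)} v≉0 with z , Nz≈1 ← inverse (N-nonzero v≉0) =
      -- Cofactors of the matrix of multiplication by v, divided by its determinant N v.
      ((a * a - d * (b * c)) * z , (d * (c * c) - a * b) * z , (b * b - a * c) * z) ,
      trans (solve 5 (λ d a b c z →
        a :* ((a :* a :- d :* (b :* c)) :* z) :+ d :* (b :* ((b :* b :- a :* c) :* z) :+ c :* ((d :* (c :* c) :- a :* b) :* z)) :=
        (a :^ 3 :+ d :* b :^ 3 :+ d :^ 2 :* c :^ 3 :+ con (4 , 0) :* (d :* (a :* (b :* c)))) :* z) ≡.refl d a b c z) Nz≈1 ,
      solve 5 (λ d a b c z →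
        a :* ((d :* (c :* c) :- a :* b) :* z) :+ b :* ((a :* a :- d :* (b :* c)) :* z) :+ d :* (c :* ((b :* b :- a :* c) :* z)) :=
        con 0c) ≡.refl d a b c z ,
      solve 5 (λ d a b c z →
        a :* ((b :* b :- a :* c) :* z) :+ b :* ((d :* (c :* c) :- a :* b) :* z) :+ c :* ((a :* a :- d :* (b :* c)) :* z) :=
        con 0c) ≡.refl d a b c z

    L : FiniteField c ℓ₁ ℓ₂
    L = finiteField R ℓ₂ (×-decidable _≟_ (×-decidable _≟_ _≟_)) (1≉0 ∘ proj₁) inverse′
      (×-enumeration enumeration (×-enumeration enumeration enumeration))

    ι : Carrier → R.Carrier
    ι a = a , 0# , 0#

    ι-mono : IsRingMonomorphism rawRing R.rawRing ι
    ι-mono = ringMonomorphism commutativeRing R ι (λ x≈y → x≈y , refl , refl) proj₁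
      (λ x y → refl , sym (+-identityˡ 0#) , sym (+-identityˡ 0#))
      (λ x y → solve 3 (λ d x y → x :* y := x :* y :+ d :* (con 0c :* con 0c :+ con 0c :* con 0c)) ≡.refl d x y ,
               solve 3 (λ d x y → con 0c := x :* con 0c :+ con 0c :* y :+ d :* (con 0c :* con 0c)) ≡.refl d x y ,
               solve 2 (λ x y → con 0c := x :* con 0c :+ con 0c :* con 0c :+ con 0c :* y) ≡.refl x y)
      (refl , refl , refl)

    θ : R.Carrier
    θ = 0# , 1# , 0#

    -- N θ = d.
    θ-noncube : ¬ IsPower R 3 θ
    θ-noncube (w , w³≈θ) = d-noncube (N w , (begin
      N w ^ 3            ≈⟨ trans (sym (N-^ w 3)) (N-cong w³≈θ) ⟩
      N θ                ≈⟨ solve 1 (λ d → con 0c :^ 3 :+ d :* con 1c :^ 3 :+ d :^ 2 :* con 0c :^ 3 :+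
                              con (4 , 0) :* (d :* (con 0c :* (con 1c :* con 0c))) := d) ≡.refl d ⟩
      d                  ∎))

    -- A square root w of a would have (N w)² = N a = a³, hence a = (N w / a)² already in F.
    ι-nonsquare : ∀ {a} → ¬ IsPower commutativeRing 2 a → ¬ IsPower R 2 (ι a)
    ι-nonsquare {a} a-nonsquare (w , w²≈a) = a-nonsquare (N w * z , (begin
      (N w * z) ^ 2           ≈⟨ solve 2 (λ n z → (n :* z) :^ 2 := n :^ 2 :* z :^ 2) ≡.refl (N w) z ⟩
      N w ^ 2 * z ^ 2         ≈⟨ *-congʳ (trans (sym (N-^ w 2)) (N-cong w²≈a)) ⟩
      N (ι a) * z ^ 2         ≈⟨ solve 3 (λ d a z → (a :^ 3 :+ d :* con 0c :^ 3 :+ d :^ 2 :* con 0c :^ 3 :+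
                                   con (4 , 0) :* (d :* (a :* (con 0c :* con 0c)))) :* z :^ 2 := a :* (a :* z) :^ 2) ≡.refl d a z ⟩
      a * (a * z) ^ 2         ≈⟨ *-congˡ (^-congˡ 2 (proj₂ (inverse a≉0))) ⟩
      a * 1# ^ 2              ≈⟨ solve 1 (λ a → a :* con 1c :^ 2 := a) ≡.refl a ⟩
      a                       ∎))
      where
      a≉0 : a ≉ 0#
      a≉0 a≈0 = a-nonsquare (0# , trans (zeroˡ _) (sym a≈0))
      z = proj₁ (inverse a≉0)

-- Towers of extensions that preserve non-powers

record Extension {c ℓ₁ ℓ₂} (F : FiniteField c ℓ₁ ℓ₂) (m n : ℕ) : Set (Level.suc (c ⊔ ℓ₁ ⊔ ℓ₂)) where
  private
    module F = FiniteField F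
  field
    L : FiniteField c ℓ₁ ℓ₂
  module L = FiniteField L
  field
    order≡   : L.order ≡ F.order ℕ.^ m
    ι        : F.Carrier → L.Carrier
    ι-mono   : IsRingMonomorphism F.rawRing L.rawRing ι
    nonpower : ∀ {a} → ¬ IsPower F.commutativeRing n a → ¬ IsPower L.commutativeRing n (ι a)

module _ where
  open Extension

  trivialExtension : ∀ {c ℓ₁ ℓ₂} (F : FiniteField c ℓ₁ ℓ₂) n → Extension F 1 n
  trivialExtension F n = record
    { L = F ; order≡ = ≡.sym (ℕ.^-identityʳ F.order) ; ι = id
    ; ι-mono = Identity.isRingMonomorphism F.rawRing F.refl ; nonpower = id }
    where module F = FiniteField F

  _⨾_ : ∀ {c ℓ₁ ℓ₂} {F : FiniteField c ℓ₁ ℓ₂} {m m′ n} (E : Extension F m n) → Extension (L E) m′ n → Extension F (m ℕ.* m′) n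
  _⨾_ {F = F} {m} {m′} E E′ = record
    { L = L E′
    ; order≡ = ≡.trans (order≡ E′) (≡.trans (≡.cong (ℕ._^ m′) (order≡ E)) (ℕ.^-*-assoc F.order m m′))
    ; ι = ι E′ ∘ ι E
    ; ι-mono = Composition.isRingMonomorphism (FiniteField.trans (L E′)) (ι-mono E) (ι-mono E′)
    ; nonpower = nonpower E′ ∘ nonpower E
    }
    where module F = FiniteField F

  -- The adjoined root is again a nonsquare, so it can be used for the next step, and a single
  -- nonsquare of F starts the whole tower.
  quadraticTower : ∀ {c ℓ₁ ℓ₂} (F : FiniteField c ℓ₁ ℓ₂) → let open FiniteField F in F₄₉Algebra commutativeRing →
    ∀ {d} → ¬ IsPower commutativeRing 2 d → ∀ k → Extension F (2 ℕ.^ k) 3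
  quadraticTower F A d-nonsquare zero    = trivialExtension F 3
  quadraticTower F A d-nonsquare (suc k) = E ⨾ quadraticTower (L E)
    (Homomorphism.image (IsRingMonomorphism.isRingHomomorphism (ι-mono E)) A) Q.θ-nonsquare k
    where
    open FiniteField F using (order)
    module Q = Quadratic F A _ d-nonsquare
    E : Extension F 2 3
    E = record
      { L = Q.L ; order≡ = ≡.cong (order ℕ.*_) (≡.sym (ℕ.*-identityʳ order))
      ; ι = Q.ι ; ι-mono = Q.ι-mono ; nonpower = Q.ι-noncube }

  cubicTower : ∀ {c ℓ₁ ℓ₂} (F : FiniteField c ℓ₁ ℓ₂) → let open FiniteField F in F₄₉Algebra commutativeRing →
    ∀ {d} → ¬ IsPower commutativeRing 3 d → ∀ k → Extension F (3 ℕ.^ k) 2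
  cubicTower F A d-noncube zero    = trivialExtension F 2
  cubicTower F A d-noncube (suc k) = E ⨾ cubicTower (L E)
    (Homomorphism.image (IsRingMonomorphism.isRingHomomorphism (ι-mono E)) A) C.θ-noncube k
    where
    open FiniteField F using (order)
    module C = Cubic F A _ d-noncube
    E : Extension F 3 2
    E = record
      { L = C.L ; order≡ = ≡.cong (λ m → order ℕ.* (order ℕ.* m)) (≡.sym (ℕ.*-identityʳ order))
      ; ι = C.ι ; ι-mono = C.ι-mono ; nonpower = C.ι-nonsquare }

-- Exhaustive checks over the 49 codes

CodePoly : Set
CodePoly = List Code

codes : List Code
codes = cartesianProduct (upTo 7) (upTo 7)

infix 5 _==_
_==_ : Code → Code → Bool
(a , b) == (c , d) = (a ≡ᵇ c) ∧ (b ≡ᵇ d)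

infix 5 _≐_
-- A difference is always reduced modulo 7, so this equality can be derived from φ x ≈ φ y for
-- unreduced codes as well.
_≐_ : Code → Code → Bool
x ≐ y = x ⊞ ⊟ y == 0c

infixr 4 _⇒_
_⇒_ : Bool → Bool → Bool
true  ⇒ b = b
false ⇒ b = true

value : CodePoly → Code → Code
value []      x = 0c
value (a ∷ p) x = a ⊞ x ⊠ value p x

preimage : Code → List (Code × Code) → Maybe Code
preimage v []              = nothing
preimage v ((x , w) ∷ tbl) = if v == w then just x else preimage v tbl

findCollision : CodePoly → List (Code × Code) → List Code → Code × Code
-- The default pair has equal entries and is rejected by `separates`, so an unsuccessful search
-- certifies nothing.
findCollision p tbl []       = 0c , 0c
findCollision p tbl (x ∷ xs) =
  maybe′ (x ,_) (findCollision p ((x , value p x) ∷ tbl) xs) (preimage (value p x) tbl)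

search : CodePoly → Code × Code
search p = findCollision p [] codes

separates : CodePoly → Code × Code → Bool
separates p (x , y) = (value p x == value p y) ∧ not (x ≐ y)

_==ₚ_ : CodePoly → CodePoly → Bool
[]      ==ₚ []      = true
(a ∷ p) ==ₚ (b ∷ q) = (a == b) ∧ (p ==ₚ q)
_       ==ₚ _       = false

opaque
  -- The multiplicative group has order 48. Being opaque, the 47-fold product unfolds only inside
  -- the checks that compute with it.
  inv : Code → Code
  inv x = x ⊠^ 47

septic : Code → Code → Code → Code → Code → CodePoly
septic c₁ c₂ c₃ c₄ c₅ = 0c ∷ c₁ ∷ c₂ ∷ c₃ ∷ c₄ ∷ c₅ ∷ 0c ∷ 1c ∷ []

-- The sporadic polynomial comes last, so that the nine exceptional ones are exactly the indices of
-- the form `inject₁ k`.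
target : Fin 10 → CodePoly
target = Vec.lookup
  ( septic 0c          0c 0c          0c          0c
  ∷ septic ec          0c 0c          0c          0c
  ∷ septic (ec ⊠^ 2)   0c 0c          0c          0c
  ∷ septic (ec ⊠^ 3)   0c 0c          0c          0c
  ∷ septic (ec ⊠^ 4)   0c 0c          0c          0c
  ∷ septic (ec ⊠^ 5)   0c 0c          0c          0c
  ∷ septic (2 , 0)     0c 0c          1c          0c
  ∷ septic ((2 , 0) ⊠ ec ⊠^ 4) 0c 0c (ec ⊠^ 2) 0c
  ∷ septic ((6 , 0) ⊠ ec ⊠^ 3) 0c ((5 , 0) ⊠ ec ⊠^ 2) 0c ec
  ∷ septic (ec ⊠^ 35)  0c (ec ⊠^ 18)  0c          ec
  ∷ [])

isTarget : CodePoly → Bool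
isTarget p = any (λ i → p ==ₚ target i) (allFin 10)

-- The search for the collision is a parameter because the soundness of the test does not
-- depend on it, and a proof about the concrete search would unfold it.
classifiedBy : (CodePoly → Code × Code) → CodePoly → Bool
classifiedBy search p = separates p (search p) ∨ isTarget p

-- 2a₁a₅ + a₃² + a₅²a₃ = 0 solved for a₁.
linearCoefficient : Code → Code → Code
linearCoefficient a₅ a₃ = (3 , 0) ⊠ inv a₅ ⊠ (a₃ ⊠ a₃ ⊞ a₅ ⊠ a₅ ⊠ a₃)

-- Scaling multiplies the coefficient of xʲ by tʲ⁻⁷. With n = gcd(7 - j, 48) these powers of e
-- represent the nonzero elements modulo (7 - j)-th powers, which gives n = 2, 3, 4, 1, 6 for j = 5,
-- 4, 3, 2, 1.
leading : ℕ → List Code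
leading n = map (ec ⊠^_) (upTo n)

-- A data type rather than an equation between Booleans, so that the predicate can be
-- inferred without evaluating the check.
data Every {A : Set} (p : A → Bool) (xs : List A) : Set where
  every : all p xs ≡ true → Every p xs

data Every₂ {A B : Set} (p : A → B → Bool) (xs : List A) (ys : List B) : Set where
  every₂ : all (λ x → all (p x) ys) xs ≡ true → Every₂ p xs ys

data Every₃ {A B C : Set} (p : A → B → C → Bool) (xs : List A) (ys : List B) (zs : List C) : Set where
  every₃ : all (λ x → all (λ y → all (p x y) zs) ys) xs ≡ true → Every₃ p xs ys zs

opaque
  unfolding inv

  -- A translation has removed x⁴ and the exponent 10 has fixed the x-coefficient; what is left are
  -- 2 · 49² candidates.
  classified₅ : Every₃ (λ l a₃ a₂ → classifiedBy search (septic (linearCoefficient l a₃) a₂ a₃ 0c l))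
    (leading 2) codes codes
  classified₅ = every₃ ≡.refl

-- Here x³ has been translated away, and the 3 · 49² remaining candidates are settled by collisions
-- alone.
classified₄ : Every₃ (λ l a₂ a₁ → classifiedBy search (septic a₁ a₂ 0c l 0c))
  (leading 3) codes codes
classified₄ = every₃ ≡.refl

classified₃ : Every₂ (λ l a₁ → classifiedBy search (septic a₁ 0c l 0c 0c)) (leading 4) codes
classified₃ = every₂ ≡.refl

classified₂ : Every (λ l → classifiedBy search (septic 0c l 0c 0c 0c)) (leading 1)
classified₂ = every ≡.refl

classified₁ : Every (λ l → classifiedBy search (septic l 0c 0c 0c 0c)) (0c ∷ leading 6)
classified₁ = every ≡.refl

-- With s = t⁻⁷: the substitution x ↦ t x followed by multiplication with s fixes x⁷ and
-- turns a xʲ into l xʲ.  The powers of t are arguments so that they stay folded in proofs.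
scales : (s t⁷ tʲ a l : Code) → Bool
scales s t⁷ tʲ a l = (s ⊠ t⁷ == 1c) ∧ (s ⊠ tʲ ⊠ a == l)

data Scalable (j n : ℕ) : Set where
  scalable : Every (λ a → (a == 0c) ∨ any (λ t → any (scales (inv (t ⊠^ 7)) (t ⊠^ 7) (t ⊠^ j) a) (leading n)) codes) codes →
    Scalable j n

opaque
  unfolding inv

  -- It also makes the interpretation of codes faithful, since an invertible code cannot become 0 in
  -- a field.
  units : Every (λ x → (x == 0c) ∨ (x ⊠ inv x == 1c)) codes
  units = every ≡.refl

  ⊟-separates : Every₂ (λ x y → (x ≐ y) ⇒ (x == y)) codes codes
  ⊟-separates = every₂ ≡.refl

  scalable₅ : Scalable 5 2
  scalable₅ = scalable (every ≡.refl)

  scalable₄ : Scalable 4 3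
  scalable₄ = scalable (every ≡.refl)

  scalable₃ : Scalable 3 4
  scalable₃ = scalable (every ≡.refl)

  scalable₂ : Scalable 2 1
  scalable₂ = scalable (every ≡.refl)

  scalable₁ : Scalable 1 6
  scalable₁ = scalable (every ≡.refl)

nth : CodePoly → ℕ → Code
nth []      _       = 0c
nth (a ∷ p) zero    = a
nth (a ∷ p) (suc n) = nth p n

-- Necessary conditions on the x⁵-, x⁴- and x-coefficients for q to be the normalised
-- polynomial s p (t x + u) + v with s = t⁻⁷; they do not involve u.
matches : (p q : CodePoly) (s t⁷ t⁵ t⁴ t : Code) → Bool
matches p q s t⁷ t⁵ t⁴ t =
  (s ⊠ t⁷ ≐ 1c) ∧
  (s ⊠ t⁵ ⊠ nth p 5 ≐ nth q 5) ∧
  ((nth p 5 == 0c) ⇒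
    (s ⊠ t⁴ ⊠ nth p 4 ≐ nth q 4) ∧
    ((nth p 4 == 0c) ⇒ (nth p 3 == 0c) ⇒ (nth p 2 == 0c) ⇒ (s ⊠ t ⊠ nth p 1 ≐ nth q 1)))

opaque
  unfolding inv

  matches-distinct : Every₃ (λ i j t →
    matches (target (inject₁ i)) (target (inject₁ j)) (inv (t ⊠^ 7)) (t ⊠^ 7) (t ⊠^ 5) (t ⊠^ 4) t ⇒ (toℕ i ≡ᵇ toℕ j))
    (allFin 9) (allFin 9) codes
  matches-distinct = every₃ ≡.refl

private
  all-∈ : ∀ {A : Set} (p : A → Bool) xs → all p xs ≡ true → ∀ {x} → x ∈ xs → p x ≡ true
  all-∈ p xs eq x∈ = Equivalence.to T-≡ (All.lookup (all⁺ p xs (Equivalence.from T-≡ eq)) x∈)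

every-∈ : ∀ {A : Set} {p : A → Bool} {xs} → Every p xs → ∀ {x} → x ∈ xs → T (p x)
every-∈ {p = p} {xs} (every eq) x∈ = Equivalence.from T-≡ (all-∈ p xs eq x∈)

every₂-∈ : ∀ {A B : Set} {p : A → B → Bool} {xs ys} → Every₂ p xs ys → ∀ {x y} → x ∈ xs → y ∈ ys → T (p x y)
every₂-∈ {p = p} {xs} {ys} (every₂ eq) {x} x∈ = every-∈ (every (all-∈ (λ x → all (p x) ys) xs eq x∈))

every₃-∈ : ∀ {A B C : Set} {p : A → B → C → Bool} {xs ys zs} → Every₃ p xs ys zs →
  ∀ {x y z} → x ∈ xs → y ∈ ys → z ∈ zs → T (p x y z)
every₃-∈ {p = p} {xs} {ys} {zs} (every₃ eq) {x} x∈ =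
  every₂-∈ {p = p x} (every₂ (all-∈ (λ x → all (λ y → all (p x y) zs) ys) xs eq x∈))

==⇒≡ : ∀ x y → T (x == y) → x ≡ y
==⇒≡ (a , b) (c , d) eq with a≡c , b≡d ← Equivalence.to T-∧ eq =
  ≡.cong₂ _,_ (ℕ.≡ᵇ⇒≡ a c a≡c) (ℕ.≡ᵇ⇒≡ b d b≡d)

≡⇒== : ∀ {x y} → x ≡ y → T (x == y)
≡⇒== {a , b} ≡.refl = Equivalence.from T-∧ (ℕ.≡⇒≡ᵇ a a ≡.refl , ℕ.≡⇒≡ᵇ b b ≡.refl)

⇒-elim : ∀ {a b} → T (a ⇒ b) → T a → T b
⇒-elim {true} b _ = b

⇒-intro : ∀ {a b} → (T a → T b) → T (a ⇒ b)
⇒-intro {true}  f = f _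
⇒-intro {false} f = _

not-elim : ∀ {a} → T (not a) → ¬ T a
not-elim {true} () _

==ₚ⇒≡ : ∀ p q → T (p ==ₚ q) → p ≡ q
==ₚ⇒≡ []      []      _  = ≡.refl
==ₚ⇒≡ (a ∷ p) (b ∷ q) eq with a≡b , p≡q ← Equivalence.to T-∧ eq =
  ≡.cong₂ _∷_ (==⇒≡ a b a≡b) (==ₚ⇒≡ p q p≡q)

normal : ∀ a b → (a % 7 , b % 7) ∈ codes
normal a b = ∈-cartesianProduct⁺ {xs = upTo 7} {ys = upTo 7} (∈-upTo⁺ (m%n<n a 7)) (∈-upTo⁺ (m%n<n b 7))

⊠∈codes : ∀ x y → x ⊠ y ∈ codes
⊠∈codes (a , b) (c , d) = normal (a ℕ.* c ℕ.+ 4 ℕ.* (b ℕ.* d)) (a ℕ.* d ℕ.+ b ℕ.* c ℕ.+ b ℕ.* d)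

⊞∈codes : ∀ x y → x ⊞ y ∈ codes
⊞∈codes (a , b) (c , d) = normal (a ℕ.+ c) (b ℕ.+ d)

-- Codes as elements of a field, and linear relatedness on values

module CodeValues {c ℓ} (R : CommutativeRing c ℓ) (A : F₄₉Algebra R) where
  open CommutativeRing R
  open Polynomial R
  open Scalars R A
  open Solver using (con; _:+_; _:*_)
  open Exp commutativeSemiring using (^-distrib-*)

  φₚ : CodePoly → Poly
  φₚ = map φ

  φ-value : ∀ p x → ⟦ φₚ p ⟧ (φ x) ≈ φ (value p x)
  φ-value []      x = refl
  φ-value (a ∷ p) x = trans (+-congˡ (trans (*-congˡ (φ-value p x)) (sym (φ-⊠ x (value p x)))))
    (sym (φ-⊞ a (x ⊠ value p x)))

  ⟦⟧-pointwise : ∀ {p q} → Pointwise _≈_ p q → ∀ x → ⟦ p ⟧ x ≈ ⟦ q ⟧ x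
  ⟦⟧-pointwise []          x = refl
  ⟦⟧-pointwise (a≈b ∷ p≈q) x = +-cong a≈b (*-congˡ (⟦⟧-pointwise p≈q x))

  -- Mirrors the operations on coefficient lists, so that an expression denotes by definition the
  -- evaluated polynomial and the solver proves identities between polynomials with symbolic
  -- coefficients.
  module Symbolic {n : ℕ} where
    private
      Expr = Solver.Polynomial n
    infixl 6 _⊕ₑ_
    infixl 7 _⊗ₑ_
    _⊕ₑ_ _⊗ₑ_ : List Expr → List Expr → List Expr
    []      ⊕ₑ g       = g
    (a ∷ f) ⊕ₑ []      = a ∷ f
    (a ∷ f) ⊕ₑ (b ∷ g) = (a :+ b) ∷ (f ⊕ₑ g)
    []      ⊗ₑ g = []
    (a ∷ f) ⊗ₑ g = map (a :*_) g ⊕ₑ (con 0c ∷ (f ⊗ₑ g))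

    ⟦_⟧ₑ : List Expr → Expr → Expr
    ⟦ [] ⟧ₑ    x = con 0c
    ⟦ a ∷ f ⟧ₑ x = a :+ x :* ⟦ f ⟧ₑ x

  0^7≈0 : 0# ^ 7 ≈ 0#
  0^7≈0 = zeroˡ _

  frobenius : ∀ p x → ⟦ map (_^ 7) p ⟧ (x ^ 7) ≈ ⟦ p ⟧ x ^ 7
  frobenius []      x = sym 0^7≈0
  frobenius (a ∷ p) x = trans (+-congˡ (trans (*-congˡ (frobenius p x)) (sym (^-distrib-* x (⟦ p ⟧ x) 7))))
    (sym (frobenius-+ a (x * ⟦ p ⟧ x)))

module Field49 {c ℓ₁ ℓ₂} (K : FiniteField c ℓ₁ ℓ₂) (order≡49 : FiniteField.order K ≡ 49)
  (A : F₄₉Algebra (FiniteField.commutativeRing K)) where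
  open FiniteField K
  open FiniteFieldProperties K
  open Polynomial commutativeRing
  open PolynomialProperties commutativeRing
  open Scalars commutativeRing A
  open CodeValues commutativeRing A
  open Solver using (_:=_; _:+_; _:*_; _:-_; :-_)
  open SetoidReasoning ≈-setoid

  φ-unit : ∀ {x y} → T (x ⊠ y == 1c) → φ x * φ y ≈ 1#
  φ-unit {x} {y} eq = trans (sym (φ-⊠ x y)) (reflexive (≡.cong φ (==⇒≡ (x ⊠ y) 1c eq)))

  φ≈0⇒≡0c : ∀ {x} → x ∈ codes → φ x ≈ 0# → x ≡ 0c
  φ≈0⇒≡0c {x} x∈ φx≈0 with Equivalence.to T-∨ (every-∈ units x∈)
  ... | inj₁ x≡0  = ==⇒≡ x 0c x≡0
  ... | inj₂ unit = contradiction (trans (sym (φ-unit {x} {inv x} unit)) (trans (*-congʳ φx≈0) (zeroˡ _))) 1≉0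

  φ-⊟-zero : ∀ x y → φ x ≈ φ y → x ⊞ ⊟ y ≡ 0c
  φ-⊟-zero x y φx≈φy = φ≈0⇒≡0c (⊞∈codes x (⊟ y)) (begin
    φ (x ⊞ ⊟ y)   ≈⟨ trans (φ-⊞ x (⊟ y)) (+-congˡ (φ-⊟ y)) ⟩
    φ x - φ y     ≈⟨ x≈y⇒x-y≈0 φx≈φy ⟩
    0#            ∎)

  φ-injective : ∀ {x y} → x ∈ codes → y ∈ codes → φ x ≈ φ y → x ≡ y
  φ-injective {x} {y} x∈ y∈ φx≈φy = ==⇒≡ x y
    (⇒-elim (every₂-∈ ⊟-separates x∈ y∈) (≡⇒== (φ-⊟-zero x y φx≈φy)))

  private
    code : Fin order → Code
    code i = let a , b = remQuot {7} 7 (Fin.cast order≡49 i) in toℕ a , toℕ b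

    code∈codes : ∀ i → code i ∈ codes
    code∈codes i = ∈-cartesianProduct⁺ {xs = upTo 7} {ys = upTo 7} (∈-upTo⁺ (Fin.toℕ<n _)) (∈-upTo⁺ (Fin.toℕ<n _))

    code-injective : ∀ {i j} → code i ≡ code j → i ≡ j
    code-injective {i} {j} eq = Fin.toℕ-injective (≡.trans (≡.sym (Fin.toℕ-cast order≡49 i))
      (≡.trans (≡.cong toℕ cast≡) (Fin.toℕ-cast order≡49 j)))
      where
      cast≡ : Fin.cast order≡49 i ≡ Fin.cast order≡49 j
      cast≡ = ≡.trans (≡.sym (Fin.combine-remQuot {7} 7 (Fin.cast order≡49 i)))
        (≡.trans (≡.cong₂ combine (Fin.toℕ-injective (≡.cong proj₁ eq)) (Fin.toℕ-injective (≡.cong proj₂ eq)))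
          (Fin.combine-remQuot {7} 7 (Fin.cast order≡49 j)))

  opaque
    -- The 49 reduced codes map injectively into a field with 49 elements.
    φ-surjective : ∀ x → ∃[ a ] a ∈ codes × φ a ≈ x
    φ-surjective x = code i , code∈codes i , ix-injective (proj₂ found)
      where
      f : Fin order → Fin order
      f i = ix (φ (code i))
      f-injective : Injective _≡_ _≡_ f
      f-injective {i} {j} eq = code-injective (φ-injective (code∈codes i) (code∈codes j) (ix-injective eq))
      found : ∃[ i ] f i ≡ ix x
      found = injective⇒surjective f f-injective (ix x)
      i : Fin order
      i = proj₁ found

  infix 4 _∼_
  -- Linear relatedness on values rather than coefficients, which makes symmetry and transitivity
  -- easy. For degree below 8 nothing is lost, as 49 values determine the polynomial.
  _∼_ : Poly → Poly → Set _
  p ∼ q = ∃[ s ] ∃[ t ] ∃[ u ] ∃[ v ] (s ≉ 0# × t ≉ 0# × (∀ x → ⟦ q ⟧ x ≈ s * ⟦ p ⟧ (t * x + u) + v))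

  unit-nonzero : ∀ {x y} → x * y ≈ 1# → x ≉ 0#
  unit-nonzero xy≈1 x≈0 = 1≉0 (trans (sym xy≈1) (trans (*-congʳ x≈0) (zeroˡ _)))

  ∼-sym : ∀ {p q} → p ∼ q → q ∼ p
  ∼-sym {p} {q} (s , t , u , v , s≉0 , t≉0 , q≈) with s⁻¹ , ss⁻¹≈1 ← inverse s≉0 | t⁻¹ , tt⁻¹≈1 ← inverse t≉0 =
    s⁻¹ , t⁻¹ , - u * t⁻¹ , - v * s⁻¹ ,
    unit-nonzero (trans (*-comm s⁻¹ s) ss⁻¹≈1) , unit-nonzero (trans (*-comm t⁻¹ t) tt⁻¹≈1) , λ x → begin
    ⟦ p ⟧ x
      ≈⟨ ⟦⟧-cong p (trans (sym (trans (*-congʳ tt⁻¹≈1) (*-identityˡ x)))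
           (solve 4 (λ t t′ u x → t :* t′ :* x := t :* (t′ :* x :+ :- u :* t′) :+ (t :* t′ :* u)) ≡.refl t t⁻¹ u x)) ⟩
    ⟦ p ⟧ (t * (t⁻¹ * x + - u * t⁻¹) + t * t⁻¹ * u)
      ≈⟨ ⟦⟧-cong p (+-congˡ (trans (*-congʳ tt⁻¹≈1) (*-identityˡ u))) ⟩
    P (t⁻¹ * x + - u * t⁻¹)
      ≈⟨ trans (*-congʳ ss⁻¹≈1) (*-identityˡ _) ⟨
    s * s⁻¹ * P (t⁻¹ * x + - u * t⁻¹)
      ≈⟨ solve 4 (λ s s′ v P → s :* s′ :* P := s′ :* (s :* P :+ v) :+ :- v :* s′) ≡.refl s s⁻¹ v (P (t⁻¹ * x + - u * t⁻¹)) ⟩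
    s⁻¹ * (s * P (t⁻¹ * x + - u * t⁻¹) + v) + - v * s⁻¹
      ≈⟨ +-congʳ (*-congˡ (q≈ _)) ⟨
    s⁻¹ * ⟦ q ⟧ (t⁻¹ * x + - u * t⁻¹) + - v * s⁻¹ ∎
    where
    P : Carrier → Carrier
    P y = ⟦ p ⟧ (t * y + u)

  ∼-trans : ∀ {p q r} → p ∼ q → q ∼ r → p ∼ r
  ∼-trans {p} {q} {r} (s , t , u , v , s≉0 , t≉0 , q≈) (s′ , t′ , u′ , v′ , s′≉0 , t′≉0 , r≈) =
    s′ * s , t * t′ , t * u′ + u , s′ * v + v′ , *-nonzero s′≉0 s≉0 , *-nonzero t≉0 t′≉0 , λ x → begin
    ⟦ r ⟧ x                                                   ≈⟨ r≈ x ⟩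
    s′ * ⟦ q ⟧ (t′ * x + u′) + v′                             ≈⟨ +-congʳ (*-congˡ (q≈ _)) ⟩
    s′ * (s * ⟦ p ⟧ (t * (t′ * x + u′) + u) + v) + v′         ≈⟨ +-congʳ (*-congˡ (+-congʳ (*-congˡ (⟦⟧-cong p
      (solve 5 (λ t t′ u u′ x → t :* (t′ :* x :+ u′) :+ u := t :* t′ :* x :+ (t :* u′ :+ u)) ≡.refl t t′ u u′ x))))) ⟩
    s′ * (s * ⟦ p ⟧ (t * t′ * x + (t * u′ + u)) + v) + v′     ≈⟨ solve 5 (λ s s′ v v′ P →
      s′ :* (s :* P :+ v) :+ v′ := s′ :* s :* P :+ (s′ :* v :+ v′)) ≡.refl s s′ v v′ _ ⟩
    s′ * s * ⟦ p ⟧ (t * t′ * x + (t * u′ + u)) + (s′ * v + v′) ∎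

  ∼-injective : ∀ {p q} → p ∼ q → Injective _≈_ _≈_ ⟦ p ⟧ → Injective _≈_ _≈_ ⟦ q ⟧
  ∼-injective (s , t , u , v , s≉0 , t≉0 , q≈) p-inj {x} {y} qx≈qy =
    *-cancelˡ t≉0 (+-cancelʳ u (t * x) (t * y) (p-inj (*-cancelˡ s≉0 (+-cancelʳ v _ _
      (trans (sym (q≈ x)) (trans qx≈qy (q≈ y)))))))
    where
    open import Algebra.Properties.Group +-group using () renaming (∙-cancelʳ to +-cancelʳ)

  separates-contra : ∀ p x y → T (separates p (x , y)) → ¬ Injective _≈_ _≈_ ⟦ φₚ p ⟧
  separates-contra p x y sep p-inj = not-elim (proj₂ both) (≡⇒== (φ-⊟-zero x y (p-inj (begin
    ⟦ φₚ p ⟧ (φ x)   ≈⟨ φ-value p x ⟩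
    φ (value p x)    ≡⟨ ≡.cong φ (==⇒≡ (value p x) (value p y) (proj₁ both)) ⟩
    φ (value p y)    ≈⟨ φ-value p y ⟨
    ⟦ φₚ p ⟧ (φ y)   ∎))))
    where
    both = Equivalence.to (T-∧ {value p x == value p y} {not (x ≐ y)}) sep

  classified-target : ∀ search p → T (classifiedBy search p) → Injective _≈_ _≈_ ⟦ φₚ p ⟧ → ∃[ i ] p ≡ target i
  classified-target search p ok p-inj with Equivalence.to (T-∨ {separates p (search p)} {isTarget p}) ok
  ... | inj₁ sep = contradiction (λ {x} {y} → p-inj {x} {y}) (separates-contra p (proj₁ (search p)) (proj₂ (search p)) sep)
  ... | inj₂ tgt = i , ==ₚ⇒≡ p (target i) (proj₂ (proj₂ found))
    where
    found : ∃[ i ] i ∈ allFin 10 × T (p ==ₚ target i)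
    found = find (any⁻ (λ i → p ==ₚ target i) (allFin 10) tgt)
    i = proj₁ found

-- Reduction of degree 7 permutation polynomials to the ten targets

module Classification {c ℓ₁ ℓ₂} (K : FiniteField c ℓ₁ ℓ₂) (order≡49 : FiniteField.order K ≡ 49)
  (A : F₄₉Algebra (FiniteField.commutativeRing K)) where
  open FiniteField K
  open FiniteFieldProperties K
  open Polynomial commutativeRing
  open PolynomialProperties commutativeRing
  open Scalars commutativeRing A
  open CodeValues commutativeRing A
  open Field49 K order≡49 A
  open Solver using (con; _:=_; _:+_; _:*_; _:-_; :-_; _:^_)
  open Exp commutativeSemiring using (^-congˡ)
  open SetoidReasoning ≈-setoid
  open Hermite K order≡49 using (hermite; W)
  private
    module E = Evaluation commutativeRing commutativeRing
    module Sym {n} = Transfer {A = Solver.Polynomial n} _:+_ _:*_ (con 0c) (con 1c)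

    id-hom = Identity.isRingHomomorphism rawRing refl

  ⟦map-id⟧ : ∀ p x → ⟦ map id p ⟧ x ≈ ⟦ p ⟧ x
  ⟦map-id⟧ p x = reflexive (≡.cong (λ p → ⟦ p ⟧ x) (map-id p))

  ⊗-eval : ∀ p q x → ⟦ p ⊗ q ⟧ x ≈ ⟦ p ⟧ x * ⟦ q ⟧ x
  ⊗-eval p q x = trans (sym (⟦map-id⟧ (p ⊗ q) x))
    (trans (E.eval-⊗ id-hom p q x) (*-cong (⟦map-id⟧ p x) (⟦map-id⟧ q x)))

  open Symbolic

  monic : (b₁ b₂ b₃ b₄ b₅ b₆ : Carrier) → Poly
  monic b₁ b₂ b₃ b₄ b₅ b₆ = 0# ∷ b₁ ∷ b₂ ∷ b₃ ∷ b₄ ∷ b₅ ∷ b₆ ∷ 1# ∷ []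

  private
    x^1≈x : ∀ p x → ⟦ p ⟧ (x ^ 1) ≈ ⟦ p ⟧ x
    x^1≈x p x = ⟦⟧-cong p (*-identityʳ x)

  -- The power sum with exponent 8 = 1 + 7 · 1.
  injective⇒b₆≈0 : ∀ {b₁ b₂ b₃ b₄ b₅ b₆} → Injective _≈_ _≈_ ⟦ monic b₁ b₂ b₃ b₄ b₅ b₆ ⟧ → b₆ ≈ 0#
  injective⇒b₆≈0 {b₁} {b₂} {b₃} {b₄} {b₅} {b₆} inj = ^-zero 8 (trans
    (sym (solve 6 (λ b₁ b₂ b₃ b₄ b₅ b₆ →
      let p = con 0c ∷ b₁ ∷ b₂ ∷ b₃ ∷ b₄ ∷ b₅ ∷ b₆ ∷ con 1c ∷ []
          cs = p ∷ map (_:^ 7) p ∷ []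
      -- Among i + 7 j with i, j ≤ 7 the value 48 occurs only for i = j = 6, and 96 is out of reach;
      -- this leaves b₆ · b₆⁷.
      in Sym.W cs 1 1 :+ Sym.W cs 2 2 := b₆ :^ 8) ≡.refl b₁ b₂ b₃ b₄ b₅ b₆))
    -- The bound is 8 · 1 + 8 · 7 = 64 by counting coefficients, against 3 · 48 = 144.
    (hermite (p ∷ map (_^ 7) p ∷ []) (≡.sym order≡49) (toWitness {a? = 64 ℕ.<? 144} _)
      (⟦⟧-cong p) inj 7 (toWitness {a? = 8 ℕ.<? 48} _) (λ x → begin
        ⟦ p ⟧ (x ^ 1) * (⟦ map (_^ 7) p ⟧ (x ^ 7) * 1#) ≈⟨ *-cong (x^1≈x p x) (trans (*-identityʳ _) (frobenius p x)) ⟩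
        ⟦ p ⟧ x * ⟦ p ⟧ x ^ 7                           ∎)))
    where
    p = monic b₁ b₂ b₃ b₄ b₅ b₆

  -- The power sum with exponent 10 = 3 + 7 · 1.
  injective⇒b₁ : ∀ {b₁ b₂ b₃ b₅} → Injective _≈_ _≈_ ⟦ monic b₁ b₂ b₃ 0# b₅ 0# ⟧ → b₅ ≉ 0# →
    φ (6 , 0) * b₁ * b₅ + φ (3 , 0) * (b₃ * b₃ + b₅ * b₅ * b₃) ≈ 0#
  injective⇒b₁ {b₁} {b₂} {b₃} {b₅} inj b₅≉0 = zero-product (trans
    (sym (solve 4 (λ b₁ b₂ b₃ b₅ →
      let p = con 0c ∷ b₁ ∷ b₂ ∷ b₃ ∷ con 0c ∷ b₅ ∷ con 0c ∷ con 1c ∷ []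
          cs = (p ⊗ₑ (p ⊗ₑ p)) ∷ map (_:^ 7) p ∷ []
      in Sym.W cs 1 1 :+ Sym.W cs 2 2 :=
         -- In 48 = i + 7 j with i ≤ 21 the choices j = 6 and j = 4 meet zero coefficients, and j =
         -- 5 gives b₅⁷ times the x¹³-coefficient of the cube, from 7 + 5 + 1, 7 + 3 + 3 and 5 + 5 +
         -- 3. The value 96 is out of reach.
         b₅ :^ 7 :* (con (6 , 0) :* b₁ :* b₅ :+ con (3 , 0) :* (b₃ :* b₃ :+ b₅ :* b₅ :* b₃))) ≡.refl b₁ b₂ b₃ b₅))
    (hermite ((p ⊗ (p ⊗ p)) ∷ map (_^ 7) p ∷ []) (≡.sym order≡49) (toWitness {a? = 78 ℕ.<? 144} _)
      (⟦⟧-cong p) inj 9 (toWitness {a? = 10 ℕ.<? 48} _) (λ x → begin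
        ⟦ p ⊗ (p ⊗ p) ⟧ (x ^ 1) * (⟦ map (_^ 7) p ⟧ (x ^ 7) * 1#)
          ≈⟨ *-cong (trans (x^1≈x (p ⊗ (p ⊗ p)) x) (cube x)) (trans (*-identityʳ _) (frobenius p x)) ⟩
        (⟦ p ⟧ x * (⟦ p ⟧ x * ⟦ p ⟧ x)) * ⟦ p ⟧ x ^ 7
          ≈⟨ solve 1 (λ y → (y :* (y :* y)) :* y :^ 7 := y :^ 10) ≡.refl (⟦ p ⟧ x) ⟩
        ⟦ p ⟧ x ^ 10 ∎))) (^-nonzero 7 b₅≉0)
    where
    p = monic b₁ b₂ b₃ 0# b₅ 0#
    cube : ∀ x → ⟦ p ⊗ (p ⊗ p) ⟧ x ≈ ⟦ p ⟧ x * (⟦ p ⟧ x * ⟦ p ⟧ x)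
    cube x = trans (⊗-eval p (p ⊗ p) x) (*-congˡ (⊗-eval p p x))

  module _ {b₁ b₂ b₃ b₄ b₅ s t : Carrier} (st⁷≈1 : s * t ^ 7 ≈ 1#) (u : Carrier) where

    -- The hypotheses compare the coefficients of s p(t x + u); the constants are binomial
    -- coefficients modulo 7. As (t x + u)⁷ splits into two seventh powers, no x⁶-term appears.
    translate : ∀ {d₁ d₂ d₃ d₄ d₅} →
      s * t * (φ (5 , 0) * b₅ * u ^ 4 + φ (4 , 0) * b₄ * u ^ 3 + φ (3 , 0) * b₃ * u ^ 2 + φ (2 , 0) * b₂ * u + b₁) ≈ d₁ →
      s * t ^ 2 * (φ (3 , 0) * b₅ * u ^ 3 + φ (6 , 0) * b₄ * u ^ 2 + φ (3 , 0) * b₃ * u + b₂) ≈ d₂ →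
      s * t ^ 3 * (φ (3 , 0) * b₅ * u ^ 2 + φ (4 , 0) * b₄ * u + b₃) ≈ d₃ →
      s * t ^ 4 * (φ (5 , 0) * b₅ * u + b₄) ≈ d₄ →
      s * t ^ 5 * b₅ ≈ d₅ →
      monic b₁ b₂ b₃ b₄ b₅ 0# ∼ monic d₁ d₂ d₃ d₄ d₅ 0#
    translate {d₁} {d₂} {d₃} {d₄} {d₅} e₁ e₂ e₃ e₄ e₅ = s , t , u , - (s * ⟦ p ⟧ u) , s≉0 , t≉0 , λ x → sym (begin
      s * ⟦ p ⟧ (t * x + u) + - (s * ⟦ p ⟧ u)
        ≈⟨ solve 9 (λ b₁ b₂ b₃ b₄ b₅ s t u x →
             let p = con 0c ∷ b₁ ∷ b₂ ∷ b₃ ∷ b₄ ∷ b₅ ∷ con 0c ∷ con 1c ∷ [] in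
             s :* ⟦ p ⟧ₑ (t :* x :+ u) :+ :- (s :* ⟦ p ⟧ₑ u) :=
             ⟦ con 0c
             ∷ s :* t :* (con (5 , 0) :* b₅ :* u :^ 4 :+ con (4 , 0) :* b₄ :* u :^ 3 :+ con (3 , 0) :* b₃ :* u :^ 2 :+ con (2 , 0) :* b₂ :* u :+ b₁)
             ∷ s :* t :^ 2 :* (con (3 , 0) :* b₅ :* u :^ 3 :+ con (6 , 0) :* b₄ :* u :^ 2 :+ con (3 , 0) :* b₃ :* u :+ b₂)
             ∷ s :* t :^ 3 :* (con (3 , 0) :* b₅ :* u :^ 2 :+ con (4 , 0) :* b₄ :* u :+ b₃)
             ∷ s :* t :^ 4 :* (con (5 , 0) :* b₅ :* u :+ b₄)
             ∷ s :* t :^ 5 :* b₅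
             ∷ con 0c ∷ s :* t :^ 7 ∷ [] ⟧ₑ x) ≡.refl b₁ b₂ b₃ b₄ b₅ s t u x ⟩
      _ ≈⟨ ⟦⟧-pointwise (refl ∷ e₁ ∷ e₂ ∷ e₃ ∷ e₄ ∷ e₅ ∷ refl ∷ st⁷≈1 ∷ []) x ⟩
      ⟦ monic d₁ d₂ d₃ d₄ d₅ 0# ⟧ x ∎)
      where
      p = monic b₁ b₂ b₃ b₄ b₅ 0#
      s≉0 : s ≉ 0#
      s≉0 = unit-nonzero st⁷≈1
      t≉0 : t ≉ 0#
      t≉0 t≈0 = unit-nonzero (trans (*-comm (t ^ 7) s) st⁷≈1) (trans (^-congˡ 7 t≈0) 0^7≈0)

  φ-inv : ∀ {a} → a ∈ codes → φ a ≉ 0# → φ a * φ (inv a) ≈ 1#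
  φ-inv {a} a∈ φa≉0 with Equivalence.to (T-∨ {a == 0c} {a ⊠ inv a == 1c}) (every-∈ units a∈)
  ... | inj₁ a≡0  = contradiction (reflexive (≡.cong φ (==⇒≡ a 0c a≡0))) φa≉0
  ... | inj₂ unit = φ-unit {a} {inv a} unit

  record Scaling (j n : ℕ) (b : Carrier) : Set (c ⊔ ℓ₁) where
    field
      {s t}  : Carrier
      {l}    : Code
      l∈     : l ∈ leading n
      l∈codes : l ∈ codes
      st⁷≈1  : s * t ^ 7 ≈ 1#
      stʲb≈l : s * t ^ j * b ≈ φ l

  private
    scales⇒Scaling : ∀ {j n} s t⁷ tʲ {t} a l → φ t⁷ ≈ t ^ 7 → φ tʲ ≈ t ^ j →
      l ∈ leading n → T (scales s t⁷ tʲ a l) → Scaling j n (φ a)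
    scales⇒Scaling {j} s t⁷ tʲ {t} a l t⁷≈ tʲ≈ l∈ ok = record
      { s = φ s ; t = t ; l = l
      ; l∈ = l∈
      ; l∈codes = ≡.subst (_∈ codes) l≡ (⊠∈codes (s ⊠ tʲ) a)
      ; st⁷≈1 = trans (*-congˡ (sym t⁷≈)) (φ-unit {s} {t⁷} (proj₁ conditions))
      ; stʲb≈l = begin
          φ s * t ^ j * φ a   ≈⟨ *-congʳ (*-congˡ tʲ≈) ⟨
          φ s * φ tʲ * φ a    ≈⟨ *-congʳ (φ-⊠ s tʲ) ⟨
          φ (s ⊠ tʲ) * φ a    ≈⟨ φ-⊠ (s ⊠ tʲ) a ⟨
          φ (s ⊠ tʲ ⊠ a)      ≡⟨ ≡.cong φ l≡ ⟩
          φ l                 ∎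
      }
      where
      conditions = Equivalence.to (T-∧ {s ⊠ t⁷ == 1c} {s ⊠ tʲ ⊠ a == l}) ok
      l≡ : s ⊠ tʲ ⊠ a ≡ l
      l≡ = ==⇒≡ (s ⊠ tʲ ⊠ a) l (proj₂ conditions)

    scalableTo⇒Scaling : ∀ j n ts a →
      T (any (λ t → any (scales (inv (t ⊠^ 7)) (t ⊠^ 7) (t ⊠^ j) a) (leading n)) ts) → Scaling j n (φ a)
    scalableTo⇒Scaling j n ts a ok = scales⇒Scaling (inv (t ⊠^ 7)) (t ⊠^ 7) (t ⊠^ j) a _ (φ-^ t 7) (φ-^ t j)
      (proj₁ (proj₂ found-l)) (proj₂ (proj₂ found-l))
      where
      found-t = find (any⁻ (λ t → any (scales (inv (t ⊠^ 7)) (t ⊠^ 7) (t ⊠^ j) a) (leading n)) ts ok)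
      t = proj₁ found-t
      found-l = find (any⁻ (scales (inv (t ⊠^ 7)) (t ⊠^ 7) (t ⊠^ j) a) (leading n) (proj₂ (proj₂ found-t)))

    Scaling-cong : ∀ {j n b b′} → b ≈ b′ → Scaling j n b → Scaling j n b′
    Scaling-cong b≈b′ S = record
      { l∈ = l∈ ; l∈codes = l∈codes ; st⁷≈1 = st⁷≈1 ; stʲb≈l = trans (*-congˡ (sym b≈b′)) stʲb≈l }
      where open Scaling S

  scaling : ∀ {j n} → Scalable j n → ∀ {b} → b ≉ 0# → Scaling j n b
  scaling {j} {n} (scalable every-a) {b} b≉0 = Scaling-cong φa≈b ([
      (λ a≡0 → contradiction (trans (sym φa≈b) (reflexive (≡.cong φ (==⇒≡ a 0c a≡0)))) b≉0) ,
      scalableTo⇒Scaling j n codes a ]′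
    (Equivalence.to (T-∨ {a == 0c} {any (λ t → any (scales (inv (t ⊠^ 7)) (t ⊠^ 7) (t ⊠^ j) a) (leading n)) codes}) (every-∈ every-a (proj₁ (proj₂ found)))))
    where
    found = φ-surjective b
    a = proj₁ found
    φa≈b = proj₂ (proj₂ found)

  scaled-nonzero : ∀ {j n b} (S : Scaling j n b) → b ≉ 0# → φ (Scaling.l S) ≉ 0#
  scaled-nonzero {j} S b≉0 l≈0 = *-nonzero (*-nonzero (unit-nonzero st⁷≈1) (^-nonzero j t≉0)) b≉0 (trans stʲb≈l l≈0)
    where
    open Scaling S
    t≉0 : t ≉ 0#
    t≉0 t≈0 = unit-nonzero (trans (*-comm (t ^ 7) s) st⁷≈1) (trans (^-congˡ 7 t≈0) 0^7≈0)

  module CodeOf (x : Carrier) where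
    code : Code
    code = proj₁ (φ-surjective x)
    code∈ : code ∈ codes
    code∈ = proj₁ (proj₂ (φ-surjective x))
    φ-code : φ code ≈ x
    φ-code = proj₂ (proj₂ (φ-surjective x))

  module Inverse′ {x : Carrier} (inv : ∃[ y ] x * y ≈ 1#) where
    y = proj₁ inv
    xy≈1 = proj₂ inv

  RelatedToTarget : Poly → Set _
  RelatedToTarget p = ∃[ i ] p ∼ φₚ (target i)

  related : ∀ {p q} → p ∼ φₚ q → T (classifiedBy search q) → Injective _≈_ _≈_ ⟦ p ⟧ → RelatedToTarget p
  related {p} {q} p∼q ok p-inj = proj₁ found , ≡.subst (λ q → p ∼ φₚ q) (proj₂ found) p∼q
    where
    found : ∃[ i ] q ≡ target i
    found = classified-target search q ok (∼-injective {p} {φₚ q} p∼q p-inj)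

  -- Since 6 = -1, the relation from the exponent 10 reads a₁ l = 3 (a₃² + l² a₃), and l is
  -- invertible.
  linearCoefficient-unique : ∀ {a₁ a₂ a₃ l} → a₁ ∈ codes → l ∈ codes → φ l ≉ 0# →
    Injective _≈_ _≈_ ⟦ φₚ (septic a₁ a₂ a₃ 0c l) ⟧ → a₁ ≡ linearCoefficient l a₃
  linearCoefficient-unique {a₁} {a₂} {a₃} {l} a₁∈ l∈codes l≉0 inj =
    φ-injective a₁∈ (⊠∈codes ((3 , 0) ⊠ inv l) (a₃ ⊠ a₃ ⊞ l ⊠ l ⊠ a₃)) (begin
      φ a₁
        ≈⟨ solve 4 (λ a₁ a₃ l z → a₁ :=
             a₁ :* (con 1c :- l :* z) :- z :* (con (6 , 0) :* a₁ :* l :+ con (3 , 0) :* (a₃ :* a₃ :+ l :* l :* a₃)) :+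
             con (3 , 0) :* z :* (a₃ :* a₃ :+ l :* l :* a₃)) ≡.refl (φ a₁) (φ a₃) (φ l) (φ (inv l)) ⟩
      φ a₁ * (1# - φ l * φ (inv l)) - φ (inv l) * (φ (6 , 0) * φ a₁ * φ l + φ (3 , 0) * (φ a₃ * φ a₃ + φ l * φ l * φ a₃)) +
        φ (3 , 0) * φ (inv l) * (φ a₃ * φ a₃ + φ l * φ l * φ a₃)
        ≈⟨ +-congʳ (+-cong
             (trans (*-congˡ (x≈y⇒x-y≈0 (sym (φ-inv l∈codes l≉0)))) (zeroʳ _))
             (-‿cong (trans (*-congˡ (injective⇒b₁ inj l≉0)) (zeroʳ _)))) ⟩
      (0# - 0#) + φ (3 , 0) * φ (inv l) * (φ a₃ * φ a₃ + φ l * φ l * φ a₃)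
        ≈⟨ trans (+-congʳ (-‿inverseʳ 0#)) (+-identityˡ _) ⟩
      φ (3 , 0) * φ (inv l) * (φ a₃ * φ a₃ + φ l * φ l * φ a₃)
        ≈⟨ *-cong (φ-⊠ (3 , 0) (inv l)) (trans (φ-⊞ (a₃ ⊠ a₃) (l ⊠ l ⊠ a₃))
             (+-cong (φ-⊠ a₃ a₃) (trans (φ-⊠ (l ⊠ l) a₃) (*-congʳ (φ-⊠ l l))))) ⟨
      φ ((3 , 0) ⊠ inv l) * φ (a₃ ⊠ a₃ ⊞ l ⊠ l ⊠ a₃)
        ≈⟨ φ-⊠ ((3 , 0) ⊠ inv l) (a₃ ⊠ a₃ ⊞ l ⊠ l ⊠ a₃) ⟨
      φ (linearCoefficient l a₃) ∎)

  related-septic₅ : ∀ {p a₁ a₂ a₃ l} → a₁ ∈ codes → a₂ ∈ codes → a₃ ∈ codes → l ∈ leading 2 → l ∈ codes → φ l ≉ 0# →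
    p ∼ φₚ (septic a₁ a₂ a₃ 0c l) → Injective _≈_ _≈_ ⟦ p ⟧ → RelatedToTarget p
  related-septic₅ {p} {a₁} {a₂} {a₃} {l} a₁∈ a₂∈ a₃∈ l∈ l∈codes l≉0 rel inj = related {p} {septic (linearCoefficient l a₃) a₂ a₃ 0c l}
    (≡.subst (λ a₁ → p ∼ φₚ (septic a₁ a₂ a₃ 0c l))
      (linearCoefficient-unique {a₁} {a₂} {a₃} {l} a₁∈ l∈codes l≉0 (∼-injective {p} {φₚ (septic a₁ a₂ a₃ 0c l)} rel inj)) rel)
    (every₃-∈ classified₅ l∈ a₃∈ a₂∈) inj

  related₅ : ∀ {b₁ b₂ b₃ b₄ b₅} → b₅ ≉ 0# → Injective _≈_ _≈_ ⟦ monic b₁ b₂ b₃ b₄ b₅ 0# ⟧ →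
    RelatedToTarget (monic b₁ b₂ b₃ b₄ b₅ 0#)
  related₅ {b₁} {b₂} {b₃} {b₄} {b₅} b₅≉0 = related-septic₅ {monic b₁ b₂ b₃ b₄ b₅ 0#} {a₁} {a₂} {a₃} {l}
    a₁∈ a₂∈ a₃∈ l∈ l∈codes (scaled-nonzero S b₅≉0)
    (translate st⁷≈1 u (sym a₁≈) (sym a₂≈) (sym a₃≈) (begin
      s * t ^ 4 * (φ (5 , 0) * b₅ * (φ (4 , 0) * b₄ * z) + b₄)
        ≈⟨ solve 5 (λ s t b₄ b₅ z → s :* t :^ 4 :* (con (5 , 0) :* b₅ :* (con (4 , 0) :* b₄ :* z) :+ b₄) :=
             s :* t :^ 4 :* b₄ :* (con 1c :- b₅ :* z)) ≡.refl s t b₄ b₅ z ⟩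
      s * t ^ 4 * b₄ * (1# - b₅ * z)  ≈⟨ *-congˡ (x≈y⇒x-y≈0 (sym b₅z≈1)) ⟩
      s * t ^ 4 * b₄ * 0#             ≈⟨ zeroʳ _ ⟩
      0#                              ∎) stʲb≈l)
    where
    S = scaling scalable₅ b₅≉0
    open Scaling S
    open Inverse′ (inverse b₅≉0) renaming (y to z; xy≈1 to b₅z≈1)
    -- The solution of 5 b₅ u + b₄ = 0, as 5 · 4 = -1 modulo 7. In the smaller families the factors
    -- 5, 2 and 3 arise likewise, being the negative inverses of the leading exponents 4, 3 and 2.
    u = φ (4 , 0) * b₄ * z
    open CodeOf (s * t * (φ (5 , 0) * b₅ * u ^ 4 + φ (4 , 0) * b₄ * u ^ 3 + φ (3 , 0) * b₃ * u ^ 2 + φ (2 , 0) * b₂ * u + b₁))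
      renaming (code to a₁; code∈ to a₁∈; φ-code to a₁≈)
    open CodeOf (s * t ^ 2 * (φ (3 , 0) * b₅ * u ^ 3 + φ (6 , 0) * b₄ * u ^ 2 + φ (3 , 0) * b₃ * u + b₂))
      renaming (code to a₂; code∈ to a₂∈; φ-code to a₂≈)
    open CodeOf (s * t ^ 3 * (φ (3 , 0) * b₅ * u ^ 2 + φ (4 , 0) * b₄ * u + b₃))
      renaming (code to a₃; code∈ to a₃∈; φ-code to a₃≈)

  related₄ : ∀ {b₁ b₂ b₃ b₄} → b₄ ≉ 0# → Injective _≈_ _≈_ ⟦ monic b₁ b₂ b₃ b₄ 0# 0# ⟧ →
    RelatedToTarget (monic b₁ b₂ b₃ b₄ 0# 0#)
  related₄ {b₁} {b₂} {b₃} {b₄} b₄≉0 = related {monic b₁ b₂ b₃ b₄ 0# 0#} {septic a₁ a₂ 0c l 0c}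
    (translate st⁷≈1 u (sym a₁≈) (sym a₂≈) (begin
      s * t ^ 3 * (φ (3 , 0) * 0# * u ^ 2 + φ (4 , 0) * b₄ * (φ (5 , 0) * b₃ * z) + b₃)
        ≈⟨ solve 6 (λ s t b₃ b₄ u z →
             s :* t :^ 3 :* (con (3 , 0) :* con 0c :* u :^ 2 :+ con (4 , 0) :* b₄ :* (con (5 , 0) :* b₃ :* z) :+ b₃) :=
             s :* t :^ 3 :* b₃ :* (con 1c :- b₄ :* z)) ≡.refl s t b₃ b₄ u z ⟩
      s * t ^ 3 * b₃ * (1# - b₄ * z) ≈⟨ *-congˡ (x≈y⇒x-y≈0 (sym b₄z≈1)) ⟩
      s * t ^ 3 * b₃ * 0#            ≈⟨ zeroʳ _ ⟩
      0#                             ∎)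
      (trans (solve 4 (λ s t b₄ u → s :* t :^ 4 :* (con (5 , 0) :* con 0c :* u :+ b₄) := s :* t :^ 4 :* b₄) ≡.refl s t b₄ u) stʲb≈l)
      (zeroʳ _))
    (every₃-∈ classified₄ l∈ a₂∈ a₁∈)
    where
    S = scaling scalable₄ b₄≉0
    open Scaling S
    open Inverse′ (inverse b₄≉0) renaming (y to z; xy≈1 to b₄z≈1)
    u = φ (5 , 0) * b₃ * z
    open CodeOf (s * t * (φ (5 , 0) * 0# * u ^ 4 + φ (4 , 0) * b₄ * u ^ 3 + φ (3 , 0) * b₃ * u ^ 2 + φ (2 , 0) * b₂ * u + b₁))
      renaming (code to a₁; code∈ to a₁∈; φ-code to a₁≈)
    open CodeOf (s * t ^ 2 * (φ (3 , 0) * 0# * u ^ 3 + φ (6 , 0) * b₄ * u ^ 2 + φ (3 , 0) * b₃ * u + b₂))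
      renaming (code to a₂; code∈ to a₂∈; φ-code to a₂≈)

  related₃ : ∀ {b₁ b₂ b₃} → b₃ ≉ 0# → Injective _≈_ _≈_ ⟦ monic b₁ b₂ b₃ 0# 0# 0# ⟧ →
    RelatedToTarget (monic b₁ b₂ b₃ 0# 0# 0#)
  related₃ {b₁} {b₂} {b₃} b₃≉0 = related {monic b₁ b₂ b₃ 0# 0# 0#} {septic a₁ 0c l 0c 0c}
    (translate st⁷≈1 u (sym a₁≈) (begin
      s * t ^ 2 * (φ (3 , 0) * 0# * u ^ 3 + φ (6 , 0) * 0# * u ^ 2 + φ (3 , 0) * b₃ * (φ (2 , 0) * b₂ * z) + b₂)
        ≈⟨ solve 6 (λ s t b₂ b₃ u z → s :* t :^ 2 :* (con (3 , 0) :* con 0c :* u :^ 3 :+ con (6 , 0) :* con 0c :* u :^ 2 :+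
             con (3 , 0) :* b₃ :* (con (2 , 0) :* b₂ :* z) :+ b₂) :=
             s :* t :^ 2 :* b₂ :* (con 1c :- b₃ :* z)) ≡.refl s t b₂ b₃ u z ⟩
      s * t ^ 2 * b₂ * (1# - b₃ * z) ≈⟨ *-congˡ (x≈y⇒x-y≈0 (sym b₃z≈1)) ⟩
      s * t ^ 2 * b₂ * 0#            ≈⟨ zeroʳ _ ⟩
      0#                             ∎)
      (trans (solve 4 (λ s t b₃ u → s :* t :^ 3 :* (con (3 , 0) :* con 0c :* u :^ 2 :+ con (4 , 0) :* con 0c :* u :+ b₃) :=
        s :* t :^ 3 :* b₃) ≡.refl s t b₃ u) stʲb≈l)
      (solve 3 (λ s t u → s :* t :^ 4 :* (con (5 , 0) :* con 0c :* u :+ con 0c) := con 0c) ≡.refl s t u)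
      (zeroʳ _))
    (every₂-∈ classified₃ l∈ a₁∈)
    where
    S = scaling scalable₃ b₃≉0
    open Scaling S
    open Inverse′ (inverse b₃≉0) renaming (y to z; xy≈1 to b₃z≈1)
    u = φ (2 , 0) * b₂ * z
    open CodeOf (s * t * (φ (5 , 0) * 0# * u ^ 4 + φ (4 , 0) * 0# * u ^ 3 + φ (3 , 0) * b₃ * u ^ 2 + φ (2 , 0) * b₂ * u + b₁))
      renaming (code to a₁; code∈ to a₁∈; φ-code to a₁≈)

  related₂ : ∀ {b₁ b₂} → b₂ ≉ 0# → Injective _≈_ _≈_ ⟦ monic b₁ b₂ 0# 0# 0# 0# ⟧ →
    RelatedToTarget (monic b₁ b₂ 0# 0# 0# 0#)
  related₂ {b₁} {b₂} b₂≉0 = related {monic b₁ b₂ 0# 0# 0# 0#} {septic 0c l 0c 0c 0c}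
    (translate st⁷≈1 u (begin
      s * t * (φ (5 , 0) * 0# * u ^ 4 + φ (4 , 0) * 0# * u ^ 3 + φ (3 , 0) * 0# * u ^ 2 + φ (2 , 0) * b₂ * (φ (3 , 0) * b₁ * z) + b₁)
        ≈⟨ solve 6 (λ s t b₁ b₂ u z → s :* t :* (con (5 , 0) :* con 0c :* u :^ 4 :+ con (4 , 0) :* con 0c :* u :^ 3 :+
             con (3 , 0) :* con 0c :* u :^ 2 :+ con (2 , 0) :* b₂ :* (con (3 , 0) :* b₁ :* z) :+ b₁) :=
             s :* t :* b₁ :* (con 1c :- b₂ :* z)) ≡.refl s t b₁ b₂ u z ⟩
      s * t * b₁ * (1# - b₂ * z) ≈⟨ *-congˡ (x≈y⇒x-y≈0 (sym b₂z≈1)) ⟩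
      s * t * b₁ * 0#            ≈⟨ zeroʳ _ ⟩
      0#                         ∎)
      (trans (solve 4 (λ s t b₂ u → s :* t :^ 2 :* (con (3 , 0) :* con 0c :* u :^ 3 :+ con (6 , 0) :* con 0c :* u :^ 2 :+
        con (3 , 0) :* con 0c :* u :+ b₂) := s :* t :^ 2 :* b₂) ≡.refl s t b₂ u) stʲb≈l)
      (solve 3 (λ s t u → s :* t :^ 3 :* (con (3 , 0) :* con 0c :* u :^ 2 :+ con (4 , 0) :* con 0c :* u :+ con 0c) := con 0c) ≡.refl s t u)
      (solve 3 (λ s t u → s :* t :^ 4 :* (con (5 , 0) :* con 0c :* u :+ con 0c) := con 0c) ≡.refl s t u)
      (zeroʳ _))
    (every-∈ classified₂ l∈)
    where
    S = scaling scalable₂ b₂≉0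
    open Scaling S
    open Inverse′ (inverse b₂≉0) renaming (y to z; xy≈1 to b₂z≈1)
    u = φ (3 , 0) * b₁ * z

  related₁ : ∀ {b₁} → b₁ ≉ 0# → Injective _≈_ _≈_ ⟦ monic b₁ 0# 0# 0# 0# 0# ⟧ →
    RelatedToTarget (monic b₁ 0# 0# 0# 0# 0#)
  related₁ {b₁} b₁≉0 = related {monic b₁ 0# 0# 0# 0# 0#} {septic l 0c 0c 0c 0c}
    (translate st⁷≈1 0#
      (trans (solve 3 (λ s t b₁ → s :* t :* (con (5 , 0) :* con 0c :* con 0c :^ 4 :+ con (4 , 0) :* con 0c :* con 0c :^ 3 :+
        con (3 , 0) :* con 0c :* con 0c :^ 2 :+ con (2 , 0) :* con 0c :* con 0c :+ b₁) := s :* t :^ 1 :* b₁) ≡.refl s t b₁) stʲb≈l)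
      (solve 2 (λ s t → s :* t :^ 2 :* (con (3 , 0) :* con 0c :* con 0c :^ 3 :+ con (6 , 0) :* con 0c :* con 0c :^ 2 :+
        con (3 , 0) :* con 0c :* con 0c :+ con 0c) := con 0c) ≡.refl s t)
      (solve 2 (λ s t → s :* t :^ 3 :* (con (3 , 0) :* con 0c :* con 0c :^ 2 :+ con (4 , 0) :* con 0c :* con 0c :+ con 0c) := con 0c) ≡.refl s t)
      (solve 2 (λ s t → s :* t :^ 4 :* (con (5 , 0) :* con 0c :* con 0c :+ con 0c) := con 0c) ≡.refl s t)
      (zeroʳ _))
    -- The head of the checked list is 0, reserved for x⁷ itself.
    (every-∈ classified₁ (there l∈))
    where
    S = scaling scalable₁ b₁≉0
    open Scaling S

  pointwise⇒∼ : ∀ {p q} → Pointwise _≈_ p q → p ∼ q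
  pointwise⇒∼ {p} {q} p≈q = 1# , 1# , 0# , 0# , 1≉0 , 1≉0 , λ x → sym (begin
    1# * ⟦ p ⟧ (1# * x + 0#) + 0# ≈⟨ trans (+-identityʳ _) (*-identityˡ _) ⟩
    ⟦ p ⟧ (1# * x + 0#)           ≈⟨ ⟦⟧-cong p (trans (+-identityʳ _) (*-identityˡ x)) ⟩
    ⟦ p ⟧ x                       ≈⟨ ⟦⟧-pointwise p≈q x ⟩
    ⟦ q ⟧ x                       ∎)

  related-∼ : ∀ {p q} → p ∼ q → (Injective _≈_ _≈_ ⟦ q ⟧ → RelatedToTarget q) →
    Injective _≈_ _≈_ ⟦ p ⟧ → RelatedToTarget p
  related-∼ {p} {q} p∼q classify inj with i , q∼i ← classify (∼-injective {p} {q} p∼q inj) =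
    i , ∼-trans {p} {q} {φₚ (target i)} p∼q q∼i

  related-monic : ∀ b₁ b₂ b₃ b₄ b₅ → Injective _≈_ _≈_ ⟦ monic b₁ b₂ b₃ b₄ b₅ 0# ⟧ →
    RelatedToTarget (monic b₁ b₂ b₃ b₄ b₅ 0#)
  related-monic b₁ b₂ b₃ b₄ b₅ with b₅ ≟ 0# | b₄ ≟ 0# | b₃ ≟ 0# | b₂ ≟ 0# | b₁ ≟ 0#
  ... | no  b₅≉0 | _        | _        | _        | _ = related₅ b₅≉0
  ... | yes b₅≈0 | no b₄≉0  | _        | _        | _ = related-∼ {monic b₁ b₂ b₃ b₄ b₅ 0#} {monic b₁ b₂ b₃ b₄ 0# 0#}
    (pointwise⇒∼ (refl ∷ refl ∷ refl ∷ refl ∷ refl ∷ b₅≈0 ∷ refl ∷ refl ∷ [])) (related₄ b₄≉0)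
  ... | yes b₅≈0 | yes b₄≈0 | no b₃≉0  | _        | _ = related-∼ {monic b₁ b₂ b₃ b₄ b₅ 0#} {monic b₁ b₂ b₃ 0# 0# 0#}
    (pointwise⇒∼ (refl ∷ refl ∷ refl ∷ refl ∷ b₄≈0 ∷ b₅≈0 ∷ refl ∷ refl ∷ [])) (related₃ b₃≉0)
  ... | yes b₅≈0 | yes b₄≈0 | yes b₃≈0 | no b₂≉0  | _ = related-∼ {monic b₁ b₂ b₃ b₄ b₅ 0#} {monic b₁ b₂ 0# 0# 0# 0#}
    (pointwise⇒∼ (refl ∷ refl ∷ refl ∷ b₃≈0 ∷ b₄≈0 ∷ b₅≈0 ∷ refl ∷ refl ∷ [])) (related₂ b₂≉0)
  ... | yes b₅≈0 | yes b₄≈0 | yes b₃≈0 | yes b₂≈0 | no b₁≉0 = related-∼ {monic b₁ b₂ b₃ b₄ b₅ 0#} {monic b₁ 0# 0# 0# 0# 0#}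
    (pointwise⇒∼ (refl ∷ refl ∷ b₂≈0 ∷ b₃≈0 ∷ b₄≈0 ∷ b₅≈0 ∷ refl ∷ refl ∷ [])) (related₁ b₁≉0)
  ... | yes b₅≈0 | yes b₄≈0 | yes b₃≈0 | yes b₂≈0 | yes b₁≈0 = related {monic b₁ b₂ b₃ b₄ b₅ 0#} {septic 0c 0c 0c 0c 0c}
    (pointwise⇒∼ (refl ∷ b₁≈0 ∷ b₂≈0 ∷ b₃≈0 ∷ b₄≈0 ∷ b₅≈0 ∷ refl ∷ refl ∷ []))
    (every-∈ classified₁ (here ≡.refl))

  coefficients : Poly → Poly
  coefficients f = coeff f 0 ∷ coeff f 1 ∷ coeff f 2 ∷ coeff f 3 ∷ coeff f 4 ∷ coeff f 5 ∷ coeff f 6 ∷ coeff f 7 ∷ []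

  ≋-coefficients : ∀ f → DegreeBelow f 8 → f ≋ coefficients f
  ≋-coefficients f f<8 0 = refl
  ≋-coefficients f f<8 1 = refl
  ≋-coefficients f f<8 2 = refl
  ≋-coefficients f f<8 3 = refl
  ≋-coefficients f f<8 4 = refl
  ≋-coefficients f f<8 5 = refl
  ≋-coefficients f f<8 6 = refl
  ≋-coefficients f f<8 7 = refl
  ≋-coefficients f f<8 (suc (suc (suc (suc (suc (suc (suc (suc n)))))))) = f<8 (ℕ.m≤m+n 8 n)

  classification : ∀ f → HasDegree f 7 → Injective _≈_ _≈_ ⟦ f ⟧ → RelatedToTarget f
  classification f (f₇≉0 , f>7) inj = related-∼ {f} {monic b₁ b₂ b₃ b₄ b₅ b₆} f∼monic (λ monic-inj →
    related-∼ {monic b₁ b₂ b₃ b₄ b₅ b₆} {monic b₁ b₂ b₃ b₄ b₅ 0#}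
      (pointwise⇒∼ (refl ∷ refl ∷ refl ∷ refl ∷ refl ∷ refl ∷ injective⇒b₆≈0 monic-inj ∷ refl ∷ []))
      (related-monic b₁ b₂ b₃ b₄ b₅) monic-inj) inj
    where
    open Inverse′ (inverse f₇≉0) renaming (y to s; xy≈1 to f₇s≈1)
    b₁ = s * coeff f 1
    b₂ = s * coeff f 2
    b₃ = s * coeff f 3
    b₄ = s * coeff f 4
    b₅ = s * coeff f 5
    b₆ = s * coeff f 6
    f∼monic : f ∼ monic b₁ b₂ b₃ b₄ b₅ b₆
    f∼monic = s , 1# , 0# , - (s * coeff f 0) , unit-nonzero (trans (*-comm s _) f₇s≈1) , 1≉0 , λ x → sym (begin
      s * ⟦ f ⟧ (1# * x + 0#) + - (s * coeff f 0)
        ≈⟨ +-congʳ (*-congˡ (trans (⟦⟧-cong f (trans (+-identityʳ _) (*-identityˡ x)))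
             (⟦⟧-≋ f (coefficients f) x (≋-coefficients f f>7)))) ⟩
      s * ⟦ coefficients f ⟧ x + - (s * coeff f 0)
        ≈⟨ solve 10 (λ s x f₀ f₁ f₂ f₃ f₄ f₅ f₆ f₇ →
             s :* ⟦ f₀ ∷ f₁ ∷ f₂ ∷ f₃ ∷ f₄ ∷ f₅ ∷ f₆ ∷ f₇ ∷ [] ⟧ₑ x :+ :- (s :* f₀) :=
             ⟦ con 0c ∷ s :* f₁ ∷ s :* f₂ ∷ s :* f₃ ∷ s :* f₄ ∷ s :* f₅ ∷ s :* f₆ ∷ f₇ :* s ∷ [] ⟧ₑ x) ≡.refl
             s x (coeff f 0) (coeff f 1) (coeff f 2) (coeff f 3) (coeff f 4) (coeff f 5) (coeff f 6) (coeff f 7) ⟩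
      ⟦ 0# ∷ b₁ ∷ b₂ ∷ b₃ ∷ b₄ ∷ b₅ ∷ b₆ ∷ coeff f 7 * s ∷ [] ⟧ x
        ≈⟨ ⟦⟧-pointwise (refl ∷ refl ∷ refl ∷ refl ∷ refl ∷ refl ∷ refl ∷ f₇s≈1 ∷ []) x ⟩
      ⟦ monic b₁ b₂ b₃ b₄ b₅ b₆ ⟧ x ∎)

-- Inequivalence of the exceptional forms, and passage to coefficients

module Uniqueness {c ℓ₁ ℓ₂} (K : FiniteField c ℓ₁ ℓ₂) (order≡49 : FiniteField.order K ≡ 49)
  (A : F₄₉Algebra (FiniteField.commutativeRing K)) where
  open FiniteField K
  open FiniteFieldProperties K
  open Polynomial commutativeRing
  open PolynomialProperties commutativeRing
  open Scalars commutativeRing A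
  open CodeValues commutativeRing A
  open Field49 K order≡49 A
  open Classification K order≡49 A
  open Symbolic
  open RingProperties ring using (-1*x≈-x)
  open F₄₉Algebra A using (e)
  open Solver using (con; _:=_; _:+_; _:*_; _:-_; :-_; _:^_)
  open Exp commutativeSemiring using (^-congˡ)
  open SetoidReasoning ≈-setoid

  8≤order : 8 ℕ.≤ order
  8≤order = ≡.subst (8 ℕ.≤_) (≡.sym order≡49) (toWitness {a? = 8 ℕ.≤? 49} _)

  module _ {a₁ a₂ a₃ a₄ a₅ d₁ d₂ d₃ d₄ d₅ s t u v}
    (rel : ∀ x → ⟦ monic d₁ d₂ d₃ d₄ d₅ 0# ⟧ x ≈ s * ⟦ monic a₁ a₂ a₃ a₄ a₅ 0# ⟧ (t * x + u) + v) where
    private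
      -- The expansion in x of the right side of the relation minus the left. It has 8 coefficients
      -- and vanishes at 49 points, so coefficients may be compared.
      difference : Poly
      difference =
          s * ⟦ monic a₁ a₂ a₃ a₄ a₅ 0# ⟧ u + v
        ∷ s * t * (φ (5 , 0) * a₅ * u ^ 4 + φ (4 , 0) * a₄ * u ^ 3 + φ (3 , 0) * a₃ * u ^ 2 + φ (2 , 0) * a₂ * u + a₁) - d₁
        ∷ s * t ^ 2 * (φ (3 , 0) * a₅ * u ^ 3 + φ (6 , 0) * a₄ * u ^ 2 + φ (3 , 0) * a₃ * u + a₂) - d₂
        ∷ s * t ^ 3 * (φ (3 , 0) * a₅ * u ^ 2 + φ (4 , 0) * a₄ * u + a₃) - d₃
        ∷ s * t ^ 4 * (φ (5 , 0) * a₅ * u + a₄) - d₄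
        ∷ s * t ^ 5 * a₅ - d₅
        ∷ 0# ∷ s * t ^ 7 - 1# ∷ []

      difference≈0 : ∀ x → ⟦ difference ⟧ x ≈ 0#
      difference≈0 x = trans (sym (solve 15 (λ a₁ a₂ a₃ a₄ a₅ d₁ d₂ d₃ d₄ d₅ s t u v x →
        let p = con 0c ∷ a₁ ∷ a₂ ∷ a₃ ∷ a₄ ∷ a₅ ∷ con 0c ∷ con 1c ∷ []
            q = con 0c ∷ d₁ ∷ d₂ ∷ d₃ ∷ d₄ ∷ d₅ ∷ con 0c ∷ con 1c ∷ []
        in (s :* ⟦ p ⟧ₑ (t :* x :+ u) :+ v) :- ⟦ q ⟧ₑ x := ⟦
            s :* ⟦ p ⟧ₑ u :+ v
          ∷ s :* t :* (con (5 , 0) :* a₅ :* u :^ 4 :+ con (4 , 0) :* a₄ :* u :^ 3 :+ con (3 , 0) :* a₃ :* u :^ 2 :+ con (2 , 0) :* a₂ :* u :+ a₁) :- d₁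
          ∷ s :* t :^ 2 :* (con (3 , 0) :* a₅ :* u :^ 3 :+ con (6 , 0) :* a₄ :* u :^ 2 :+ con (3 , 0) :* a₃ :* u :+ a₂) :- d₂
          ∷ s :* t :^ 3 :* (con (3 , 0) :* a₅ :* u :^ 2 :+ con (4 , 0) :* a₄ :* u :+ a₃) :- d₃
          ∷ s :* t :^ 4 :* (con (5 , 0) :* a₅ :* u :+ a₄) :- d₄
          ∷ s :* t :^ 5 :* a₅ :- d₅
          ∷ con 0c ∷ s :* t :^ 7 :- con 1c ∷ [] ⟧ₑ x) ≡.refl a₁ a₂ a₃ a₄ a₅ d₁ d₂ d₃ d₄ d₅ s t u v x))
        (x≈y⇒x-y≈0 (sym (rel x)))

      coefficients≈0 : ∀ n → coeff difference n ≈ 0#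
      coefficients≈0 = vanishing difference 8≤order difference≈0

    compare₁ : s * t * (φ (5 , 0) * a₅ * u ^ 4 + φ (4 , 0) * a₄ * u ^ 3 + φ (3 , 0) * a₃ * u ^ 2 + φ (2 , 0) * a₂ * u + a₁) ≈ d₁
    compare₁ = x-y≈0⇒x≈y (coefficients≈0 1)

    compare₄ : s * t ^ 4 * (φ (5 , 0) * a₅ * u + a₄) ≈ d₄
    compare₄ = x-y≈0⇒x≈y (coefficients≈0 4)

    compare₅ : s * t ^ 5 * a₅ ≈ d₅
    compare₅ = x-y≈0⇒x≈y (coefficients≈0 5)

    compare₇ : s * t ^ 7 ≈ 1#
    compare₇ = x-y≈0⇒x≈y (coefficients≈0 7)

  ≐-intro : ∀ x y → φ x ≈ φ y → T (x ≐ y)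
  ≐-intro x y φx≈φy = ≡⇒== (φ-⊟-zero x y φx≈φy)

  ==0c⇒φ≈0 : ∀ a → T (a == 0c) → φ a ≈ 0#
  ==0c⇒φ≈0 a a≡0 = reflexive (≡.cong φ (==⇒≡ a 0c a≡0))

  -- The translation u never reaches the x⁵-coefficient, reaches the x⁴-coefficient only through a₅,
  -- and the x-coefficient only through a₂, ..., a₅; the guards in `matches` are exactly these
  -- vanishing conditions.
  matches-intro : ∀ a₁ a₂ a₃ a₄ a₅ d₁ d₂ d₃ d₄ d₅ s t⁷ t⁵ t⁴ t {u v} →
    φ s * φ t ^ 7 ≈ 1# → φ t⁷ ≈ φ t ^ 7 → φ t⁵ ≈ φ t ^ 5 → φ t⁴ ≈ φ t ^ 4 →
    (∀ x → ⟦ φₚ (septic d₁ d₂ d₃ d₄ d₅) ⟧ x ≈ φ s * ⟦ φₚ (septic a₁ a₂ a₃ a₄ a₅) ⟧ (φ t * x + u) + v) →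
    T (matches (septic a₁ a₂ a₃ a₄ a₅) (septic d₁ d₂ d₃ d₄ d₅) s t⁷ t⁵ t⁴ t)
  matches-intro a₁ a₂ a₃ a₄ a₅ d₁ d₂ d₃ d₄ d₅ s t⁷ t⁵ t⁴ t {u} st⁷≈1 t⁷≈ t⁵≈ t⁴≈ rel =
    ∧-intro {s ⊠ t⁷ ≐ 1c}
      (≐-intro (s ⊠ t⁷) 1c (trans (φ-⊠ s t⁷) (trans (*-congˡ t⁷≈) st⁷≈1)))
      (∧-intro {s ⊠ t⁵ ⊠ a₅ ≐ d₅}
        (≐-intro (s ⊠ t⁵ ⊠ a₅) d₅ (trans (φ-⊠ (s ⊠ t⁵) a₅) (trans (*-congʳ (trans (φ-⊠ s t⁵) (*-congˡ t⁵≈))) (compare₅ rel))))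
        (⇒-intro {a₅ == 0c} λ a₅≡0 → ∧-intro {s ⊠ t⁴ ⊠ a₄ ≐ d₄}
          (≐-intro (s ⊠ t⁴ ⊠ a₄) d₄ (trans (φ-⊠ (s ⊠ t⁴) a₄) (trans (*-congʳ (trans (φ-⊠ s t⁴) (*-congˡ t⁴≈)))
            (trans (*-congˡ (trans (sym (+-identityˡ _)) (+-congʳ (sym (trans (*-congʳ (trans (*-congˡ (==0c⇒φ≈0 a₅ a₅≡0)) (zeroʳ _))) (zeroˡ u))))))
              (compare₄ rel)))))
          (⇒-intro {a₄ == 0c} λ a₄≡0 → ⇒-intro {a₃ == 0c} λ a₃≡0 → ⇒-intro {a₂ == 0c} λ a₂≡0 →
            ≐-intro (s ⊠ t ⊠ a₁) d₁ (trans (φ-⊠ (s ⊠ t) a₁) (trans (*-congʳ (φ-⊠ s t))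
              (trans (*-congˡ (sym (lower-terms (==0c⇒φ≈0 a₂ a₂≡0) (==0c⇒φ≈0 a₃ a₃≡0) (==0c⇒φ≈0 a₄ a₄≡0) (==0c⇒φ≈0 a₅ a₅≡0))))
                (compare₁ rel)))))))
    where
    ∧-intro : ∀ {a b} → T a → T b → T (a ∧ b)
    ∧-intro {true} _ b = b
    lower-terms : ∀ {a₁ a₂ a₃ a₄ a₅} → a₂ ≈ 0# → a₃ ≈ 0# → a₄ ≈ 0# → a₅ ≈ 0# →
      φ (5 , 0) * a₅ * u ^ 4 + φ (4 , 0) * a₄ * u ^ 3 + φ (3 , 0) * a₃ * u ^ 2 + φ (2 , 0) * a₂ * u + a₁ ≈ a₁
    lower-terms {a₁} a₂≈0 a₃≈0 a₄≈0 a₅≈0 = trans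
      (+-congʳ (+-cong (+-cong (+-cong (*-congʳ (*-congˡ a₅≈0)) (*-congʳ (*-congˡ a₄≈0))) (*-congʳ (*-congˡ a₃≈0))) (*-congʳ (*-congˡ a₂≈0))))
      (solve 2 (λ u a₁ → con (5 , 0) :* con 0c :* u :^ 4 :+ con (4 , 0) :* con 0c :* u :^ 3 :+
        con (3 , 0) :* con 0c :* u :^ 2 :+ con (2 , 0) :* con 0c :* u :+ a₁ := a₁) ≡.refl u a₁)

  -- Both polynomials are monic, which forces s = t⁻⁷; only the 49 codes for t remain to be checked.
  septic-∼ : ∀ a₁ a₂ a₃ a₄ a₅ d₁ d₂ d₃ d₄ d₅ →
    φₚ (septic a₁ a₂ a₃ a₄ a₅) ∼ φₚ (septic d₁ d₂ d₃ d₄ d₅) →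
    ∃[ t ] t ∈ codes × T (matches (septic a₁ a₂ a₃ a₄ a₅) (septic d₁ d₂ d₃ d₄ d₅) (inv (t ⊠^ 7)) (t ⊠^ 7) (t ⊠^ 5) (t ⊠^ 4) t)
  septic-∼ a₁ a₂ a₃ a₄ a₅ d₁ d₂ d₃ d₄ d₅ (s , t , u , v , s≉0 , t≉0 , rel) =
    τ , code∈ , matches-intro a₁ a₂ a₃ a₄ a₅ d₁ d₂ d₃ d₄ d₅ (inv (τ ⊠^ 7)) (τ ⊠^ 7) (τ ⊠^ 5) (τ ⊠^ 4) τ
      st⁷≈1 (φ-^ τ 7) (φ-^ τ 5) (φ-^ τ 4) λ x → trans (rel x)
        (+-congʳ (*-cong s≈ (⟦⟧-cong (φₚ (septic a₁ a₂ a₃ a₄ a₅)) (+-congʳ (*-congʳ (sym φ-code))))))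
    where
    open CodeOf t renaming (code to τ)
    t⁷≉0 : φ (τ ⊠^ 7) ≉ 0#
    t⁷≉0 t⁷≈0 = ^-nonzero 7 t≉0 (trans (^-congˡ 7 (sym φ-code)) (trans (sym (φ-^ τ 7)) t⁷≈0))
    t⁷s≈1 : φ (τ ⊠^ 7) * φ (inv (τ ⊠^ 7)) ≈ 1#
    t⁷s≈1 = φ-inv (⊠∈codes τ (τ ⊠^ 6)) t⁷≉0
    st⁷≈1 : φ (inv (τ ⊠^ 7)) * φ τ ^ 7 ≈ 1#
    st⁷≈1 = trans (*-comm _ _) (trans (*-congʳ (sym (φ-^ τ 7))) t⁷s≈1)
    s≈ : s ≈ φ (inv (τ ⊠^ 7))
    s≈ = *-cancelˡ t⁷≉0 (trans (trans (*-comm _ s) (trans (*-congˡ (trans (φ-^ τ 7) (^-congˡ 7 φ-code))) (compare₇ rel))) (sym t⁷s≈1))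

  target-septic : ∀ i → ∃[ a₁ ] ∃[ a₂ ] ∃[ a₃ ] ∃[ a₄ ] ∃[ a₅ ] target i ≡ septic a₁ a₂ a₃ a₄ a₅
  target-septic 0F = _ , _ , _ , _ , _ , ≡.refl
  target-septic 1F = _ , _ , _ , _ , _ , ≡.refl
  target-septic 2F = _ , _ , _ , _ , _ , ≡.refl
  target-septic 3F = _ , _ , _ , _ , _ , ≡.refl
  target-septic 4F = _ , _ , _ , _ , _ , ≡.refl
  target-septic 5F = _ , _ , _ , _ , _ , ≡.refl
  target-septic 6F = _ , _ , _ , _ , _ , ≡.refl
  target-septic 7F = _ , _ , _ , _ , _ , ≡.refl
  target-septic 8F = _ , _ , _ , _ , _ , ≡.refl
  target-septic 9F = _ , _ , _ , _ , _ , ≡.refl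

  ∼-matches : ∀ {p q} → (∃[ a₁ ] ∃[ a₂ ] ∃[ a₃ ] ∃[ a₄ ] ∃[ a₅ ] p ≡ septic a₁ a₂ a₃ a₄ a₅) →
    (∃[ a₁ ] ∃[ a₂ ] ∃[ a₃ ] ∃[ a₄ ] ∃[ a₅ ] q ≡ septic a₁ a₂ a₃ a₄ a₅) → φₚ p ∼ φₚ q →
    ∃[ t ] t ∈ codes × T (matches p q (inv (t ⊠^ 7)) (t ⊠^ 7) (t ⊠^ 5) (t ⊠^ 4) t)
  ∼-matches (a₁ , a₂ , a₃ , a₄ , a₅ , ≡.refl) (d₁ , d₂ , d₃ , d₄ , d₅ , ≡.refl) = septic-∼ a₁ a₂ a₃ a₄ a₅ d₁ d₂ d₃ d₄ d₅

  targets-distinct : ∀ i j → φₚ (target (inject₁ i)) ∼ φₚ (target (inject₁ j)) → i ≡ j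
  targets-distinct i j rel = Fin.toℕ-injective (ℕ.≡ᵇ⇒≡ (toℕ i) (toℕ j)
    (⇒-elim {matches (target (inject₁ i)) (target (inject₁ j)) (inv (t ⊠^ 7)) (t ⊠^ 7) (t ⊠^ 5) (t ⊠^ 4) t} {toℕ i ℕ.≡ᵇ toℕ j}
      (every₃-∈ matches-distinct (∈-allFin i) (∈-allFin j) (proj₁ (proj₂ found))) (proj₂ (proj₂ found))))
    where
    found = ∼-matches {target (inject₁ i)} {target (inject₁ j)} (target-septic (inject₁ i)) (target-septic (inject₁ j)) rel
    t = proj₁ found

  private
    module E = Evaluation commutativeRing commutativeRing
    id-hom = Identity.isRingHomomorphism rawRing refl

  linearlyRelated⇒∼ : ∀ {f g} → LinearlyRelated f g → f ∼ g
  linearlyRelated⇒∼ {f} {g} (s , t , u , v , s≉0 , t≉0 , g≋) = s , t , u , v , s≉0 , t≉0 , λ x → begin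
    ⟦ g ⟧ x            ≈⟨ ⟦⟧-≋ g h x g≋ ⟩
    ⟦ h ⟧ x            ≈⟨ ⟦map-id⟧ h x ⟨
    ⟦ map id h ⟧ x     ≈⟨ E.eval-linear id-hom f s t u v x ⟩
    s * ⟦ map id f ⟧ (t * x + u) + v ≈⟨ +-congʳ (*-congˡ (⟦map-id⟧ f (t * x + u))) ⟩
    s * ⟦ f ⟧ (t * x + u) + v ∎
    where h = s X^ 0 ⊗ (f ⊚ (t X^ 1 ⊕ u X^ 0)) ⊕ v X^ 0

  equal-functions : ∀ p q → DegreeBelow p 8 → DegreeBelow q 8 → (∀ x → ⟦ p ⟧ x ≈ ⟦ q ⟧ x) → p ≋ q
  equal-functions p q p<8 q<8 p≈q n = x-y≈0⇒x≈y (difference n)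
    where
    -- Cut to eight entries: the given lists may carry trailing zeros, whereas `vanishing` bounds
    -- the length of the list.
    d : Poly
    d = coefficients (p ⊕ map (- 1# *_) q)
    coeff-d : ∀ n → coeff (p ⊕ map (- 1# *_) q) n ≈ coeff p n - coeff q n
    coeff-d n = trans (coeff-⊕ p (map (- 1# *_) q) n) (+-congˡ (trans (coeff-scale (- 1#) q n) (-1*x≈-x _)))
    d<8 : DegreeBelow (p ⊕ map (- 1# *_) q) 8
    d<8 = ⊕-degree p (map (- 1# *_) q) p<8 (scale-degree (- 1#) q q<8)
    ⟦d⟧≈0 : ∀ x → ⟦ d ⟧ x ≈ 0#
    ⟦d⟧≈0 x = begin
      ⟦ d ⟧ x                                  ≈⟨ ⟦⟧-≋ (p ⊕ map (- 1# *_) q) d x (≋-coefficients (p ⊕ map (- 1# *_) q) d<8) ⟨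
      ⟦ p ⊕ map (- 1# *_) q ⟧ x                ≈⟨ ⟦map-id⟧ (p ⊕ map (- 1# *_) q) x ⟨
      ⟦ map id (p ⊕ map (- 1# *_) q) ⟧ x       ≈⟨ E.eval-⊕ id-hom p (map (- 1# *_) q) x ⟩
      ⟦ map id p ⟧ x + ⟦ map id (map (- 1# *_) q) ⟧ x ≈⟨ +-cong (⟦map-id⟧ p x) (E.eval-scale id-hom (- 1#) q x) ⟩
      ⟦ p ⟧ x + - 1# * ⟦ map id q ⟧ x          ≈⟨ +-congˡ (trans (*-congˡ (⟦map-id⟧ q x)) (-1*x≈-x _)) ⟩
      ⟦ p ⟧ x - ⟦ q ⟧ x                        ≈⟨ x≈y⇒x-y≈0 (p≈q x) ⟩
      0#                                       ∎
    difference : ∀ n → coeff p n - coeff q n ≈ 0#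
    difference n = trans (sym (coeff-d n)) (trans (≋-coefficients (p ⊕ map (- 1# *_) q) d<8 n) (vanishing d 8≤order ⟦d⟧≈0 n))

  ∼⇒linearlyRelated : ∀ {f g} → DegreeBelow f 8 → DegreeBelow g 8 → f ∼ g → LinearlyRelated f g
  ∼⇒linearlyRelated {f} {g} f<8 g<8 (s , t , u , v , s≉0 , t≉0 , g≈) = s , t , u , v , s≉0 , t≉0 ,
    equal-functions g h g<8 h<8 λ x → begin
      ⟦ g ⟧ x                          ≈⟨ g≈ x ⟩
      s * ⟦ f ⟧ (t * x + u) + v        ≈⟨ +-congʳ (*-congˡ (⟦map-id⟧ f (t * x + u))) ⟨
      s * ⟦ map id f ⟧ (t * x + u) + v ≈⟨ E.eval-linear id-hom f s t u v x ⟨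
      ⟦ map id h ⟧ x                   ≈⟨ ⟦map-id⟧ h x ⟩
      ⟦ h ⟧ x                          ∎
    where
    h = s X^ 0 ⊗ (f ⊚ (t X^ 1 ⊕ u X^ 0)) ⊕ v X^ 0
    h<8 : DegreeBelow h 8
    h<8 = ⊕-degree (s X^ 0 ⊗ (f ⊚ (t X^ 1 ⊕ u X^ 0))) (v X^ 0)
      (constant-⊗-degree s (f ⊚ (t X^ 1 ⊕ u X^ 0)) (linear-⊚-degree f u t f<8)) (singleton-degree v)

  pointwise⇒≋ : ∀ {p q} → Pointwise _≈_ p q → p ≋ q
  pointwise⇒≋ []          n       = refl
  pointwise⇒≋ (a≈b ∷ p≈q) zero    = a≈b
  pointwise⇒≋ (a≈b ∷ p≈q) (suc n) = pointwise⇒≋ p≈q n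

  exceptionalForms : Vec Poly 9
  exceptionalForms =
      (1# X^ 7 ⊕ 0# X^ 1)
    ∷ (1# X^ 7 ⊕ e X^ 1)
    ∷ (1# X^ 7 ⊕ (e ^ 2) X^ 1)
    ∷ (1# X^ 7 ⊕ (e ^ 3) X^ 1)
    ∷ (1# X^ 7 ⊕ (e ^ 4) X^ 1)
    ∷ (1# X^ 7 ⊕ (e ^ 5) X^ 1)
    ∷ (1# X^ 7 ⊕ 1# X^ 4 ⊕ (2 · 1#) X^ 1)
    ∷ (1# X^ 7 ⊕ (e ^ 2) X^ 4 ⊕ (2 · e ^ 4) X^ 1)
    ∷ (1# X^ 7 ⊕ e X^ 5 ⊕ (5 · e ^ 2) X^ 3 ⊕ (6 · e ^ 3) X^ 1)
    ∷ []

  sporadicForm : Poly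
  sporadicForm = 1# X^ 7 ⊕ e X^ 5 ⊕ (e ^ 18) X^ 3 ⊕ (e ^ 35) X^ 1

  forms : Vec Poly 10
  forms = exceptionalForms ∷ʳ sporadicForm

  private
    0+0 = +-identityˡ 0#
    power : ∀ n → e ^ n ≈ φ (ec ⊠^ n)
    power n = sym (trans (φ-^ ec n) (^-congˡ n φ-e))

    binomial : ∀ {a} α → a ≈ φ α → (1# X^ 7 ⊕ a X^ 1) ≋ φₚ (septic α 0c 0c 0c 0c)
    binomial α a≈ = pointwise⇒≋ (0+0 ∷ trans (+-identityˡ _) a≈ ∷ refl ∷ refl ∷ refl ∷ refl ∷ refl ∷ refl ∷ [])

    trinomial : ∀ {a b} α β → a ≈ φ α → b ≈ φ β → (1# X^ 7 ⊕ a X^ 4 ⊕ b X^ 1) ≋ φₚ (septic β 0c 0c α 0c)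
    trinomial α β a≈ b≈ = pointwise⇒≋ (trans (+-congʳ 0+0) 0+0 ∷ trans (+-congʳ 0+0) (trans (+-identityˡ _) b≈) ∷
      0+0 ∷ 0+0 ∷ trans (+-identityˡ _) a≈ ∷ refl ∷ refl ∷ refl ∷ [])

    quadrinomial : ∀ {a b d} α β δ → a ≈ φ α → b ≈ φ β → d ≈ φ δ →
      (1# X^ 7 ⊕ a X^ 5 ⊕ b X^ 3 ⊕ d X^ 1) ≋ φₚ (septic δ 0c β 0c α)
    quadrinomial α β δ a≈ b≈ d≈ = pointwise⇒≋ (trans (+-congʳ (trans (+-congʳ 0+0) 0+0)) 0+0 ∷
      trans (+-congʳ (trans (+-congʳ 0+0) 0+0)) (trans (+-identityˡ _) d≈) ∷
      trans (+-congʳ 0+0) 0+0 ∷ trans (+-congʳ 0+0) (trans (+-identityˡ _) b≈) ∷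
      0+0 ∷ trans (+-identityˡ _) a≈ ∷ refl ∷ refl ∷ [])

  forms≋target : ∀ i → Vec.lookup forms i ≋ φₚ (target i)
  forms≋target 0F = binomial 0c refl
  forms≋target 1F = binomial ec (sym φ-e)
  forms≋target 2F = binomial (ec ⊠^ 2) (power 2)
  forms≋target 3F = binomial (ec ⊠^ 3) (power 3)
  forms≋target 4F = binomial (ec ⊠^ 4) (power 4)
  forms≋target 5F = binomial (ec ⊠^ 5) (power 5)
  forms≋target 6F = trinomial 1c (2 , 0) refl refl
  forms≋target 7F = trinomial (ec ⊠^ 2) ((2 , 0) ⊠ ec ⊠^ 4) (power 2)
    (trans (solve 1 (λ x → x :+ (x :+ con 0c) := con (2 , 0) :* x) ≡.refl (e ^ 4))
      (trans (*-congˡ (power 4)) (sym (φ-⊠ (2 , 0) (ec ⊠^ 4)))))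
  forms≋target 8F = quadrinomial ec ((5 , 0) ⊠ ec ⊠^ 2) ((6 , 0) ⊠ ec ⊠^ 3) (sym φ-e)
    (trans (solve 1 (λ x → x :+ (x :+ (x :+ (x :+ (x :+ con 0c)))) := con (5 , 0) :* x) ≡.refl (e ^ 2))
      (trans (*-congˡ (power 2)) (sym (φ-⊠ (5 , 0) (ec ⊠^ 2)))))
    (trans (solve 1 (λ x → x :+ (x :+ (x :+ (x :+ (x :+ (x :+ con 0c))))) := con (6 , 0) :* x) ≡.refl (e ^ 3))
      (trans (*-congˡ (power 3)) (sym (φ-⊠ (6 , 0) (ec ⊠^ 3)))))
  forms≋target 9F = quadrinomial ec (ec ⊠^ 18) (ec ⊠^ 35) (sym φ-e) (power 18) (power 35)

  ∼-respʳ-≋ : ∀ {f g h} → g ≋ h → f ∼ g → f ∼ h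
  ∼-respʳ-≋ {f} {g} {h} g≋h (s , t , u , v , s≉0 , t≉0 , g≈) =
    s , t , u , v , s≉0 , t≉0 , λ x → trans (sym (⟦⟧-≋ g h x g≋h)) (g≈ x)

  ∼-form⇒∼-target : ∀ {f} i → f ∼ Vec.lookup forms i → f ∼ φₚ (target i)
  ∼-form⇒∼-target {f} i = ∼-respʳ-≋ {f} {Vec.lookup forms i} {φₚ (target i)} (forms≋target i)

  form-degree : ∀ i → DegreeBelow (Vec.lookup forms i) 8
  form-degree i {m} 8≤m = trans (forms≋target i m) (septic-degree (target-septic i) 8≤m)
    where
    septic-degree : ∀ {p} → (∃[ a₁ ] ∃[ a₂ ] ∃[ a₃ ] ∃[ a₄ ] ∃[ a₅ ] p ≡ septic a₁ a₂ a₃ a₄ a₅) → DegreeBelow (φₚ p) 8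
    septic-degree (_ , _ , _ , _ , _ , ≡.refl) (s≤s (s≤s (s≤s (s≤s (s≤s (s≤s (s≤s (s≤s _)))))))) = refl

  ∼-target⇒linearlyRelated : ∀ {f} i → DegreeBelow f 8 → f ∼ φₚ (target i) → LinearlyRelated f (Vec.lookup forms i)
  ∼-target⇒linearlyRelated {f} i f<8 f∼ = ∼⇒linearlyRelated {f} {Vec.lookup forms i} f<8 (form-degree i)
    (∼-respʳ-≋ {f} {φₚ (target i)} {Vec.lookup forms i} (λ n → sym (forms≋target i n)) f∼)

  exceptionalForms-lookup : ∀ k → Vec.lookup forms (inject₁ k) ≡ Vec.lookup exceptionalForms k
  exceptionalForms-lookup = lookup-∷ʳ exceptionalForms
    where
    lookup-∷ʳ : ∀ {n} (xs : Vec Poly n) {x} k → Vec.lookup (xs ∷ʳ x) (inject₁ k) ≡ Vec.lookup xs k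
    lookup-∷ʳ (x ∷ xs) Fin.zero    = ≡.refl
    lookup-∷ʳ (x ∷ xs) (Fin.suc k) = lookup-∷ʳ xs k

-- Injectivity of x (xⁿ - a)ʳ and of x⁷

module RadicalForm {c ℓ₁ ℓ₂} (F : FiniteField c ℓ₁ ℓ₂) (A : F₄₉Algebra (FiniteField.commutativeRing F)) where
  open FiniteField F
  open FiniteFieldProperties F
  open Polynomial commutativeRing
  open Scalars commutativeRing A
  open Solver using (con; _:=_; _:*_; _:-_; :-_; _:^_)
  open Exp commutativeSemiring using (^-congˡ; ^-distrib-*; ^-assocʳ)
  open SetoidReasoning ≈-setoid

  -- With ρ = (yⁿ − a) / (xⁿ − a) an equality of values reads x = y ρʳ, and then
  -- ρ (xⁿ − a) = yⁿ − a becomes (ρ − 1) (yⁿ (ρ − 1)⁶ − a) = 0, so a = (y (ρ − 1)ʳ)ⁿ unless ρ = 1.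
  radicalForm-injective : ∀ n r → r ℕ.* n ≡ 6 → ∀ {a} → ¬ IsPower commutativeRing n a →
    Injective _≈_ _≈_ (λ x → x * (x ^ n - a) ^ r)
  radicalForm-injective n r rn≡6 {a} nonpower {x} {y} fx≈fy = conclude (ρ - 1# ≟ 0#)
    where
    X = x ^ n - a
    Y = y ^ n - a
    X≉0 : X ≉ 0#
    X≉0 X≈0 = nonpower (x , x-y≈0⇒x≈y X≈0)
    z = proj₁ (inverse X≉0)
    Xz≈1 : X * z ≈ 1#
    Xz≈1 = proj₂ (inverse X≉0)
    ρ = Y * z
    ρX≈Y : ρ * X ≈ Y
    ρX≈Y = trans (solve 3 (λ X Y z → Y :* z :* X := Y :* (X :* z)) ≡.refl X Y z)
      (trans (*-congˡ Xz≈1) (*-identityʳ Y))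
    x≈yρʳ : x ≈ y * ρ ^ r
    x≈yρʳ = *-cancelˡ (^-nonzero r X≉0) (begin
      X ^ r * x             ≈⟨ *-comm _ x ⟩
      x * X ^ r             ≈⟨ fx≈fy ⟩
      y * Y ^ r             ≈⟨ *-congˡ (^-congˡ r ρX≈Y) ⟨
      y * (ρ * X) ^ r       ≈⟨ *-congˡ (^-distrib-* ρ X r) ⟩
      y * (ρ ^ r * X ^ r)   ≈⟨ solve 3 (λ y p q → y :* (p :* q) := q :* (y :* p)) ≡.refl y (ρ ^ r) (X ^ r) ⟩
      X ^ r * (y * ρ ^ r)   ∎)
    [wʳ]ⁿ : ∀ w → (y * w ^ r) ^ n ≈ y ^ n * w ^ 6
    [wʳ]ⁿ w = trans (^-distrib-* y (w ^ r) n)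
      (*-congˡ (trans (^-assocʳ w r n) (reflexive (≡.cong (w ^_) rn≡6))))
    key : (ρ - 1#) * (y ^ n * (ρ - 1#) ^ 6 - a) ≈ 0#
    key = begin
      (ρ - 1#) * (y ^ n * (ρ - 1#) ^ 6 - a)
        ≈⟨ solve 3 (λ ρ y a → (ρ :- con 1c) :* (y :* (ρ :- con 1c) :^ 6 :- a) := ρ :* (y :* ρ :^ 6 :- a) :- (y :- a)) ≡.refl ρ (y ^ n) a ⟩
      ρ * (y ^ n * ρ ^ 6 - a) - Y
        ≈⟨ +-congʳ (*-congˡ (+-congʳ (trans (^-congˡ n x≈yρʳ) ([wʳ]ⁿ ρ)))) ⟨
      ρ * X - Y ≈⟨ x≈y⇒x-y≈0 ρX≈Y ⟩
      0# ∎
    conclude : Dec (ρ - 1# ≈ 0#) → x ≈ y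
    conclude (yes ρ≈1) = begin
      x            ≈⟨ x≈yρʳ ⟩
      y * ρ ^ r    ≈⟨ *-congˡ (^-congˡ r (x-y≈0⇒x≈y ρ≈1)) ⟩
      y * 1# ^ r   ≈⟨ *-congˡ (1^n≈1 r) ⟩
      y * 1#       ≈⟨ *-identityʳ y ⟩
      y            ∎
      where
      1^n≈1 : ∀ n → 1# ^ n ≈ 1#
      1^n≈1 zero    = refl
      1^n≈1 (suc n) = trans (*-identityˡ _) (1^n≈1 n)
    conclude (no ρ≉1) = contradiction
      (y * (ρ - 1#) ^ r , trans ([wʳ]ⁿ (ρ - 1#)) (x-y≈0⇒x≈y (zero-product key ρ≉1))) nonpower

  -- The seventh power is additive here and a field has no nilpotents.
  x^7-injective : Injective _≈_ _≈_ (_^ 7)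
  x^7-injective {x} {y} x⁷≈y⁷ = x-y≈0⇒x≈y (^-zero 7 (begin
    (x - y) ^ 7     ≈⟨ solve 2 (λ x y → (x :- y) :^ 7 := x :^ 7 :- y :^ 7) ≡.refl x y ⟩
    x ^ 7 - y ^ 7   ≈⟨ x≈y⇒x-y≈0 x⁷≈y⁷ ⟩
    0#              ∎))

  sixth⇒cube : ∀ {a} → IsPower commutativeRing 6 a → IsPower commutativeRing 3 a
  sixth⇒cube (w , w⁶≈a) = w ^ 2 , trans (^-assocʳ w 2 3) w⁶≈a

  sixth⇒square : ∀ {a} → IsPower commutativeRing 6 a → IsPower commutativeRing 2 a
  sixth⇒square (w , w⁶≈a) = w ^ 3 , trans (^-assocʳ w 3 2) w⁶≈a

-- Transport of polynomials and relations along an embedding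

module AlongExtension {c ℓ₁ ℓ₂} (K L : FiniteField c ℓ₁ ℓ₂)
  {ι : FiniteField.Carrier K → FiniteField.Carrier L}
  (ι-mono : IsRingMonomorphism (FiniteField.rawRing K) (FiniteField.rawRing L) ι)
  (A : F₄₉Algebra (FiniteField.commutativeRing K)) where
  private
    module K where
      open FiniteField K public
      open FiniteFieldProperties K public
      open Polynomial commutativeRing public
      open Scalars commutativeRing A public
  open FiniteField L
  open FiniteFieldProperties L
  open Polynomial commutativeRing
  open PolynomialProperties commutativeRing
  open IsRingMonomorphism ι-mono renaming (⟦⟧-cong to ι-cong)

  algebra : F₄₉Algebra commutativeRing
  algebra = Homomorphism.image isRingHomomorphism A

  open Homomorphism {R = K.commutativeRing} {S = commutativeRing} isRingHomomorphism using (ι-·1)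
  open Scalars commutativeRing algebra
  open CodeValues commutativeRing algebra
  open SetoidReasoning ≈-setoid
  private
    module E = Evaluation K.commutativeRing commutativeRing

  ι-φ : ∀ x → ι (K.φ x) ≈ φ x
  ι-φ (a , b) = begin
    ι (K.φ (a , b))                          ≈⟨ ι-cong (K.φ-def a b) ⟩
    ι (a K.· K.1# K.+ (b K.· K.1#) K.* e)    ≈⟨ +-homo _ _ ⟩
    ι (a K.· K.1#) + ι ((b K.· K.1#) K.* e)  ≈⟨ +-cong (ι-·1 a) (trans (*-homo _ _) (*-congʳ (ι-·1 b))) ⟩
    a · 1# + (b · 1#) * ι e                  ≈⟨ φ-def a b ⟨
    φ (a , b)                                ∎
    where
    open F₄₉Algebra A using (e)

  ι-eval : ∀ f x → ⟦ map ι f ⟧ (ι x) ≈ ι (K.⟦ f ⟧ x)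
  ι-eval []      x = sym 0#-homo
  ι-eval (a ∷ f) x = sym (trans (+-homo a _) (+-congˡ (trans (*-homo x _) (*-congˡ (sym (ι-eval f x))))))

  descend-injective : ∀ f → Injective _≈_ _≈_ ⟦ map ι f ⟧ → Injective K._≈_ K._≈_ K.⟦ f ⟧
  descend-injective f inj {x} {y} fx≈fy = injective (inj (trans (ι-eval f x)
    (trans (ι-cong fx≈fy) (sym (ι-eval f y)))))

  φₚ-eval : ∀ p y → ⟦ map ι (map K.φ p) ⟧ y ≈ ⟦ φₚ p ⟧ y
  φₚ-eval []      y = refl
  φₚ-eval (a ∷ p) y = +-cong (ι-φ a) (*-congˡ (φₚ-eval p y))

  form-eval : ∀ f p → f K.≋ map K.φ p → ∀ y → ⟦ map ι f ⟧ y ≈ ⟦ φₚ p ⟧ y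
  form-eval f p f≋p y = trans (⟦⟧-≋ (map ι f) (map ι (map K.φ p)) y (E.map-≋ isRingHomomorphism {f} {map K.φ p} f≋p)) (φₚ-eval p y)

  form-injective : ∀ f p → f K.≋ map K.φ p → Injective _≈_ _≈_ ⟦ φₚ p ⟧ → Injective _≈_ _≈_ ⟦ map ι f ⟧
  form-injective f p f≋p inj {x} {y} fx≈fy =
    inj (trans (sym (form-eval f p f≋p x)) (trans fx≈fy (form-eval f p f≋p y)))

  form-injective⁻¹ : ∀ f p → f K.≋ map K.φ p → Injective _≈_ _≈_ ⟦ map ι f ⟧ → Injective _≈_ _≈_ ⟦ φₚ p ⟧
  form-injective⁻¹ f p f≋p inj {x} {y} px≈py =
    inj (trans (form-eval f p f≋p x) (trans px≈py (sym (form-eval f p f≋p y))))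

  ι≉0 : ∀ {x} → x K.≉ K.0# → ι x ≉ 0#
  ι≉0 x≉0 ιx≈0 = x≉0 (injective (trans ιx≈0 (sym 0#-homo)))

  private
    related-eval : ∀ {f g} (rel : K.LinearlyRelated f g) → let s , t , u , v , _ = rel in
      ∀ y → ⟦ map ι g ⟧ y ≈ ι s * ⟦ map ι f ⟧ (ι t * y + ι u) + ι v
    related-eval {f} {g} (s , t , u , v , _ , _ , g≋) y = trans
      (⟦⟧-≋ (map ι g) (map ι h) y (E.map-≋ isRingHomomorphism {g} {h} g≋))
      (E.eval-linear isRingHomomorphism f s t u v y)
      where h = s K.X^ 0 K.⊗ (f K.⊚ (t K.X^ 1 K.⊕ u K.X^ 0)) K.⊕ v K.X^ 0

    open import Algebra.Properties.Group +-group using () renaming (∙-cancelʳ to +-cancelʳ)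

  related-injective : ∀ {f g} → K.LinearlyRelated f g → Injective _≈_ _≈_ ⟦ map ι f ⟧ → Injective _≈_ _≈_ ⟦ map ι g ⟧
  related-injective {f} {g} rel@(s , t , u , v , s≉0 , t≉0 , _) f-inj {x} {y} gx≈gy =
    *-cancelˡ (ι≉0 t≉0) (+-cancelʳ (ι u) _ _ (f-inj (*-cancelˡ (ι≉0 s≉0) (+-cancelʳ (ι v) _ _
      (trans (sym (related-eval {f} {g} rel x)) (trans gx≈gy (related-eval {f} {g} rel y)))))))

  related-injective⁻¹ : ∀ {f g} → K.LinearlyRelated f g → Injective _≈_ _≈_ ⟦ map ι g ⟧ → Injective _≈_ _≈_ ⟦ map ι f ⟧
  related-injective⁻¹ {f} {g} rel@(s , t , u , v , s≉0 , t≉0 , _) g-inj {x} {y} fx≈fy = begin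
    x                    ≈⟨ back x ⟨
    ι t * pre x + ι u    ≈⟨ +-congʳ (*-congˡ (g-inj (trans (related-eval {f} {g} rel (pre x)) (trans
                              (+-congʳ (*-congˡ (trans (⟦⟧-cong (map ι f) (back x)) (trans fx≈fy (sym (⟦⟧-cong (map ι f) (back y)))))))
                              (sym (related-eval {f} {g} rel (pre y))))))) ⟩
    ι t * pre y + ι u    ≈⟨ back y ⟩
    y                    ∎
    where
    t⁻¹ = proj₁ (inverse (ι≉0 t≉0))
    pre : Carrier → Carrier
    pre x = t⁻¹ * (x - ι u)
    back : ∀ x → ι t * pre x + ι u ≈ x
    back x = begin
      ι t * (t⁻¹ * (x - ι u)) + ι u  ≈⟨ +-congʳ (trans (sym (*-assoc _ _ _)) (*-congʳ (proj₂ (inverse (ι≉0 t≉0))))) ⟩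
      1# * (x - ι u) + ι u           ≈⟨ +-congʳ (*-identityˡ _) ⟩
      x - ι u + ι u                  ≈⟨ +-assoc x _ _ ⟩
      x + (- ι u + ι u)              ≈⟨ +-congˡ (-‿inverseˡ (ι u)) ⟩
      x + 0#                         ≈⟨ +-identityʳ x ⟩
      x                              ∎

-- Exceptionality of the nine forms

nonsquare-e : Every (λ c → not (c ⊠^ 2 ≐ ec)) codes
nonsquare-e = every ≡.refl

noncube-e : Every (λ c → not (c ⊠^ 3 ≐ ec)) codes
noncube-e = every ≡.refl

-- With 2ᴺ or 3ᴺ as the degree it yields, for every N, an admissible m > N.
n<b^n : ∀ b n → n ℕ.< suc (suc b) ℕ.^ n
n<b^n b zero    = s≤s z≤n
n<b^n b (suc n) = ℕ.≤-trans (ℕ.+-mono-≤ (ℕ.≤-trans (s≤s z≤n) (n<b^n b n)) (n<b^n b n))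
  (ℕ.+-monoʳ-≤ (B ℕ.^ n) (ℕ.m≤m+n (B ℕ.^ n) (b ℕ.* B ℕ.^ n)))
  where B = suc (suc b)

module ExceptionalForms {c ℓ₁ ℓ₂} (K : FiniteField c ℓ₁ ℓ₂) (order≡49 : FiniteField.order K ≡ 49)
  (A : F₄₉Algebra (FiniteField.commutativeRing K)) where
  private
    module K where
      open FiniteField K public
      open FiniteFieldProperties K public
      open Polynomial commutativeRing public
      open Scalars commutativeRing A public
      open CodeValues commutativeRing A public
      open Field49 K order≡49 A public
      open Classification K order≡49 A public
      open Uniqueness K order≡49 A public
      open Exp commutativeSemiring using (^-congˡ) public

  φ-nonpower : ∀ n α → Every (λ c → not (c ⊠^ n ≐ α)) codes → ¬ IsPower K.commutativeRing n (K.φ α)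
  φ-nonpower n α checked (w , wⁿ≈α) = not-elim {code ⊠^ n ≐ α} (every-∈ checked code∈)
    (K.≐-intro (code ⊠^ n) α (K.trans (K.φ-^ code n) (K.trans (K.^-congˡ n φ-code) wⁿ≈α)))
    where open K.CodeOf w

  module OverExtension {m n} (E : Extension K m n) where
    open Extension E
    open AlongExtension K L ι-mono A public
    open FiniteField L
    open Polynomial commutativeRing
    open Scalars commutativeRing algebra
    open CodeValues commutativeRing algebra
    open Symbolic
    open RadicalForm L algebra
    open Solver using (con; _:=_; _:*_; _:-_; :-_; _:^_)

    -- The non-power property of the extension is about images under ι; this restates it for codes
    -- interpreted in L, as the radical forms need it.
    lift-nonpower : ∀ {α} → ¬ IsPower K.commutativeRing n (K.φ α) → ¬ IsPower commutativeRing n (φ α)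
    lift-nonpower {α} np (w , wⁿ≈α) = Extension.nonpower E np (w , trans wⁿ≈α (sym (ι-φ α)))

    InjectiveTarget : Fin 9 → Set _
    InjectiveTarget k = Injective _≈_ _≈_ ⟦ φₚ (target (inject₁ k)) ⟧

    via : ∀ k n r α → r ℕ.* n ≡ 6 → (∀ x → ⟦ φₚ (target (inject₁ k)) ⟧ x ≈ x * (x ^ n - φ α) ^ r) →
      ¬ IsPower commutativeRing n (φ α) → InjectiveTarget k
    via k n r α rn≡6 form np {x} {y} fx≈fy =
      radicalForm-injective n r rn≡6 np (trans (sym (form x)) (trans fx≈fy (form y)))

    injective₀ : InjectiveTarget 0F
    injective₀ {x} {y} fx≈fy = x^7-injective (trans (sym (form x)) (trans fx≈fy (form y)))
      where
      form : ∀ x → ⟦ φₚ (target 0F) ⟧ x ≈ x ^ 7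
      form = solve 1 (λ x → ⟦ map con (target 0F) ⟧ₑ x := x :^ 7) ≡.refl

    injective₁ : ¬ IsPower commutativeRing 6 (φ (⊟ ec)) → InjectiveTarget 1F
    injective₁ = via 1F 6 1 (⊟ ec) ≡.refl
      (solve 1 (λ x → ⟦ map con (target 1F) ⟧ₑ x := x :* (x :^ 6 :- con (⊟ ec)) :^ 1) ≡.refl)

    injective₂ : ¬ IsPower commutativeRing 6 (φ (⊟ (ec ⊠^ 2))) → InjectiveTarget 2F
    injective₂ = via 2F 6 1 (⊟ (ec ⊠^ 2)) ≡.refl
      (solve 1 (λ x → ⟦ map con (target 2F) ⟧ₑ x := x :* (x :^ 6 :- con (⊟ (ec ⊠^ 2))) :^ 1) ≡.refl)

    injective₃ : ¬ IsPower commutativeRing 6 (φ (⊟ (ec ⊠^ 3))) → InjectiveTarget 3F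
    injective₃ = via 3F 6 1 (⊟ (ec ⊠^ 3)) ≡.refl
      (solve 1 (λ x → ⟦ map con (target 3F) ⟧ₑ x := x :* (x :^ 6 :- con (⊟ (ec ⊠^ 3))) :^ 1) ≡.refl)

    injective₄ : ¬ IsPower commutativeRing 6 (φ (⊟ (ec ⊠^ 4))) → InjectiveTarget 4F
    injective₄ = via 4F 6 1 (⊟ (ec ⊠^ 4)) ≡.refl
      (solve 1 (λ x → ⟦ map con (target 4F) ⟧ₑ x := x :* (x :^ 6 :- con (⊟ (ec ⊠^ 4))) :^ 1) ≡.refl)

    injective₅ : ¬ IsPower commutativeRing 6 (φ (⊟ (ec ⊠^ 5))) → InjectiveTarget 5F
    injective₅ = via 5F 6 1 (⊟ (ec ⊠^ 5)) ≡.refl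
      (solve 1 (λ x → ⟦ map con (target 5F) ⟧ₑ x := x :* (x :^ 6 :- con (⊟ (ec ⊠^ 5))) :^ 1) ≡.refl)

    injective₆ : ¬ IsPower commutativeRing 3 (φ (3 , 0)) → InjectiveTarget 6F
    -- Modulo 7, (x³ - 3)² = x⁶ - 6 x³ + 9 = x⁶ + x³ + 2.
    injective₆ = via 6F 3 2 (3 , 0) ≡.refl
      (solve 1 (λ x → ⟦ map con (target 6F) ⟧ₑ x := x :* (x :^ 3 :- con (3 , 0)) :^ 2) ≡.refl)

    injective₇ : ¬ IsPower commutativeRing 3 (φ ((3 , 0) ⊠ ec ⊠^ 2)) → InjectiveTarget 7F
    injective₇ = via 7F 3 2 ((3 , 0) ⊠ ec ⊠^ 2) ≡.refl
      (solve 1 (λ x → ⟦ map con (target 7F) ⟧ₑ x := x :* (x :^ 3 :- con ((3 , 0) ⊠ ec ⊠^ 2)) :^ 2) ≡.refl)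

    injective₈ : ¬ IsPower commutativeRing 2 (φ ((2 , 0) ⊠ ec)) → InjectiveTarget 8F
    -- Modulo 7, (x² - 2 e)³ = x⁶ - 6 e x⁴ + 12 e² x² - 8 e³ = x⁶ + e x⁴ + 5 e² x² + 6 e³.
    injective₈ = via 8F 2 3 ((2 , 0) ⊠ ec) ≡.refl
      (solve 1 (λ x → ⟦ map con (target 8F) ⟧ₑ x := x :* (x :^ 2 :- con ((2 , 0) ⊠ ec)) :^ 3) ≡.refl)

  module OverQuadratic {m} (E : Extension K m 3) where
    open OverExtension E public
    open RadicalForm (Extension.L E) algebra using (sixth⇒cube) public

    noncube : ∀ α → Every (λ c → not (c ⊠^ 3 ≐ α)) codes → _
    noncube α checked = lift-nonpower {α} (φ-nonpower 3 α checked)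

  module OverCubic {m} (E : Extension K m 2) where
    open OverExtension E public
    open RadicalForm (Extension.L E) algebra using (sixth⇒square) public

    nonsquare : ∀ α → Every (λ c → not (c ⊠^ 2 ≐ α)) codes → _
    nonsquare α checked = lift-nonpower {α} (φ-nonpower 2 α checked)

  permutation-over : ∀ {m n} (E : Extension K m n) k → OverExtension.InjectiveTarget E k →
    ∀ f → K.LinearlyRelated f (Vec.lookup K.forms (inject₁ k)) → IsPermutationPolynomialOverDegree K f m
  permutation-over E k inj f rel = L , order≡ , ι , ι-mono ,
    FiniteFieldProperties.injective⇒bijective L (PolynomialProperties.⟦⟧-cong (FiniteField.commutativeRing L) (map ι f))
      (related-injective⁻¹ {f} {form} rel (form-injective form (target (inject₁ k)) (K.forms≋target (inject₁ k)) inj))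
    where
    open Extension E
    open OverExtension E
    form = Vec.lookup K.forms (inject₁ k)

  exceptional-quadratic : ∀ k → (∀ {m} (E : Extension K m 3) → OverExtension.InjectiveTarget E k) →
    ∀ f → K.LinearlyRelated f (Vec.lookup K.forms (inject₁ k)) → Exceptional K f
  exceptional-quadratic k inj f rel N = 2 ℕ.^ N , n<b^n 0 N , permutation-over E k (inj E) f rel
    where E = quadraticTower K A (φ-nonpower 2 ec nonsquare-e) N

  exceptional-cubic : ∀ k → (∀ {m} (E : Extension K m 2) → OverExtension.InjectiveTarget E k) →
    ∀ f → K.LinearlyRelated f (Vec.lookup K.forms (inject₁ k)) → Exceptional K f
  exceptional-cubic k inj f rel N = 3 ℕ.^ N , n<b^n 1 N , permutation-over E k (inj E) f rel
    where E = cubicTower K A (φ-nonpower 3 ec noncube-e) N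

  forms-exceptional : ∀ k f → K.LinearlyRelated f (Vec.lookup K.forms (inject₁ k)) → Exceptional K f
  forms-exceptional 0F = exceptional-quadratic 0F (λ E → let open OverQuadratic E in injective₀)
  forms-exceptional 1F = exceptional-quadratic 1F (λ E → let open OverQuadratic E in
    injective₁ (noncube (⊟ ec) (every ≡.refl) ∘ sixth⇒cube))
  forms-exceptional 2F = exceptional-quadratic 2F (λ E → let open OverQuadratic E in
    injective₂ (noncube (⊟ (ec ⊠^ 2)) (every ≡.refl) ∘ sixth⇒cube))
  -- Among the binomials this one needs the cubic tower: - e³ = (- e)³ is a cube, so only its being
  -- a nonsquare keeps it from being a sixth power.
  forms-exceptional 3F = exceptional-cubic 3F (λ E → let open OverCubic E in
    injective₃ (nonsquare (⊟ (ec ⊠^ 3)) (every ≡.refl) ∘ sixth⇒square))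
  forms-exceptional 4F = exceptional-quadratic 4F (λ E → let open OverQuadratic E in
    injective₄ (noncube (⊟ (ec ⊠^ 4)) (every ≡.refl) ∘ sixth⇒cube))
  forms-exceptional 5F = exceptional-quadratic 5F (λ E → let open OverQuadratic E in
    injective₅ (noncube (⊟ (ec ⊠^ 5)) (every ≡.refl) ∘ sixth⇒cube))
  forms-exceptional 6F = exceptional-quadratic 6F (λ E → let open OverQuadratic E in
    injective₆ (noncube (3 , 0) (every ≡.refl)))
  forms-exceptional 7F = exceptional-quadratic 7F (λ E → let open OverQuadratic E in
    injective₇ (noncube ((3 , 0) ⊠ ec ⊠^ 2) (every ≡.refl)))
  forms-exceptional 8F = exceptional-cubic 8F (λ E → let open OverCubic E in
    injective₈ (nonsquare ((2 , 0) ⊠ ec) (every ≡.refl)))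

-- The sporadic polynomial over proper extensions of 𝔽₄₉

module CodeTransfer = Transfer _⊞_ _⊠_ 0c 1c

infixl 6 _⊞ₚ_
infixl 7 _⊠ₚ_
_⊞ₚ_ _⊠ₚ_ : CodePoly → CodePoly → CodePoly
[]      ⊞ₚ q       = q
(a ∷ p) ⊞ₚ []      = a ∷ p
(a ∷ p) ⊞ₚ (b ∷ q) = (a ⊞ b) ∷ (p ⊞ₚ q)
[]      ⊠ₚ q = []
(a ∷ p) ⊠ₚ q = map (a ⊠_) q ⊞ₚ (0c ∷ (p ⊠ₚ q))

conjugate : CodePoly → CodePoly
conjugate = map (_⊠^ 7)

g : CodePoly
g = target 9F

-- The transfer matrix of two equal digits, applied to a vector indexed by carries. The second digit
-- carries the conjugated coefficients; a second conjugation restores g, so the pattern repeats.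
twoSteps : CodePoly → (ℕ → Code) → ℕ → Code
twoSteps p κ = CodeTransfer.step p (CodeTransfer.step (conjugate p) κ)

opaque
  g² g³ : CodePoly
  g² = g ⊠ₚ g
  g³ = g ⊠ₚ g²

  length-g² : length g² ≡ 15
  length-g² = ≡.refl

  length-g³ : length g³ ≡ 22
  length-g³ = ≡.refl

  -- The transfer vector of the digits 2 and 2; it is an eigenvector of the corresponding
  -- transfer matrix, with eigenvalue μ.
  κ : ℕ → ℕ → Code
  κ s₀ = twoSteps g² (λ s → CodeTransfer.δ s s₀)

  κ-def : ∀ {s₀} → s₀ ≡ 1 ⊎ s₀ ≡ 2 → ∀ {s} → s ℕ.≤ 3 → twoSteps g² (λ s → CodeTransfer.δ s s₀) s ≡ κ s₀ s
  κ-def (inj₁ ≡.refl) {0} _ = ≡.refl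
  κ-def (inj₁ ≡.refl) {1} _ = ≡.refl
  κ-def (inj₁ ≡.refl) {2} _ = ≡.refl
  κ-def (inj₁ ≡.refl) {3} _ = ≡.refl
  κ-def (inj₂ ≡.refl) {0} _ = ≡.refl
  κ-def (inj₂ ≡.refl) {1} _ = ≡.refl
  κ-def (inj₂ ≡.refl) {2} _ = ≡.refl
  κ-def (inj₂ ≡.refl) {3} _ = ≡.refl
  κ-def _ {suc (suc (suc (suc _)))} (s≤s (s≤s (s≤s ())))

  μ : ℕ → Code
  μ s₀ = κ s₀ s₀

  -- A column s₀ holds the coefficients at 49 s₀ - s. Column 0 vanishes since g² has no constant
  -- term, column 3 since the degree is only 112. As g is odd, s and s₀ have equal parity, so
  -- columns 1 and 2 do not mix. Hence the matrix sends column s₀ to its diagonal entry times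
  -- itself.
  eigenvector : ∀ {s₀} → s₀ ≡ 1 ⊎ s₀ ≡ 2 → ∀ {s} → s ℕ.≤ 3 → twoSteps g² (κ s₀) s ≡ μ s₀ ⊠ κ s₀ s
  eigenvector (inj₁ ≡.refl) {0} _ = ≡.refl
  eigenvector (inj₁ ≡.refl) {1} _ = ≡.refl
  eigenvector (inj₁ ≡.refl) {2} _ = ≡.refl
  eigenvector (inj₁ ≡.refl) {3} _ = ≡.refl
  eigenvector (inj₂ ≡.refl) {0} _ = ≡.refl
  eigenvector (inj₂ ≡.refl) {1} _ = ≡.refl
  eigenvector (inj₂ ≡.refl) {2} _ = ≡.refl
  eigenvector (inj₂ ≡.refl) {3} _ = ≡.refl
  eigenvector _ {suc (suc (suc (suc _)))} (s≤s (s≤s (s≤s ())))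

  μ₂≡-μ₁ : μ 2 ≡ ⊟ μ 1
  μ₂≡-μ₁ = ≡.refl

  -- A 48th power equal to 1 certifies, in every field over 𝔽₄₉, that the element is not 0.
  μ₁-unit : μ 1 ⊠^ 48 ≡ 1c
  μ₁-unit = ≡.refl

  -- The diagonal entry at s₀ for the digits 3, 3 followed by digits 2, with the power of μ taken
  -- out.
  trace : ℕ → Code
  trace s₀ = twoSteps g³ (κ s₀) s₀

  trace-def : ∀ s₀ → twoSteps g³ (κ s₀) s₀ ≡ trace s₀
  trace-def s₀ = ≡.refl

  trace₁+trace₂-unit : (trace 1 ⊞ trace 2) ⊠^ 48 ≡ 1c
  trace₁+trace₂-unit = ≡.refl

  trace₁-trace₂-unit : (trace 1 ⊞ ⊟ trace 2) ⊠^ 48 ≡ 1c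
  trace₁-trace₂-unit = ≡.refl

module _ where
  open ℕ.≤-Reasoning

  -- A digit 2 has 15 coefficients, which amounts to 15 / 6 of q in the limit, below 3; a digit 3
  -- has 22, and 22 / 6 exceeds 3. Two digits 3 cost only the constant 22 · 8, and 112 < Q is
  -- exactly the room needed.
  degree-estimate : ∀ {d D Q} → d ≡ 22 ℕ.* 1 ℕ.+ (22 ℕ.* 7 ℕ.+ D) → 2 ℕ.* D ℕ.+ 5 ℕ.* 49 ≡ 5 ℕ.* suc Q →
    112 ℕ.< Q → d ℕ.< 3 ℕ.* Q
  degree-estimate {d} {D} {Q} d≡ D≡ 112<Q = ℕ.*-cancelˡ-< 2 _ _ (ℕ.+-cancelʳ-< 245 _ _ (begin-strict
    2 ℕ.* d ℕ.+ 245                                  ≡⟨ ≡.cong (λ d → 2 ℕ.* d ℕ.+ 245) d≡ ⟩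
    2 ℕ.* (22 ℕ.* 1 ℕ.+ (22 ℕ.* 7 ℕ.+ D)) ℕ.+ 245    ≡⟨ lemma D ⟩
    (2 ℕ.* D ℕ.+ 5 ℕ.* 49) ℕ.+ 352                   ≡⟨ ≡.cong (ℕ._+ 352) D≡ ⟩
    5 ℕ.* suc Q ℕ.+ 352                              ≡⟨ lemma₂ Q ⟩
    112 ℕ.+ (5 ℕ.* Q ℕ.+ 245)                        <⟨ ℕ.+-monoˡ-< (5 ℕ.* Q ℕ.+ 245) 112<Q ⟩
    Q ℕ.+ (5 ℕ.* Q ℕ.+ 245)                          ≡⟨ lemma₃ Q ⟩
    2 ℕ.* (3 ℕ.* Q) ℕ.+ 245                          ∎))
    where
    lemma : ∀ D → 2 ℕ.* (22 ℕ.* 1 ℕ.+ (22 ℕ.* 7 ℕ.+ D)) ℕ.+ 245 ≡ (2 ℕ.* D ℕ.+ 5 ℕ.* 49) ℕ.+ 352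
    lemma = solve-∀
    lemma₂ : ∀ Q → 5 ℕ.* suc Q ℕ.+ 352 ≡ 112 ℕ.+ (5 ℕ.* Q ℕ.+ 245)
    lemma₂ = solve-∀
    lemma₃ : ∀ Q → Q ℕ.+ (5 ℕ.* Q ℕ.+ 245) ≡ 2 ℕ.* (3 ℕ.* Q) ℕ.+ 245
    lemma₃ = solve-∀

  exponent-estimate : ∀ {E Q} → 3 ℕ.* E ℕ.+ 49 ≡ suc Q → 112 ℕ.< Q → 24 ℕ.+ E ℕ.< Q
  exponent-estimate {E} {Q} E≡ 112<Q = ℕ.*-cancelˡ-< 3 _ _ (ℕ.+-cancelʳ-< 49 _ _ (begin-strict
    3 ℕ.* (24 ℕ.+ E) ℕ.+ 49       ≡⟨ lemma E ⟩
    72 ℕ.+ (3 ℕ.* E ℕ.+ 49)       ≡⟨ ≡.cong (72 ℕ.+_) E≡ ⟩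
    72 ℕ.+ suc Q                  ≡⟨ lemma₂ Q ⟩
    24 ℕ.+ (Q ℕ.+ 49)             ≤⟨ ℕ.+-monoˡ-≤ (Q ℕ.+ 49) (ℕ.m≤m+n 24 88) ⟩
    112 ℕ.+ (Q ℕ.+ 49)            <⟨ ℕ.+-monoˡ-< (Q ℕ.+ 49) 112<Q ⟩
    Q ℕ.+ (Q ℕ.+ 49)              ≤⟨ ℕ.+-monoˡ-≤ (Q ℕ.+ 49) (ℕ.m≤m+n Q (Q ℕ.+ 0)) ⟩
    2 ℕ.* Q ℕ.+ (Q ℕ.+ 49)        ≡⟨ lemma₃ Q ⟩
    3 ℕ.* Q ℕ.+ 49                ∎))
    where
    lemma : ∀ E → 3 ℕ.* (24 ℕ.+ E) ℕ.+ 49 ≡ 72 ℕ.+ (3 ℕ.* E ℕ.+ 49)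
    lemma = solve-∀
    lemma₂ : ∀ Q → 72 ℕ.+ suc Q ≡ 24 ℕ.+ (Q ℕ.+ 49)
    lemma₂ = solve-∀
    lemma₃ : ∀ Q → 2 ℕ.* Q ℕ.+ (Q ℕ.+ 49) ≡ 3 ℕ.* Q ℕ.+ 49
    lemma₃ = solve-∀

module Nonexceptional {c ℓ₁ ℓ₂} (F : FiniteField c ℓ₁ ℓ₂) (A : F₄₉Algebra (FiniteField.commutativeRing F))
  (n Q-1 : ℕ) (order≡ : FiniteField.order F ≡ suc (suc Q-1)) (order≡49^ : FiniteField.order F ≡ 49 ℕ.^ (2 ℕ.+ n)) where
  open FiniteField F
  open FiniteFieldProperties F
  open Polynomial commutativeRing
  open PolynomialProperties commutativeRing
  open Scalars commutativeRing A
  open CodeValues commutativeRing A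
  open Symbolic
  open Solver using (con; _:=_; _:+_; _:*_; _:-_; :-_; _:^_)
  open Exp commutativeSemiring using (^-congˡ; ^-assocʳ; ^-homo-*)
  open SetoidReasoning ≈-setoid

  private
    q : ℕ
    q = 49 ℕ.^ (2 ℕ.+ n)

    2401≤q : 2401 ℕ.≤ q
    2401≤q = ≡.subst (ℕ._≤ q) (ℕ.*-identityʳ 2401) (≡.subst (2401 ℕ.* 1 ℕ.≤_) (ℕ.*-assoc 49 49 (49 ℕ.^ n))
      (ℕ.*-monoʳ-≤ 2401 (ℕ.m^n>0 49 n)))

  open Hermite F order≡ using (hermite; digitProduct; degreeBound; W; step; δ; Q)

  private
    q≡1+Q : q ≡ suc Q
    q≡1+Q = ≡.trans (≡.sym order≡49^) order≡

  -- The bound 28 = 4 · 7 keeps the next carry at most 3, the range in which h is known. A carry at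
  -- most 3 and at most 22 coefficients give 25.
  step-φ : ∀ p {h κ γ} → (∀ {t} → t ℕ.≤ 3 → h t ≈ γ * φ (κ t)) →
    ∀ s → s ℕ.+ length p ℕ.≤ 28 → step (φₚ p) h s ≈ γ * φ (CodeTransfer.step p κ s)
  step-φ []      {γ = γ} h≈ s s≤ = sym (zeroʳ γ)
  step-φ (a ∷ p) {h} {κ} {γ} h≈ s s≤ = begin
    φ a * (if does (7 ∣? s) then h (s / 7) else 0#) + step (φₚ p) h (suc s)
      ≈⟨ +-cong (*-congˡ (branch (does (7 ∣? s)))) (step-φ p h≈ (suc s) s+1≤) ⟩
    φ a * (γ * φ x) + γ * φ y
      ≈⟨ solve 4 (λ a γ x y → a :* (γ :* x) :+ γ :* y := γ :* (a :* x :+ y)) ≡.refl (φ a) γ (φ x) (φ y) ⟩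
    γ * (φ a * φ x + φ y)
      ≈⟨ *-congˡ (trans (φ-⊞ (a ⊠ x) y) (+-congʳ (φ-⊠ a x))) ⟨
    γ * φ (a ⊠ x ⊞ y) ∎
    where
    x = if does (7 ∣? s) then κ (s / 7) else 0c
    y = CodeTransfer.step p κ (suc s)
    s+1≤ : suc s ℕ.+ length p ℕ.≤ 28
    s+1≤ = ≡.subst (ℕ._≤ 28) (ℕ.+-suc s (length p)) s≤
    s/7≤3 : s / 7 ℕ.≤ 3
    s/7≤3 = ℕ.≤-pred (m<n*o⇒m/o<n {s} {4} {7} (ℕ.≤-trans (ℕ.m≤m+n (suc s) (length p)) s+1≤))
    branch : ∀ b → (if b then h (s / 7) else 0#) ≈ γ * φ (if b then κ (s / 7) else 0c)
    branch true  = h≈ s/7≤3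
    branch false = sym (zeroʳ γ)

  -- The digits 2 in base 7, lowest first.
  twos : ℕ → List Poly
  twos zero    = []
  twos (suc n) = φₚ g² ∷ φₚ (conjugate g²) ∷ twos n

  -- By `W-twos`, digits 2 alone would contribute μ₁ᵐ and (- μ₁)ᵐ, which cancel for odd m; the
  -- leading pair of digits 3 weights the two carries differently.
  digits : List Poly
  digits = φₚ g³ ∷ φₚ (conjugate g³) ∷ twos (suc n)

  two-steps : ∀ p cs {cs′} s₀ {κ γ} → cs′ ≡ φₚ p ∷ φₚ (conjugate p) ∷ cs → length p ℕ.≤ 22 → (∀ {t} → t ℕ.≤ 3 → W cs s₀ t ≈ γ * φ (κ t)) →
    ∀ {s} → s ℕ.≤ 3 → W cs′ s₀ s ≈ γ * φ (twoSteps p κ s)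
  two-steps p cs s₀ ≡.refl p≤22 W≈ {s} s≤3 = step-φ p (λ {t} t≤3 → step-φ (conjugate p) W≈ t
    (ℕ.≤-trans (ℕ.+-mono-≤ t≤3 (≡.subst (ℕ._≤ 22) (≡.sym (length-map (_⊠^ 7) p)) p≤22)) (ℕ.m≤m+n 25 3)))
    s (ℕ.≤-trans (ℕ.+-mono-≤ s≤3 p≤22) (ℕ.m≤m+n 25 3))

  private
    g²≤22 : length g² ℕ.≤ 22
    g²≤22 = ℕ.≤-trans (ℕ.≤-reflexive length-g²) (ℕ.m≤m+n 15 7)

  δ-φ : ∀ s₀ {t} → δ t s₀ ≈ 1# * φ (CodeTransfer.δ t s₀)
  δ-φ s₀ {t} = trans (branch (t ℕ.≡ᵇ s₀)) (sym (*-identityˡ _))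
    where
    branch : ∀ b → (if b then 1# else 0#) ≈ φ (if b then 1c else 0c)
    branch true  = refl
    branch false = refl

  W-two : ∀ {s₀} → s₀ ≡ 1 ⊎ s₀ ≡ 2 → ∀ {s} → s ℕ.≤ 3 → W (twos 1) s₀ s ≈ 1# * φ (κ s₀ s)
  W-two {s₀} ok {s} s≤3 = ≡.subst (λ x → W (twos 1) s₀ s ≈ 1# * φ x) (κ-def ok s≤3)
    (two-steps g² [] s₀ ≡.refl g²≤22 (λ {t} _ → δ-φ s₀ {t}) s≤3)

  W-twos-step : ∀ n {s₀ γ} → s₀ ≡ 1 ⊎ s₀ ≡ 2 → (∀ {s} → s ℕ.≤ 3 → W (twos n) s₀ s ≈ γ * φ (κ s₀ s)) →
    ∀ {s} → s ℕ.≤ 3 → W (twos (suc n)) s₀ s ≈ γ * φ (μ s₀ ⊠ κ s₀ s)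
  W-twos-step n {s₀} {γ} ok W≈ {s} s≤3 = ≡.subst (λ x → W (twos (suc n)) s₀ s ≈ γ * φ x) (eigenvector ok s≤3)
    (two-steps g² (twos n) s₀ {κ s₀} {γ} ≡.refl g²≤22 W≈ s≤3)

  -- The first pair of digits turns the unit vector at s₀ into κ, and each of the other n pairs adds
  -- a factor μ.
  W-twos : ∀ n {s₀} → s₀ ≡ 1 ⊎ s₀ ≡ 2 → ∀ {s} → s ℕ.≤ 3 →
    W (twos (suc n)) s₀ s ≈ φ (μ s₀) ^ n * φ (κ s₀ s)
  W-twos zero    ok = W-two ok
  W-twos (suc n) {s₀} ok {s} s≤3 = begin
    W (twos (suc (suc n))) s₀ s                  ≈⟨ W-twos-step (suc n) ok (W-twos n ok) s≤3 ⟩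
    φ (μ s₀) ^ n * φ (μ s₀ ⊠ κ s₀ s)             ≈⟨ *-congˡ (φ-⊠ (μ s₀) (κ s₀ s)) ⟩
    φ (μ s₀) ^ n * (φ (μ s₀) * φ (κ s₀ s))       ≈⟨ solve 3 (λ p m k → p :* (m :* k) := m :* p :* k) ≡.refl
                                                      (φ (μ s₀) ^ n) (φ (μ s₀)) (φ (κ s₀ s)) ⟩
    φ (μ s₀) ^ suc n * φ (κ s₀ s)                ∎

  W-digits : ∀ {s₀} → s₀ ≡ 1 ⊎ s₀ ≡ 2 → s₀ ℕ.≤ 3 → W digits s₀ s₀ ≈ φ (μ s₀) ^ n * φ (trace s₀)
  W-digits {s₀} ok s₀≤3 = trans (two-steps g³ (twos (suc n)) s₀ {κ = κ s₀} ≡.refl (ℕ.≤-reflexive length-g³) (W-twos n ok) s₀≤3)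
    (*-congˡ (reflexive (≡.cong φ (trace-def s₀))))

  -- A power equal to 1 survives interpretation, whereas φ x ≈ 0 would make that power 0.
  φ-unit-nonzero : ∀ x → x ⊠^ 48 ≡ 1c → φ x ≉ 0#
  φ-unit-nonzero x x⁴⁸≡1 φx≈0 = 1≉0 (trans (sym (trans (sym (φ-^ x 48)) (reflexive (≡.cong φ x⁴⁸≡1))))
    (trans (*-congʳ φx≈0) (zeroˡ _)))

  -- μ 2 = - μ 1, so the two eigenvalues contribute with equal or with opposite signs.
  W-digits-nonzero : W digits 1 1 + W digits 2 2 ≉ 0#
  W-digits-nonzero W≈0 = conclude (alternate n)
    where
    m = φ (μ 1)
    φμ₂≈-m : φ (μ 2) ≈ - m
    φμ₂≈-m = trans (reflexive (≡.cong φ μ₂≡-μ₁)) (φ-⊟ (μ 1))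
    alternate : ∀ n → φ (μ 2) ^ n ≈ m ^ n ⊎ φ (μ 2) ^ n ≈ - (m ^ n)
    alternate zero    = inj₁ refl
    alternate (suc n) with alternate n
    ... | inj₁ eq = inj₂ (trans (*-cong φμ₂≈-m eq) (solve 2 (λ m p → :- m :* p := :- (m :* p)) ≡.refl m (m ^ n)))
    ... | inj₂ eq = inj₁ (trans (*-cong φμ₂≈-m eq) (solve 2 (λ m p → :- m :* :- p := m :* p) ≡.refl m (m ^ n)))
    mⁿ≉0 : m ^ n ≉ 0#
    mⁿ≉0 = ^-nonzero n (φ-unit-nonzero (μ 1) μ₁-unit)
    sum≈0 : m ^ n * φ (trace 1) + φ (μ 2) ^ n * φ (trace 2) ≈ 0#
    sum≈0 = trans (sym (+-cong (W-digits (inj₁ ≡.refl) (s≤s z≤n)) (W-digits (inj₂ ≡.refl) (s≤s (s≤s z≤n))))) W≈0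
    conclude : φ (μ 2) ^ n ≈ m ^ n ⊎ φ (μ 2) ^ n ≈ - (m ^ n) → ⊥
    conclude (inj₁ eq) = *-nonzero mⁿ≉0 (φ-unit-nonzero (trace 1 ⊞ trace 2) trace₁+trace₂-unit) (begin
      m ^ n * φ (trace 1 ⊞ trace 2)                        ≈⟨ *-congˡ (φ-⊞ (trace 1) (trace 2)) ⟩
      m ^ n * (φ (trace 1) + φ (trace 2))                  ≈⟨ distribˡ _ _ _ ⟩
      m ^ n * φ (trace 1) + m ^ n * φ (trace 2)            ≈⟨ +-congˡ (*-congʳ eq) ⟨
      m ^ n * φ (trace 1) + φ (μ 2) ^ n * φ (trace 2)      ≈⟨ sum≈0 ⟩
      0#                                                   ∎)
    conclude (inj₂ eq) = *-nonzero mⁿ≉0 (φ-unit-nonzero (trace 1 ⊞ ⊟ trace 2) trace₁-trace₂-unit) (begin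
      m ^ n * φ (trace 1 ⊞ ⊟ trace 2)                      ≈⟨ *-congˡ (trans (φ-⊞ (trace 1) (⊟ trace 2)) (+-congˡ (φ-⊟ (trace 2)))) ⟩
      m ^ n * (φ (trace 1) - φ (trace 2))                  ≈⟨ solve 3 (λ p x y → p :* (x :- y) := p :* x :+ :- p :* y) ≡.refl (m ^ n) (φ (trace 1)) (φ (trace 2)) ⟩
      m ^ n * φ (trace 1) + - (m ^ n) * φ (trace 2)        ≈⟨ +-congˡ (*-congʳ eq) ⟨
      m ^ n * φ (trace 1) + φ (μ 2) ^ n * φ (trace 2)      ≈⟨ sum≈0 ⟩
      0#                                                   ∎)

  conjugate-eval : ∀ p x → ⟦ φₚ (conjugate p) ⟧ (x ^ 7) ≈ ⟦ φₚ p ⟧ x ^ 7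
  conjugate-eval p x = trans (⟦⟧-pointwise (pointwise p) (x ^ 7)) (frobenius (φₚ p) x)
    where
    pointwise : ∀ p → Pointwise _≈_ (φₚ (conjugate p)) (map (_^ 7) (φₚ p))
    pointwise []      = []
    pointwise (a ∷ p) = φ-^ a 7 ∷ pointwise p

  ^-swap : ∀ x m n → (x ^ m) ^ n ≈ (x ^ n) ^ m
  ^-swap x m n = trans (^-assocʳ x m n) (trans (reflexive (≡.cong (x ^_) (ℕ.*-comm m n))) (sym (^-assocʳ x n m)))

  opaque
    unfolding g²

    G : Carrier → Carrier
    G = ⟦ φₚ g ⟧

    G-cong : ∀ {x y} → x ≈ y → G x ≈ G y
    G-cong = ⟦⟧-cong (φₚ g)

    G-injective : Injective _≈_ _≈_ ⟦ φₚ (target 9F) ⟧ → Injective _≈_ _≈_ G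
    G-injective inj = inj

    g²-eval : ∀ x → ⟦ φₚ g² ⟧ x ≈ G x ^ 2
    g²-eval = solve 1 (λ x → ⟦ map con g² ⟧ₑ x := ⟦ map con g ⟧ₑ x :^ 2) ≡.refl

    g³-eval : ∀ x → ⟦ φₚ g³ ⟧ x ≈ G x ^ 3
    g³-eval = solve 1 (λ x → ⟦ map con g³ ⟧ₑ x := ⟦ map con g ⟧ₑ x :^ 3) ≡.refl

    -- Conjugating twice fixes the coefficients of g.
    G-49 : ∀ x → G (x ^ 49) ≈ G x ^ 49
    G-49 x = begin
      ⟦ φₚ (conjugate (conjugate g)) ⟧ (x ^ 49)       ≈⟨ ⟦⟧-cong (φₚ (conjugate (conjugate g))) (^-assocʳ x 7 7) ⟨
      ⟦ φₚ (conjugate (conjugate g)) ⟧ ((x ^ 7) ^ 7)  ≈⟨ conjugate-eval (conjugate g) (x ^ 7) ⟩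
      ⟦ φₚ (conjugate g) ⟧ (x ^ 7) ^ 7                ≈⟨ ^-congˡ 7 (conjugate-eval g x) ⟩
      (G x ^ 7) ^ 7                                   ≈⟨ ^-assocʳ (G x) 7 7 ⟩
      G x ^ 49                                        ∎

  opaque
    -- Here 16 = 2 + 2 · 7 is the value of one pair of digits, and the next pair has weight 49 N.
    twosExponent : ℕ → ℕ → ℕ
    twosExponent N zero    = 0
    twosExponent N (suc n) = 16 ℕ.* N ℕ.+ twosExponent (49 ℕ.* N) n

  private
    module _ (N : ℕ) (x : Carrier) (eq : G (x ^ N) ≈ G x ^ N) where
      low : ⟦ φₚ g² ⟧ (x ^ N) ≈ (G x ^ N) ^ 2
      low = trans (g²-eval (x ^ N)) (^-congˡ 2 eq)

      high : ⟦ φₚ (conjugate g²) ⟧ (x ^ (7 ℕ.* N)) ≈ ((G x ^ N) ^ 2) ^ 7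
      high = trans (⟦⟧-cong (φₚ (conjugate g²)) (trans (sym (^-assocʳ x 7 N)) (^-swap x 7 N)))
        (trans (conjugate-eval g² (x ^ N)) (^-congˡ 7 low))

      rest : G (x ^ (49 ℕ.* N)) ≈ G x ^ (49 ℕ.* N)
      rest = begin
        G (x ^ (49 ℕ.* N))  ≈⟨ G-cong (trans (sym (^-assocʳ x 49 N)) (^-swap x 49 N)) ⟩
        G ((x ^ N) ^ 49)    ≈⟨ G-49 (x ^ N) ⟩
        G (x ^ N) ^ 49      ≈⟨ ^-congˡ 49 eq ⟩
        (G x ^ N) ^ 49      ≈⟨ trans (^-swap (G x) N 49) (^-assocʳ (G x) 49 N) ⟩
        G x ^ (49 ℕ.* N)    ∎

    collect : ∀ y N E → ((y ^ N) ^ 2) * (((y ^ N) ^ 2) ^ 7 * y ^ E) ≈ y ^ (16 ℕ.* N ℕ.+ E)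
    collect y N E = begin
      (y ^ N) ^ 2 * (((y ^ N) ^ 2) ^ 7 * y ^ E)
        ≈⟨ solve 2 (λ y r → y :^ 2 :* ((y :^ 2) :^ 7 :* r) := y :^ 16 :* r) ≡.refl (y ^ N) (y ^ E) ⟩
      (y ^ N) ^ 16 * y ^ E
        ≈⟨ *-congʳ (trans (^-swap y N 16) (^-assocʳ y 16 N)) ⟩
      y ^ (16 ℕ.* N) * y ^ E
        ≈⟨ ^-homo-* y (16 ℕ.* N) E ⟨
      y ^ (16 ℕ.* N ℕ.+ E) ∎

  opaque
    unfolding twosExponent

    digitProduct-twos : ∀ n N x → G (x ^ N) ≈ G x ^ N → digitProduct N (twos n) x ≈ G x ^ twosExponent N n
    digitProduct-twos zero    N x eq = refl
    digitProduct-twos (suc n) N x eq = trans (*-cong (low N x eq) (*-cong (high N x eq) tail))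
      (collect (G x) N (twosExponent (49 ℕ.* N) n))
      where
      tail : digitProduct (7 ℕ.* (7 ℕ.* N)) (twos n) x ≈ G x ^ twosExponent (49 ℕ.* N) n
      tail = ≡.subst (λ N′ → digitProduct N′ (twos n) x ≈ G x ^ twosExponent (49 ℕ.* N) n) (ℕ.*-assoc 7 7 N)
        (digitProduct-twos n (49 ℕ.* N) x (rest N x eq))

  private
    collect-digits : ∀ y E → y ^ 3 * ((y ^ 3) ^ 7 * y ^ E) ≈ y ^ (24 ℕ.+ E)
    collect-digits y E = trans (solve 2 (λ y r → y :^ 3 :* ((y :^ 3) :^ 7 :* r) := y :^ 24 :* r) ≡.refl y (y ^ E))
      (sym (^-homo-* y 24 E))

  digitProduct-digits : ∀ x → digitProduct 1 digits x ≈ G x ^ (24 ℕ.+ twosExponent 49 (suc n))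
  digitProduct-digits x = trans
    (*-cong (trans (⟦⟧-cong (φₚ g³) (*-identityʳ x)) (g³-eval x))
      (*-cong (trans (conjugate-eval g³ x) (^-congˡ 7 (g³-eval x))) (digitProduct-twos (suc n) 49 x (G-49 x))))
    (collect-digits (G x) (twosExponent 49 (suc n)))

  opaque
    unfolding twosExponent

    -- A geometric series with 3 · 16 = 49 - 1, stated without subtraction or division.
    3*twosExponent : ∀ n N → 3 ℕ.* twosExponent N n ℕ.+ N ≡ 49 ℕ.^ n ℕ.* N
    3*twosExponent zero    N = ≡.sym (ℕ.+-identityʳ N)
    3*twosExponent (suc n) N = ≡.trans (lemma N (twosExponent (49 ℕ.* N) n))
      (≡.trans (3*twosExponent n (49 ℕ.* N)) (lemma′ (49 ℕ.^ n) N))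
      where
      lemma : ∀ N k → 3 ℕ.* (16 ℕ.* N ℕ.+ k) ℕ.+ N ≡ 3 ℕ.* k ℕ.+ 49 ℕ.* N
      lemma = solve-∀
      lemma′ : ∀ m N → m ℕ.* (49 ℕ.* N) ≡ 49 ℕ.* m ℕ.* N
      lemma′ = solve-∀

  degreeBound-∷ : ∀ N c cs → degreeBound N (c ∷ cs) ≡ length c ℕ.* N ℕ.+ degreeBound (7 ℕ.* N) cs
  degreeBound-∷ N []      cs = ≡.refl
  degreeBound-∷ N (a ∷ c) cs = ≡.trans (≡.cong (N ℕ.+_) (degreeBound-∷ N c cs)) (≡.sym (ℕ.+-assoc N (length c ℕ.* N) (degreeBound (7 ℕ.* N) cs)))

  degreeBound-two-digits : ∀ N p cs {l} → length p ≡ l → degreeBound N (φₚ p ∷ φₚ (conjugate p) ∷ cs) ≡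
    l ℕ.* N ℕ.+ (l ℕ.* (7 ℕ.* N) ℕ.+ degreeBound (7 ℕ.* (7 ℕ.* N)) cs)
  degreeBound-two-digits N p cs ≡.refl = ≡.trans (degreeBound-∷ N (φₚ p) (φₚ (conjugate p) ∷ cs)) (≡.cong₂ ℕ._+_
    (≡.cong (ℕ._* N) (length-map φ p))
    (≡.trans (degreeBound-∷ (7 ℕ.* N) (φₚ (conjugate p)) cs)
      (≡.cong (λ l → l ℕ.* (7 ℕ.* N) ℕ.+ degreeBound (7 ℕ.* (7 ℕ.* N)) cs)
        (≡.trans (length-map φ (conjugate p)) (length-map (_⊠^ 7) p)))))

  -- The same series for the coefficient counts: 2 · 15 · (1 + 7) = 5 · (49 - 1).
  2*degreeBound : ∀ n N → 2 ℕ.* degreeBound N (twos n) ℕ.+ 5 ℕ.* N ≡ 5 ℕ.* (49 ℕ.^ n ℕ.* N)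
  2*degreeBound zero    N = ≡.cong (5 ℕ.*_) (≡.sym (ℕ.+-identityʳ N))
  2*degreeBound (suc n) N = ≡.trans (≡.cong (λ d → 2 ℕ.* d ℕ.+ 5 ℕ.* N) expand)
    (≡.trans (lemma N (degreeBound (7 ℕ.* (7 ℕ.* N)) (twos n)))
      (≡.trans (2*degreeBound n (7 ℕ.* (7 ℕ.* N))) (lemma′ (49 ℕ.^ n) N)))
    where
    expand : degreeBound N (twos (suc n)) ≡ 15 ℕ.* N ℕ.+ (15 ℕ.* (7 ℕ.* N) ℕ.+ degreeBound (7 ℕ.* (7 ℕ.* N)) (twos n))
    expand = degreeBound-two-digits N g² (twos n) length-g²
    lemma : ∀ N d → 2 ℕ.* (15 ℕ.* N ℕ.+ (15 ℕ.* (7 ℕ.* N) ℕ.+ d)) ℕ.+ 5 ℕ.* N ≡ 2 ℕ.* d ℕ.+ 5 ℕ.* (7 ℕ.* (7 ℕ.* N))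
    lemma = solve-∀
    lemma′ : ∀ m N → 5 ℕ.* (m ℕ.* (7 ℕ.* (7 ℕ.* N))) ≡ 5 ℕ.* (49 ℕ.* m ℕ.* N)
    lemma′ = solve-∀

  7^length-twos : ∀ n → 7 ℕ.^ length (twos n) ≡ 49 ℕ.^ n
  7^length-twos zero    = ≡.refl
  7^length-twos (suc n) = ≡.trans (≡.sym (ℕ.*-assoc 7 7 (7 ℕ.^ length (twos n)))) (≡.cong (49 ℕ.*_) (7^length-twos n))

  private
    D E : ℕ
    D = degreeBound 49 (twos (suc n))
    E = twosExponent 49 (suc n)

    q≡ : 49 ℕ.^ suc n ℕ.* 49 ≡ q
    q≡ = ℕ.*-comm (49 ℕ.^ suc n) 49

    114≤q : 114 ℕ.≤ suc Q
    114≤q = ℕ.≤-trans (ℕ.m≤m+n 114 2287) (≡.subst (2401 ℕ.≤_) q≡1+Q 2401≤q)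

    degree-small : degreeBound 1 digits ℕ.< 3 ℕ.* Q
    degree-small = degree-estimate (degreeBound-two-digits 1 g³ (twos (suc n)) length-g³)
      (≡.trans (2*degreeBound (suc n) 49) (≡.cong (5 ℕ.*_) (≡.trans q≡ q≡1+Q))) (ℕ.≤-pred 114≤q)

    exponent-small : 24 ℕ.+ E ℕ.< Q
    exponent-small = exponent-estimate (≡.trans (3*twosExponent (suc n) 49) (≡.trans q≡ q≡1+Q)) (ℕ.≤-pred 114≤q)

  not-injective : ¬ Injective _≈_ _≈_ ⟦ φₚ (target 9F) ⟧
  not-injective inj = W-digits-nonzero (hermite digits
    (≡.trans (≡.cong (λ m → 7 ℕ.* (7 ℕ.* m)) (7^length-twos (suc n)))
      (≡.trans (≡.sym (ℕ.*-assoc 7 7 (49 ℕ.^ suc n))) (≡.sym order≡49^)))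
    degree-small G-cong (G-injective inj) (23 ℕ.+ E) exponent-small digitProduct-digits)

-- Characteristic 7 and the two classifications

-- The square of 7 · 1 is 49 · 1, which vanishes because 49 is the order.
characteristic-7 : ∀ {c ℓ₁ ℓ₂} (K : FiniteField c ℓ₁ ℓ₂) →
  let open FiniteField K
      open Polynomial commutativeRing
  in order ≡ 49 → 7 · 1# ≈ 0#
characteristic-7 K order≡49 = ^-zero 2 (begin
  (7 · 1#) ^ 2           ≈⟨ *-congˡ (*-identityʳ _) ⟩
  (7 · 1#) * (7 · 1#)    ≈⟨ ×1-homo-* 7 7 ⟨
  49 · 1#                ≡⟨ ≡.cong (_· 1#) order≡49 ⟨
  order · 1#             ≈⟨ order·1≈0 ⟩
  0#                     ∎)
  where
  open FiniteField K
  open FiniteFieldProperties K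
  open Polynomial commutativeRing
  open Mult semiring using (×1-homo-*)
  open SetoidReasoning ≈-setoid

module _ {c ℓ₁ ℓ₂} (K : FiniteField c ℓ₁ ℓ₂) (order≡49 : FiniteField.order K ≡ 49)
  (A : F₄₉Algebra (FiniteField.commutativeRing K)) where
  open FiniteField K
  open Polynomial commutativeRing
  open Classification K order≡49 A
  open Uniqueness K order≡49 A
  open Field49 K order≡49 A
  open CodeValues commutativeRing A
  open ExceptionalForms K order≡49 A

  private
    2≤49^ : ∀ n → 2 ℕ.≤ 49 ℕ.^ (2 ℕ.+ n)
    2≤49^ n = ℕ.≤-trans (ℕ.m≤m+n 2 47) (ℕ.*-monoʳ-≤ 49 {1} (ℕ.m^n>0 49 (suc n)))

  sporadicForm-not-injective : ∀ n (L : FiniteField c ℓ₁ ℓ₂) → FiniteField.order L ≡ order ℕ.^ (2 ℕ.+ n) →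
    ∀ {ι} → IsRingMonomorphism rawRing (FiniteField.rawRing L) ι →
    ¬ Injective (FiniteField._≈_ L) (FiniteField._≈_ L) (Polynomial.⟦_⟧ (FiniteField.commutativeRing L) (map ι sporadicForm))
  sporadicForm-not-injective n L L-order {ι} ι-mono inj =
    not-injective (form-injective⁻¹ sporadicForm (target 9F) (forms≋target 9F) inj)
    where
    open AlongExtension K L ι-mono A
    L-order≡ : FiniteField.order L ≡ 49 ℕ.^ (2 ℕ.+ n)
    L-order≡ = ≡.trans L-order (≡.cong (ℕ._^ (2 ℕ.+ n)) order≡49)
    2≤L-order : 2 ℕ.≤ FiniteField.order L
    2≤L-order = ≡.subst (2 ℕ.≤_) (≡.sym L-order≡) (2≤49^ n)
    open Nonexceptional L algebra n (FiniteField.order L ℕ.∸ 2) (≡.sym (ℕ.m+[n∸m]≡n 2≤L-order)) L-order≡ using (not-injective)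

  sporadicForm-nonexceptional : ∀ {f} → LinearlyRelated f sporadicForm → ¬ Exceptional K f
  -- Asking for m > 1 skips K itself, over which the form is a permutation polynomial.
  sporadicForm-nonexceptional {f} rel exc with exc 1
  ... | suc (suc n) , _ , L , L-order , ι , ι-mono , f-inj , _ =
    sporadicForm-not-injective n L L-order ι-mono
      (AlongExtension.related-injective K L ι-mono A {f} {sporadicForm} rel f-inj)
  ... | suc zero , s≤s () , _

  classification-nonexceptional : ∀ f → HasDegree f 7 → IsPermutationPolynomial K f → ¬ Exceptional K f →
    LinearlyRelated f sporadicForm
  classification-nonexceptional f deg (f-inj , _) nonexc = conclude (classification f deg f-inj)
    where
    conclude : RelatedToTarget f → LinearlyRelated f sporadicForm
    conclude (i , f∼) with view i
    ... | ‵fromℕ     = ∼-target⇒linearlyRelated {f} 9F (proj₂ deg) f∼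
    ... | ‵inject₁ k = contradiction (forms-exceptional k f (∼-target⇒linearlyRelated {f} (inject₁ k) (proj₂ deg) f∼)) nonexc

  -- A permutation of any extension restricts to K, since f has its coefficients there; so one value
  -- of m is enough to start the classification.
  exceptional-injective : ∀ f → Exceptional K f → Injective _≈_ _≈_ ⟦ f ⟧
  exceptional-injective f exc with exc 0
  ... | _ , _ , L , _ , ι , ι-mono , f-inj , _ = AlongExtension.descend-injective K L ι-mono A f f-inj

  classification-exceptional : ∀ f → HasDegree f 7 → Exceptional K f →
    ∃! _≡_ λ (k : Fin 9) → LinearlyRelated f (Vec.lookup exceptionalForms k)
  classification-exceptional f deg exc = proj₁ found , proj₂ found , λ {k} rel →
    -- Two forms related to f are related to each other through f.
    targets-distinct (proj₁ found) k (∼-trans {φₚ (target (inject₁ (proj₁ found)))} {f} {φₚ (target (inject₁ k))}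
      (∼-sym {f} {φₚ (target (inject₁ (proj₁ found)))} (target-related (proj₁ found) (proj₂ found)))
      (target-related k rel))
    where
    target-related : ∀ k → LinearlyRelated f (Vec.lookup exceptionalForms k) → f ∼ φₚ (target (inject₁ k))
    target-related k rel = ∼-form⇒∼-target {f} (inject₁ k) (linearlyRelated⇒∼ {f} {Vec.lookup forms (inject₁ k)}
      (≡.subst (LinearlyRelated f) (≡.sym (exceptionalForms-lookup k)) rel))
    find-form : RelatedToTarget f → ∃[ k ] LinearlyRelated f (Vec.lookup exceptionalForms k)
    find-form (i , f∼) with view i
    ... | ‵fromℕ     = contradiction exc (sporadicForm-nonexceptional {f} (∼-target⇒linearlyRelated {f} 9F (proj₂ deg) f∼))
    ... | ‵inject₁ k = k , ≡.subst (LinearlyRelated f) (exceptionalForms-lookup k)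
      (∼-target⇒linearlyRelated {f} (inject₁ k) (proj₂ deg) f∼)
    found = find-form (classification f deg (exceptional-injective f exc))

proposition16 :
    ∀ {c ℓ₁ ℓ₂} (K : FiniteField c ℓ₁ ℓ₂) →
    let open FiniteField K
        open Polynomial commutativeRing
    in
    order ≡ 7 ℕ.^ 2 →
    (e : Carrier) → e ^ 2 + 6 · e + 3 · 1# ≈ 0# →
    (∀ f → HasDegree f 7 → IsPermutationPolynomial K f → ¬ Exceptional K f →
      LinearlyRelated f
        (1# X^ 7 ⊕ e X^ 5 ⊕ (e ^ 18) X^ 3 ⊕ (e ^ 35) X^ 1))
    ×
    (∀ f → HasDegree f 7 → Exceptional K f →
      ∃! _≡_ λ (i : Fin 9) → LinearlyRelated f (lookup
        ( (1# X^ 7 ⊕ 0# X^ 1)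
        ∷ (1# X^ 7 ⊕ e X^ 1)
        ∷ (1# X^ 7 ⊕ (e ^ 2) X^ 1)
        ∷ (1# X^ 7 ⊕ (e ^ 3) X^ 1)
        ∷ (1# X^ 7 ⊕ (e ^ 4) X^ 1)
        ∷ (1# X^ 7 ⊕ (e ^ 5) X^ 1)
        ∷ (1# X^ 7 ⊕ 1# X^ 4 ⊕ (2 · 1#) X^ 1)
        ∷ (1# X^ 7 ⊕ (e ^ 2) X^ 4 ⊕ (2 · e ^ 4) X^ 1)
        ∷ (1# X^ 7 ⊕ e X^ 5 ⊕ (5 · e ^ 2) X^ 3 ⊕ (6 · e ^ 3) X^ 1)
        ∷ []) i))
proposition16 K order≡49 e e-root =
  classification-nonexceptional K order≡49 A , classification-exceptional K order≡49 A
  where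
  A : F₄₉Algebra (FiniteField.commutativeRing K)
  A = record { e = e ; 7≈0 = characteristic-7 K order≡49 ; e-root = e-root }
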